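{- For all integers $a,l,p,w\geq 0$ there exists an integer $N$ with the following property. If $G$ is a $p$-connected graph of tree-width less than $w$ with at least $N$ vertices, then either $G$ contains a subdivision of $K_{a,p}$, or $G$ has a stable regular decomposition of length at least $l$, adhesion at most $w$, and attachedness $p$.
   Context: Let $G$ be a graph. For a subgraph $S\subseteq G$, an $S$-bridge in $G$ is either a single edge of $G$ not in $S$ with both ends in $S$ (a trivial bridge), or, for a component $C$ of $G-S$, the subgraph consisting of all edges of $G$ with at least one end in $C$ together with their ends (a non-trivial bridge). Its attachments are its vertices in $S$; it attaches to $S'\subseteq S$ if it has an attachment in $S'$. A linkage is a set of disjoint paths; for a linkage $\mathcal{Q}$, a $\mathcal{Q}$-bridge means a bridge of the graph $\bigcup\mathcal{Q}$. A linkage from $X$ to $Y$ (with $|X|=|Y|$) is a set of $|X|$ disjoint $X$--$Y$ paths. For a tuple $\mathcal{W}=(W_0,\ldots,W_l)$ of subsets of $V(G)$: $l$ is its length, the $W_i$ are bags, the sets $W_{i-1}\cap W_i$ ($1\le i\le l$) are adhesion sets, $W_1,\ldots,W_{l-1}$ are inner bags, and for an inner bag $W_i$ the sets $W_{i-1}\cap W_i$ and $W_i\cap W_{i+1}$ are its left and right adhesion sets. $\mathcal{W}$ is a slim decomposition of $G$ if (L1) $\bigcup_i W_i=V(G)$ and every edge lies in some $G[W_i]$; (L2) $W_i\cap W_k\subseteq W_j$ whenever $i\le j\le k$; (L3) all adhesion sets have the same size $q$ (the adhesion); (L4) no bag contains another; (L5) $G$ contains a linkage from $W_0\cap W_1$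 to $W_{l-1}\cap W_l$. Such a linkage together with an enumeration $P_1,\ldots,P_q$ of its paths (possibly trivial) is a foundational linkage for $\mathcal{W}$; each $P_\alpha$ contains exactly one vertex of each adhesion set, its $\alpha$-vertex. For an inner bag $W$, $P_\alpha[W]$ is the subpath of $P_\alpha$ between the left and right $\alpha$-vertex of $W$ and $\mathcal{P}[W]=\{P_\alpha[W]\}$. If $\mathcal{Q}$ is a linkage in $G[W_i\cup\dots\cup W_j]$ from the left adhesion set of $W_i$ to the right adhesion set of $W_j$, enumerate it by letting $Q_\alpha$ be its path starting at the left $\alpha$-vertex of $W_i$; its induced permutation $\pi$ is defined by: $Q_\alpha$ ends at the right $\pi(\alpha)$-vertex of $W_j$. For a subgraph $H$ and a linkage $\mathcal{Q}=\{Q_1,\ldots,Q_q\}$ in $H$, the bridge graph $B(H,\mathcal{Q})$ has vertex set $\{1,\ldots,q\}$, with $\alpha\beta$ an edge iff some $\mathcal{Q}$-bridge in $H$ attaches to both $Q_\alpha$ and $Q_\beta$. The auxiliary graph is $\Gamma(\mathcal{W},\mathcal{P})=B(G[W_1\cup\dots\cup W_{l-1}],\mathcal{P}')$ where $\mathcal{P}'$ is the restriction of $\mathcal{P}$ to $G[W_1\cup\dots\cup W_{l-1}]$ with the induced enumeration. A linkage $\mathcal{Q}$ in a graph $H$ is $p$-attached if each path of $\mathcal{Q}$ is an induced path of $H$ and whenever a non-trivial $\mathcal{Q}$-bridge in $H$ attaches to a non-trivial path $P$ of $\mathcal{Q}$, either it attaches to another non-trivial path of $\mathcal{Q}$, or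 there are at least $p-2$ trivial paths $Q$ of $\mathcal{Q}$ such that $H$ contains a $\mathcal{Q}$-bridge attaching to both $P$ and $Q$. A pair $(\mathcal{W},\mathcal{P})$ of a slim decomposition and a foundational linkage is a regular decomposition of attachedness $p$ if (L6) $\mathcal{P}[W]$ is $p$-attached in $G[W]$ for every inner bag $W$; (L7) a path $P_\alpha$ is trivial whenever $P_\alpha[W]$ is trivial for some inner bag $W$; (L8) for all $\alpha,\beta$, if for some inner bag $W$ the graph $G[W]$ contains a $\mathcal{P}[W]$-bridge attaching to $P_\alpha[W]$ and $P_\beta[W]$, then this holds for every inner bag. Let $\lambda=\{\alpha: P_\alpha\text{ non-trivial}\}$. A regular decomposition is stable if for every inner bag $W$ and every linkage $\mathcal{Q}$ in $G[W]$ from the left to the right adhesion set of $W$: (L10) the induced permutation of $\mathcal{Q}$ is an automorphism of $\Gamma(\mathcal{W},\mathcal{P})$, and (L11) every edge of $B(G[W],\mathcal{Q})$ with at least one end in $\lambda$ is an edge of $\Gamma(\mathcal{W},\mathcal{P})$. -}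

module Defs where

open import Data.Nat using (ℕ; zero; suc; _≤_; _<_; _∸_; pred)
open import Data.Fin using (Fin)
open import Data.Fin.Subset using (Subset; _∈_; _∉_; _⊆_; _∩_; ∣_∣)
open import Data.Bool using (Bool; true; false)
open import Data.List using (List; []; _∷_; _++_; [_]; length)
open import Data.List.Membership.Propositional using () renaming (_∈_ to _∈ₗ_)
open import Data.List.Relation.Unary.Unique.Propositional using (Unique)
open import Data.List.Relation.Unary.Linked using (Linked)
open import Data.Product using (Σ; ∃; ∃₂; _×_; _,_)
open import Data.Sum using (_⊎_)
open import Data.Unit using (⊤)
open import Data.Empty using (⊥)
open import Relation.Nullary using (¬_)
open import Relation.Binary.PropositionalEquality using (_≡_; _≢_)
open import Function.Definitions using (Injective)

record Graph : Set where
  field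
    n     : ℕ
    adj   : Fin n → Fin n → Bool
    sym   : ∀ x y → adj x y ≡ adj y x
    irrefl : ∀ x → adj x x ≡ false

open Graph public

module _ (G : Graph) where

  V = Fin (n G)

  Edge : V → V → Set
  Edge x y = adj G x y ≡ true

  data Reach (P : V → Set) : V → V → Set where
    here : ∀ {x} → P x → Reach P x x
    step : ∀ {x y z} → P x → Edge x y → Reach P y z → Reach P x z

  ConnectedOn : (V → Set) → Set
  ConnectedOn P = ∀ x y → P x → P y → Reach P x y

  IsPath : List V → Set
  IsPath L = (L ≢ []) × Unique L × Linked Edge L

  HasCycle : Set
  HasCycle = Σ V λ x → Σ V λ y → Σ (List V) λ mid →
    IsPath (x ∷ mid ++ [ y ]) × (mid ≢ []) × Edge y x

  Connected : ℕ → Set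
  Connected p = (p < n G) ×
    (∀ (X : Subset (n G)) → ∣ X ∣ < p → ConnectedOn (λ v → v ∉ X))

IsTree : Graph → Set
IsTree T = (1 ≤ n T) × ConnectedOn T (λ _ → ⊤) × ¬ HasCycle T

-- a tree decomposition of G all of whose bags have at most k vertices
-- (i.e. of width at most k - 1)
record TreeDecomposition (G : Graph) (k : ℕ) : Set where
  field
    T      : Graph
    tree   : IsTree T
    bag    : Fin (n T) → Subset (n G)
    covers : ∀ v → ∃ λ t → v ∈ bag t
    edges  : ∀ u v → Edge G u v → ∃ λ t → u ∈ bag t × v ∈ bag t
    coh    : ∀ v → ConnectedOn T (λ t → v ∈ bag t)
    small  : ∀ t → ∣ bag t ∣ ≤ k

-- tree-width less than w  (width = max bag size - 1 < w)
TreeWidthLess : Graph → ℕ → Set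
TreeWidthLess G w = TreeDecomposition G w

StartsAt : {A : Set} → List A → A → Set
StartsAt L x = ∃ λ xs → L ≡ x ∷ xs

EndsAt : {A : Set} → List A → A → Set
EndsAt L y = ∃ λ xs → L ≡ xs ++ [ y ]

Consec : {A : Set} → List A → A → A → Set
Consec L u v = ∃₂ λ ls rs → L ≡ ls ++ (u ∷ v ∷ rs)

PathEdge : {A : Set} → List A → A → A → Set
PathEdge L u v = Consec L u v ⊎ Consec L v u

Infix : {A : Set} → List A → List A → Set
Infix Q P = ∃₂ λ ls rs → P ≡ ls ++ (Q ++ rs)

Trivial : {A : Set} → List A → Set
Trivial L = length L ≡ 1

NonTrivial : {A : Set} → List A → Set
NonTrivial L = ¬ Trivial L

record SubdivisionK (G : Graph) (a b : ℕ) : Set where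
  field
    A      : Fin a → V G
    B      : Fin b → V G
    A-inj  : Injective _≡_ _≡_ A
    B-inj  : Injective _≡_ _≡_ B
    AB     : ∀ i j → A i ≢ B j
    path   : Fin a → Fin b → List (V G)
    isPath : ∀ i j → IsPath G (path i j)
    start  : ∀ i j → StartsAt (path i j) (A i)
    end    : ∀ i j → EndsAt (path i j) (B j)
    inner-A : ∀ i j i' v → v ∈ₗ path i j → v ≡ A i' → i' ≡ i
    inner-B : ∀ i j j' v → v ∈ₗ path i j → v ≡ B j' → j' ≡ j
    disj   : ∀ i j i' j' v → ¬ (i ≡ i' × j ≡ j') →
             v ∈ₗ path i j → v ∈ₗ path i' j' →
             (∃ λ k → v ≡ A k) ⊎ (∃ λ k → v ≡ B k)

module _ (G : Graph) where

  Linkage : (U X Y : V G → Set) (q : ℕ) → (Fin q → List (V G)) → Set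
  Linkage U X Y q Q =
    (∀ α → IsPath G (Q α) × (∀ v → v ∈ₗ Q α → U v)
           × (∃ λ x → StartsAt (Q α) x × X x)
           × (∃ λ y → EndsAt (Q α) y × Y y)) ×
    (∀ α β v → α ≢ β → v ∈ₗ Q α → v ∈ₗ Q β → ⊥)

  -- Bridges of a linkage given by the vertex sets Vs α and edge sets Es α
  -- of its paths (α : Fin q), inside the host H = G[U].
  module Bridges (U : V G → Set) {q : ℕ}
                 (Vs : Fin q → V G → Set)
                 (Es : Fin q → V G → V G → Set) where

    InS : V G → Set
    InS v = ∃ λ γ → Vs γ v

    Out : V G → Set
    Out v = U v × ¬ InS v

    -- some Q-bridge in H attaches to both the α-th and the β-th path
    Attaches2 : Fin q → Fin q → Set
    Attaches2 α β =
      -- a trivial bridge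
      (Σ (V G) λ u → Σ (V G) λ v → U u × U v × Edge G u v ×
         ¬ (∃ λ γ → Es γ u v) × Vs α u × Vs β v)
      ⊎
      -- a non-trivial bridge (component of H - ⋃Q containing c and c')
      (Σ (V G) λ u → Σ (V G) λ v → Σ (V G) λ c → Σ (V G) λ c' →
         Vs α u × Vs β v × Out c × Out c' × Reach G Out c c' ×
         Edge G u c × Edge G v c')

    BEdge : Fin q → Fin q → Set
    BEdge α β = α ≢ β × Attaches2 α β

    -- the non-trivial bridge whose component contains c attaches to path α
    NTAttach : V G → Fin q → Set
    NTAttach c α = Out c × Σ (V G) λ c' → Σ (V G) λ u →
      Reach G Out c c' × Vs α u × Edge G c' u

  LV : {q : ℕ} → (Fin q → List (V G)) → Fin q → V G → Set
  LV Q α v = v ∈ₗ Q α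

  LE : {q : ℕ} → (Fin q → List (V G)) → Fin q → V G → V G → Set
  LE Q α u v = PathEdge (Q α) u v

  Attached : ℕ → (U : V G → Set) → {q : ℕ} → (Fin q → List (V G)) → Set
  Attached p U {q} Q =
    (∀ α → ∀ u v → u ∈ₗ Q α → v ∈ₗ Q α → Edge G u v → PathEdge (Q α) u v) ×
    (∀ α c → NonTrivial (Q α) → NTAttach c α →
       (∃ λ β → β ≢ α × NonTrivial (Q β) × NTAttach c β)
       ⊎
       (Σ (Fin (p ∸ 2) → Fin q) λ f → Injective _≡_ _≡_ f ×
          (∀ k → Trivial (Q (f k)) × Attaches2 α (f k))))
    where open Bridges U (LV Q) (LE Q)

-- Slim decompositions (bags W 0, ..., W L; values W i for i > L unused)

module _ (G : Graph) where

  Adh : (ℕ → Subset (n G)) → ℕ → Subset (n G)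
  Adh W i = W i ∩ W (suc i)

  Inner : ℕ → ℕ → Set
  Inner L i = (1 ≤ i) × (i < L)

  record Slim (L q : ℕ) (W : ℕ → Subset (n G)) : Set where
    field
      length≥1 : 1 ≤ L
      L1-vert  : ∀ v → ∃ λ i → i ≤ L × v ∈ W i
      L1-edge  : ∀ u v → Edge G u v → ∃ λ i → i ≤ L × u ∈ W i × v ∈ W i
      L2       : ∀ i j k → i ≤ j → j ≤ k → k ≤ L → (W i ∩ W k) ⊆ W j
      L3       : ∀ i → i < L → ∣ Adh W i ∣ ≡ q
      L4       : ∀ i j → i ≤ L → j ≤ L → i ≢ j → ¬ (W i ⊆ W j)
      L5       : ∃ λ (Q : Fin q → List (V G)) →
                   Linkage G (λ _ → ⊤) (λ v → v ∈ Adh W 0)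
                             (λ v → v ∈ Adh W (L ∸ 1)) q Q

  InnerUnion : ℕ → (ℕ → Subset (n G)) → V G → Set
  InnerUnion L W v = ∃ λ i → Inner L i × v ∈ W i

  RV : ℕ → (ℕ → Subset (n G)) → {q : ℕ} → (Fin q → List (V G)) →
       Fin q → V G → Set
  RV L W P α v = v ∈ₗ P α × InnerUnion L W v

  RE : ℕ → (ℕ → Subset (n G)) → {q : ℕ} → (Fin q → List (V G)) →
       Fin q → V G → V G → Set
  RE L W P α u v = PathEdge (P α) u v × InnerUnion L W u × InnerUnion L W v

  ΓEdge : ℕ → (ℕ → Subset (n G)) → {q : ℕ} → (Fin q → List (V G)) →
          Fin q → Fin q → Set
  ΓEdge L W P = Bridges.BEdge G (InnerUnion L W) (RV L W P) (RE L W P)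

  Automorphism : {q : ℕ} → (Fin q → Fin q → Set) → (Fin q → Fin q) → Set
  Automorphism R π =
    (Σ (_ → _) λ σ → (∀ x → σ (π x) ≡ x) × (∀ y → π (σ y) ≡ y)) ×
    (∀ α β → (R α β → R (π α) (π β)) × (R (π α) (π β) → R α β))

  record StableRegular (p L q : ℕ) (W : ℕ → Subset (n G))
                       (P : Fin q → List (V G)) : Set where
    field
      slim        : Slim L q W
      foundational : Linkage G (λ _ → ⊤) (λ v → v ∈ Adh W 0)
                              (λ v → v ∈ Adh W (L ∸ 1)) q P
      -- PW i α = P_α[W_i], the subpath of P_α between its (unique) vertex
      -- in the left adhesion set and its vertex in the right adhesion set
      PW          : ℕ → Fin q → List (V G)
      PW-sub      : ∀ i α → Inner L i →
                      Infix (PW i α) (P α) ×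
                      (∃ λ x → StartsAt (PW i α) x × x ∈ Adh W (pred i)) ×
                      (∃ λ y → EndsAt (PW i α) y × y ∈ Adh W i)
      L6          : ∀ i → Inner L i → Attached G p (λ v → v ∈ W i) (PW i)
      L7          : ∀ α i → Inner L i → Trivial (PW i α) → Trivial (P α)
      L8          : ∀ α β i j → Inner L i → Inner L j →
                      Bridges.Attaches2 G (λ v → v ∈ W i) (LV G (PW i)) (LE G (PW i)) α β →
                      Bridges.Attaches2 G (λ v → v ∈ W j) (LV G (PW j)) (LE G (PW j)) α β
      -- stability: for every linkage Q in G[W_i] from left to right adhesion
      -- set, enumerated so that Q_α starts at the left α-vertex of W_i,
      -- with induced permutation π
      L10         : ∀ i → Inner L i → (Q : Fin q → List (V G)) →
                      Linkage G (λ v → v ∈ W i) (λ v → v ∈ Adh W (pred i))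
                                (λ v → v ∈ Adh W i) q Q →
                      (∀ α → ∃ λ x → StartsAt (PW i α) x × StartsAt (Q α) x) →
                      (π : Fin q → Fin q) →
                      (∀ α → ∃ λ y → EndsAt (Q α) y × EndsAt (PW i (π α)) y) →
                      Automorphism (ΓEdge L W P) π
      L11         : ∀ i → Inner L i → (Q : Fin q → List (V G)) →
                      Linkage G (λ v → v ∈ W i) (λ v → v ∈ Adh W (pred i))
                                (λ v → v ∈ Adh W i) q Q →
                      (∀ α → ∃ λ x → StartsAt (PW i α) x × StartsAt (Q α) x) →
                      ∀ α β →
                      Bridges.BEdge G (λ v → v ∈ W i) (LV G Q) (LE G Q) α β →
                      (NonTrivial (P α) ⊎ NonTrivial (P β)) →
                      ΓEdge L W P α β

-- A large graph of bounded tree-width has, at some bag, either many components, in which fans to common ends give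
-- a subdivision of K_{a,p}, or it has a long chain of nested separations of order at most w. By Menger's theorem,
-- consecutive separations are linked or lie around one of smaller order, so a long chain of separations of one order q
-- with q disjoint paths across every bag remains. Merging consecutive bags makes each of finitely many properties of
-- bags hold everywhere or nowhere. Rerouting inside a bag makes its linkage p-attached without losing edges of the
-- bridge graph at non-trivial paths: it strictly enlarges the set of vertices in bridges that attach to two
-- non-trivial paths, or shortens the linkage. Finally, if a linkage in one bag of every block violates stability,
-- using it in all these blocks yields a regular decomposition whose auxiliary graph has more edges with a non-trivial
-- end, which can happen at most q² times.

module Submission where

open import Defs
open import Data.Nat using (ℕ; zero; suc; _+_; _*_; _∸_; _≤_; _<_; z≤n; s≤s; pred; _≤?_; _<?_)
import Data.Nat.Properties as ℕₚ
open import Data.Fin using (Fin; zero; suc; _≟_; combine)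
import Data.Fin.Properties as Finₚ
open import Data.Fin.Subset using (Subset; _∈_; _∉_; _⊆_; _∩_; _∪_; ∣_∣; ⁅_⁆; _-_) renaming (⊤ to full; ⊥ to ∅)
import Data.Fin.Subset.Properties as Subₚ
open import Data.Bool using (true; false)
import Data.Bool.Properties as Boolₚ
open import Data.List using (List; []; _∷_; _++_; [_]; length; filter; drop)
import Data.List
import Data.List.Properties as Listₚ
open import Data.List.Membership.Propositional using () renaming (_∈_ to _∈ₗ_)
import Data.List.Membership.Propositional.Properties as Memₚ
open import Data.List.Relation.Unary.Any using (here; there)
open import Data.List.Relation.Unary.All using (All; []; _∷_)
import Data.List.Relation.Unary.All as All
open import Data.List.Relation.Unary.AllPairs using ([]; _∷_)
open import Data.List.Relation.Unary.Unique.Propositional using (Unique)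
import Data.List.Relation.Unary.Unique.Propositional.Properties as Uniqueₚ
open import Data.List.Relation.Unary.Linked using (Linked; []; [-]; _∷_)
open import Data.Vec using (Vec; []; _∷_; lookup; tabulate)
import Data.Vec.Base as Vec
import Data.Vec.Properties as Vecₚ
open import Data.Product using (Σ; ∃; ∃₂; _×_; _,_; proj₁; proj₂)
open import Data.Sum using (_⊎_; inj₁; inj₂) renaming (map to map-⊎)
open import Data.Unit using (⊤; tt)
open import Data.Empty using (⊥; ⊥-elim)
open import Function using (_∘_; id; case_of_)
open import Function.Definitions using (Injective)
open import Relation.Nullary using (¬_; Dec; yes; no; does)
open import Relation.Nullary.Decidable using (_×-dec_; _⊎-dec_; ¬?; map′; dec-true; _→-dec_)
import Relation.Binary.Definitions
open import Relation.Unary using (Decidable)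
open import Relation.Binary.PropositionalEquality using (_≡_; _≢_; refl; cong; cong₂; subst; trans) renaming (sym to ≡sym)

-- A separation is encoded by a single set `A` with boundary `∂ A`. A decomposition is then a
-- strictly increasing sequence of sets, and merging bags means passing to a subsequence. A vertex
-- off the paths lies in only one bag, so each component of a merged bag minus the paths lives in
-- one of its parts, and merging unites bridge graphs. The obstacle is that the required properties
-- disturb each other: rerouting changes the bridge graph, and a linkage that violates stability
-- permutes the labels of all later bags and need not be p-attached. Progress is therefore measured
-- by a lower bound on the number of edges with a non-trivial end, which survives merging, rerouting
-- and relabelling; uniformity and attachedness are rebuilt after each gain, hence the nested
-- bounds. Edges between two trivial paths cannot be counted, as a detour may destroy them; but they
-- cannot violate stability under a permutation either, because induced permutations fix trivial
-- labels.

-- Exhaustive search over finite domains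

private variable
  ν ξ : ℕ

-- Replaces excluded middle in searches: `Q` collects whatever a failing instance yields, so `P`
-- itself need not be decidable.
all⊎ : {P : Fin ν → Set} {Q : Set} → (∀ i → P i ⊎ Q) → (∀ i → P i) ⊎ Q
all⊎ {ν = zero} f = inj₁ λ ()
all⊎ {ν = suc _} f with f zero | all⊎ (f ∘ suc)
... | inj₂ q | _      = inj₂ q
... | inj₁ p | inj₂ q = inj₂ q
... | inj₁ p | inj₁ g = inj₁ λ { zero → p ; (suc i) → g i }

all<⊎ : ∀ ν {P : ℕ → Set} {Q : Set} → (∀ i → i < ν → P i ⊎ Q) → (∀ i → i < ν → P i) ⊎ Q
all<⊎ zero f = inj₁ λ _ ()
all<⊎ (suc ν) f with f 0 (s≤s z≤n) | all<⊎ ν (λ i i<m → f (suc i) (s≤s i<m))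
... | inj₂ q | _      = inj₂ q
... | inj₁ p | inj₂ q = inj₂ q
... | inj₁ p | inj₁ g = inj₁ λ { zero _ → p ; (suc i) (s≤s i<m) → g i i<m }

allLists⊎ : ∀ ξ {P : List (Fin ν) → Set} {Q : Set} → (∀ L → P L ⊎ Q) →
            (∀ L → length L ≤ ξ → P L) ⊎ Q
allLists⊎ ξ {P} f with f []
... | inj₂ q = inj₂ q
allLists⊎ zero f | inj₁ p = inj₁ λ { [] _ → p }
allLists⊎ (suc ξ) {P} f | inj₁ p with all⊎ (λ x → allLists⊎ ξ (λ L → f (x ∷ L)))
... | inj₂ q = inj₂ q
... | inj₁ g = inj₁ λ { [] _ → p ; (x ∷ L) (s≤s l) → g x L l }

allVecs⊎ : ∀ q ξ {P : Vec (List (Fin ν)) q → Set} {Q : Set} → (∀ v → P v ⊎ Q) →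
           (∀ v → (∀ i → length (lookup v i) ≤ ξ) → P v) ⊎ Q
allVecs⊎ zero ξ f with f []
... | inj₁ p = inj₁ λ { [] _ → p }
... | inj₂ q = inj₂ q
allVecs⊎ (suc q) ξ f with allLists⊎ ξ (λ L → allVecs⊎ q ξ (λ v → f (L ∷ v)))
... | inj₂ r = inj₂ r
... | inj₁ g = inj₁ λ { (L ∷ v) h → g L (h zero) v (h ∘ suc) }

-- `choose` fills the arguments outside the range with the junk value y₀.
choose : ∀ M {Y : Set} {P : ℕ → Y → Set} → Y → (∀ i → i < M → ∃ (P i)) →
         ∃ λ (f : ℕ → Y) → ∀ i → i < M → P i (f i)
choose zero y₀ h = (λ _ → y₀) , λ _ ()
choose (suc M) y₀ h with h 0 (s≤s z≤n) | choose M y₀ (λ i l → h (suc i) (s≤s l))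
... | y , py | f , pf = (λ { zero → y ; (suc i) → f i }) , λ { zero _ → py ; (suc i) (s≤s l) → pf i l }

-- Finite subsets and counting

abstract

  toSub : {P : Fin ν → Set} → Decidable P → Subset ν
  toSub P? = tabulate (does ∘ P?)

  ∈toSub⁺ : {P : Fin ν → Set} (P? : Decidable P) → ∀ {x} → P x → x ∈ toSub P?
  ∈toSub⁺ P? {x} px = Vecₚ.lookup⇒[]= x _ (trans (Vecₚ.lookup∘tabulate (does ∘ P?) x) (dec-true (P? x) px))

  ∈toSub⁻ : {P : Fin ν → Set} (P? : Decidable P) → ∀ {x} → x ∈ toSub P? → P x
  ∈toSub⁻ P? {x} x∈ = decide (P? x) (trans (≡sym (Vecₚ.lookup∘tabulate (does ∘ P?) x)) (Vecₚ.[]=⇒lookup x∈))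
    where
    decide : ∀ {A : Set} (d : Dec A) → does d ≡ true → A
    decide (yes a) _ = a
    decide (no _) ()

_∈L?_ : (x : Fin ν) (L : List (Fin ν)) → Dec (x ∈ₗ L)
_∈L?_ = DecMem._∈?_
  where import Data.List.Membership.DecPropositional Finₚ._≟_ as DecMem

∣∪∣≤ : (p q : Subset ν) → ∣ p ∪ q ∣ ≤ ∣ p ∣ + ∣ q ∣
∣∪∣≤ [] [] = z≤n
∣∪∣≤ (true ∷ p) (true ∷ q) = s≤s (ℕₚ.≤-trans (∣∪∣≤ p q) (ℕₚ.+-monoʳ-≤ ∣ p ∣ (ℕₚ.n≤1+n _)))
∣∪∣≤ (true ∷ p) (false ∷ q) = s≤s (∣∪∣≤ p q)
∣∪∣≤ (false ∷ p) (true ∷ q) = ℕₚ.≤-trans (s≤s (∣∪∣≤ p q)) (ℕₚ.≤-reflexive (≡sym (ℕₚ.+-suc ∣ p ∣ ∣ q ∣)))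
∣∪∣≤ (false ∷ p) (false ∷ q) = ∣∪∣≤ p q

∣∣≤-insert : (p : Subset ν) (x : Fin ν) → ∣ p ∪ ⁅ x ⁆ ∣ ≤ suc ∣ p ∣
∣∣≤-insert p x = ℕₚ.≤-trans (∣∪∣≤ p ⁅ x ⁆)
  (ℕₚ.≤-reflexive (trans (cong (∣ p ∣ +_) (Subₚ.∣⁅x⁆∣≡1 x)) (ℕₚ.+-comm ∣ p ∣ 1)))

∣∣≤-remove : (p : Subset ν) (x : Fin ν) → ∣ p ∣ ≤ suc ∣ p - x ∣
∣∣≤-remove p x = ℕₚ.≤-trans (Subₚ.p⊆q⇒∣p∣≤∣q∣ sub) (∣∣≤-insert (p - x) x)
  where
  sub : p ⊆ (p - x) ∪ ⁅ x ⁆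
  sub {y} y∈ with y ≟ x
  ... | yes refl = Subₚ.x∈p∪q⁺ (inj₂ (Subₚ.x∈⁅x⁆ x))
  ... | no y≢x   = Subₚ.x∈p∪q⁺ (inj₁ (Subₚ.x∈p∧x≢y⇒x∈p-y y∈ y≢x))

x∉p-x : (p : Subset ν) (x : Fin ν) → x ∉ p - x
x∉p-x (s ∷ p) zero ()
x∉p-x (s ∷ p) (suc x) (Vec.there x∈) = x∉p-x p x x∈

∈-remove⁻ : (p : Subset ν) (x : Fin ν) → ∀ {y} → y ∈ p - x → y ∈ p × y ≢ x
∈-remove⁻ p x y∈ = Subₚ.p─q⊆p p ⁅ x ⁆ y∈ , λ { refl → x∉p-x p x y∈ }

nonempty : (p : Subset ν) → 0 < ∣ p ∣ → ∃ λ x → x ∈ p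
nonempty {ν = ν} p 0<p with Subₚ.nonempty? p
... | yes ne = ne
... | no e   = ⊥-elim (ℕₚ.<⇒≢ 0<p (≡sym (trans (cong ∣_∣ (Subₚ.Empty-unique e)) (Subₚ.∣⊥∣≡0 ν))))

injective⇒≤∣∣ : (S : Subset ν) (g : Fin ξ → Fin ν) → Injective _≡_ _≡_ g → (∀ i → g i ∈ S) → ξ ≤ ∣ S ∣
injective⇒≤∣∣ {ξ = zero} S g inj g∈ = z≤n
injective⇒≤∣∣ {ξ = suc ξ} S g inj g∈ = ℕₚ.≤-trans
  (s≤s (injective⇒≤∣∣ (S - g zero) (g ∘ suc) (Finₚ.suc-injective ∘ inj)
          (λ i → Subₚ.x∈p∧x≢y⇒x∈p-y (g∈ (suc i)) (λ e → case inj e of λ ()))))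
  (Subₚ.x∈p⇒∣p-x∣<∣p∣ (g∈ zero))

-- This is how q disjoint paths, each with an end in a boundary of size q, come to use up that
-- boundary.
injective⇒onto : (S : Subset ν) (g : Fin ξ → Fin ν) → Injective _≡_ _≡_ g → (∀ i → g i ∈ S) →
                 ∣ S ∣ ≤ ξ → ∀ {v} → v ∈ S → ∃ λ i → v ≡ g i
injective⇒onto S g inj g∈ S≤k {v} v∈ with Finₚ.any? (λ i → v ≟ g i)
... | yes found = found
... | no ¬found = ⊥-elim (ℕₚ.<-irrefl refl (ℕₚ.<-≤-trans (ℕₚ.≤-<-trans k≤ (Subₚ.x∈p⇒∣p-x∣<∣p∣ v∈)) S≤k))
  where
  k≤ = injective⇒≤∣∣ (S - v) g inj (λ i → Subₚ.x∈p∧x≢y⇒x∈p-y (g∈ i) (λ e → ¬found (i , ≡sym e)))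

enumerate : ∀ ξ (S : Subset ν) → ξ ≤ ∣ S ∣ →
            ∃ λ (g : Fin ξ → Fin ν) → Injective _≡_ _≡_ g × (∀ i → g i ∈ S)
enumerate zero S k≤ = (λ ()) , (λ { {()} }) , λ ()
enumerate (suc ξ) S k≤ with nonempty S (ℕₚ.<-≤-trans (s≤s z≤n) k≤)
... | x , x∈ with enumerate ξ (S - x) (ℕₚ.≤-pred (ℕₚ.≤-trans k≤ (∣∣≤-remove S x)))
... | g , inj , g∈ = g′ , inj′ , λ { zero → x∈ ; (suc i) → proj₁ (∈-remove⁻ S x (g∈ i)) }
  where
  g′ : Fin (suc ξ) → Fin _
  g′ zero = x
  g′ (suc i) = g i
  inj′ : Injective _≡_ _≡_ g′
  inj′ {zero} {zero} e = refl
  inj′ {zero} {suc j} e = ⊥-elim (proj₂ (∈-remove⁻ S x (g∈ j)) (≡sym e))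
  inj′ {suc i} {zero} e = ⊥-elim (proj₂ (∈-remove⁻ S x (g∈ i)) e)
  inj′ {suc i} {suc j} e = cong suc (inj e)

unique⇒length≤ : (S : Subset ν) (L : List (Fin ν)) → Unique L → (∀ v → v ∈ₗ L → v ∈ S) → length L ≤ ∣ S ∣
unique⇒length≤ S [] u sub = z≤n
unique⇒length≤ S (x ∷ L) (x∉ ∷ u) sub = ℕₚ.≤-trans
  (s≤s (unique⇒length≤ (S - x) L u
     (λ v v∈ → Subₚ.x∈p∧x≢y⇒x∈p-y (sub v (there v∈)) (λ e → All.lookup x∉ v∈ (≡sym e)))))
  (Subₚ.x∈p⇒∣p-x∣<∣p∣ (sub x (here refl)))

injective⇒inverse : (π : Fin ξ → Fin ξ) → Injective _≡_ _≡_ π →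
  ∃ λ (σ : Fin ξ → Fin ξ) → (∀ x → σ (π x) ≡ x) × (∀ y → π (σ y) ≡ y)
injective⇒inverse {ξ = ξ} π inj = σ , (λ x → inj (πσ (π x))) , πσ
  where
  onto : ∀ y → ∃ λ i → y ≡ π i
  onto y = injective⇒onto full π inj (λ _ → Subₚ.∈⊤) (ℕₚ.≤-reflexive (Subₚ.∣⊤∣≡n ξ)) Subₚ.∈⊤
  σ = proj₁ ∘ onto
  πσ : ∀ y → π (σ y) ≡ y
  πσ y = ≡sym (proj₂ (onto y))

injective-pairs⇒≤ : ∀ e q (f : Fin e → Fin q × Fin q) → Injective _≡_ _≡_ f → e ≤ q * q
injective-pairs⇒≤ e q f inj = Finₚ.injective⇒≤ {f = λ i → combine (proj₁ (f i)) (proj₂ (f i))}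
  λ {i} {j} eq → let a , b = Finₚ.combine-injective (proj₁ (f i)) (proj₂ (f i)) (proj₁ (f j)) (proj₂ (f j)) eq
                 in inj (cong₂ _,_ a b)

-- Walks and Menger's theorem

infixr 5 _⊙_
_⊙_ : {A : Set} → List A → List A → List A
L ⊙ L′ = L ++ drop 1 L′

∈-⊙⁻ : {A : Set} (L : List A) {L′ : List A} {v : A} → v ∈ₗ L ⊙ L′ → v ∈ₗ L ⊎ v ∈ₗ L′
∈-⊙⁻ L {L′} v∈ with Memₚ.∈-++⁻ L v∈
... | inj₁ v∈L = inj₁ v∈L
∈-⊙⁻ L {_ ∷ _} v∈ | inj₂ v∈L′ = inj₂ (there v∈L′)

data Walk {A : Set} (E : A → A → Set) : A → A → List A → Set where
  nil  : ∀ {x} → Walk E x x (x ∷ [])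
  cons : ∀ {x y z L} → E x y → Walk E y z L → Walk E x z (x ∷ L)

module _ {A : Set} {E : A → A → Set} where

  walk-head : ∀ {x y L} → Walk E x y L → ∃ λ post → L ≡ x ∷ post
  walk-head nil = _ , refl
  walk-head (cons _ _) = _ , refl

  walk-last : ∀ {x y L} → Walk E x y L → ∃ λ pre → L ≡ pre ++ [ y ]
  walk-last nil = [] , refl
  walk-last (cons {x = x} e w) with walk-last w
  ... | pre , eq = x ∷ pre , cong (x ∷_) eq

  start∈ : ∀ {x y L} → Walk E x y L → x ∈ₗ L
  start∈ nil = here refl
  start∈ (cons _ _) = here refl

  end∈ : ∀ {x y L} → Walk E x y L → y ∈ₗ L
  end∈ nil = here refl
  end∈ (cons _ w) = there (end∈ w)

  walk-map : ∀ {E′ : A → A → Set} → (∀ {u v} → E u v → E′ u v) → ∀ {x y L} → Walk E x y L → Walk E′ x y L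
  walk-map f nil = nil
  walk-map f (cons e w) = cons (f e) (walk-map f w)

  walk-join : ∀ {x y y′ z L L′} → Walk E x y L → E y y′ → Walk E y′ z L′ → Walk E x z (L ++ L′)
  walk-join nil e w′ = cons e w′
  walk-join (cons d w) e w′ = cons d (walk-join w e w′)

  walk-glue : ∀ {x y z L L′} → Walk E x y L → Walk E y z L′ → Walk E x z (L ⊙ L′)
  walk-glue nil nil = nil
  walk-glue nil (cons e w) = cons e w
  walk-glue (cons d w) w′ = cons d (walk-glue w w′)

  ∈-⊙⁺ʳ : ∀ {x y z L L′ v} → Walk E x y L → Walk E y z L′ → v ∈ₗ L′ → v ∈ₗ L ⊙ L′
  ∈-⊙⁺ʳ w nil (here refl) = Memₚ.∈-++⁺ˡ (end∈ w)
  ∈-⊙⁺ʳ w (cons _ _) (here refl) = Memₚ.∈-++⁺ˡ (end∈ w)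
  ∈-⊙⁺ʳ {L = L} w (cons _ _) (there v∈) = Memₚ.∈-++⁺ʳ L v∈

  walk-split : ∀ {x y} pre {v post} → Walk E x y (pre ++ v ∷ post) →
               Walk E x v (pre ++ [ v ]) × Walk E v y (v ∷ post)
  walk-split [] nil = nil , nil
  walk-split [] (cons e w) = nil , cons e w
  walk-split (_ ∷ []) (cons e w) with walk-split [] w
  ... | nil , w₂ = cons e nil , w₂
  walk-split (_ ∷ pre@(_ ∷ _)) (cons e w) with walk-split pre w
  ... | w₁ , w₂ = cons e w₁ , w₂

  walk-prefix : ∀ {x y} pre {v post} → Walk E x y (pre ++ post) → v ∈ₗ pre →
                ∃ λ L → Walk E x v L × (∀ {z} → z ∈ₗ L → z ∈ₗ pre)
  walk-prefix (_ ∷ _) w (here refl) with walk-head w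
  ... | _ , refl = _ , nil , λ { (here refl) → here refl }
  walk-prefix (_ ∷ pre@(_ ∷ _)) (cons e w) (there v∈) with walk-prefix pre w v∈
  ... | L , w′ , sub = _ , cons e w′ , λ { (here refl) → here refl ; (there z∈) → there (sub z∈) }

  walk-suffix : ∀ {x y L v} → Walk E x y L → v ∈ₗ L → ∃ λ L′ → Walk E v y L′ × (∀ {z} → z ∈ₗ L′ → z ∈ₗ L)
  walk-suffix nil (here refl) = _ , nil , id
  walk-suffix w@(cons _ _) (here refl) = _ , w , id
  walk-suffix (cons e w) (there v∈) with walk-suffix w v∈
  ... | L′ , w′ , sub = L′ , w′ , there ∘ sub

  first-hit : ∀ {T : A → Set} → Decidable T → ∀ {x y L} → Walk E x y L → T y →
              ∃₂ λ y′ pre → Walk E x y′ (pre ++ [ y′ ]) × T y′ × All (¬_ ∘ T) pre ×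
                            (∀ {z} → z ∈ₗ pre ++ [ y′ ] → z ∈ₗ L)
  first-hit T? nil ty = _ , [] , nil , ty , [] , id
  first-hit T? (cons {x = x} e w) ty with T? x
  ... | yes tx = x , [] , nil , tx , [] , λ { (here refl) → here refl }
  ... | no ¬tx with first-hit T? w ty
  ... | y′ , pre , w′ , ty′ , a , sub =
    y′ , x ∷ pre , cons e w′ , ty′ , ¬tx ∷ a , λ { (here refl) → here refl ; (there z∈) → there (sub z∈) }

  last-hit : ∀ {T : A → Set} → Decidable T → ∀ {x y L} → Walk E x y L → T x →
             ∃₂ λ x′ post → Walk E x′ y (x′ ∷ post) × T x′ × All (¬_ ∘ T) post ×
                            (∀ {z} → z ∈ₗ x′ ∷ post → z ∈ₗ L)
  last-hit T? {x = x} w tx with go w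
    where
    go : ∀ {x y L} → Walk E x y L →
         (∃₂ λ x′ post → Walk E x′ y (x′ ∷ post) × _ × All (¬_ ∘ _) post × (∀ {z} → z ∈ₗ x′ ∷ post → z ∈ₗ L))
         ⊎ All (¬_ ∘ _) L
    go {x = x} nil with T? x
    ... | yes tx = inj₁ (_ , [] , nil , tx , [] , id)
    ... | no ¬tx = inj₂ (¬tx ∷ [])
    go {x = x} (cons e w) with go w | T? x
    ... | inj₁ (x′ , post , w′ , tx′ , a , sub) | _ = inj₁ (x′ , post , w′ , tx′ , a , there ∘ sub)
    ... | inj₂ a | yes tx = inj₁ (x , _ , cons e w , tx , a , id)
    ... | inj₂ a | no ¬tx = inj₂ (¬tx ∷ a)
  ... | inj₁ r = r
  ... | inj₂ a = ⊥-elim (All.lookup a (start∈ w) tx)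

walk-erase : ∀ {m} {E : Fin m → Fin m → Set} {x y L} → Walk E x y L →
             ∃ λ L′ → Walk E x y L′ × Unique L′ × (∀ {z} → z ∈ₗ L′ → z ∈ₗ L)
walk-erase nil = _ , nil , ([] ∷ []) , id
walk-erase {E = E} {y = y} (cons {x = x} e w) with walk-erase w
... | L′ , w′ , u , sub with x ∈L? L′
... | no x∉ = _ , cons e w′ , (All.tabulate (λ { z∈ refl → x∉ z∈ }) ∷ u) ,
              λ { (here refl) → here refl ; (there z∈) → there (sub z∈) }
... | yes x∈ = let L″ , w″ , u″ , sub″ = suffix w′ u x∈ in L″ , w″ , u″ , there ∘ sub ∘ sub″
  where
  suffix : ∀ {x′ L v} → Walk E x′ y L → Unique L → v ∈ₗ L →
           ∃ λ L″ → Walk E v y L″ × Unique L″ × (∀ {z} → z ∈ₗ L″ → z ∈ₗ L)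
  suffix nil u (here refl) = _ , nil , u , id
  suffix w@(cons _ _) u (here refl) = _ , w , u , id
  suffix (cons e w) (_ ∷ u) (there v∈) with suffix w u v∈
  ... | L″ , w″ , u″ , sub = L″ , w″ , u″ , there ∘ sub

module _ {m : ℕ} where

  record DisjointWalks (E : Fin m → Fin m → Set) (A B : Subset m) (k : ℕ) : Set where
    field
      s t   : Fin k → Fin m
      L     : Fin k → List (Fin m)
      walk  : ∀ i → Walk E (s i) (t i) (L i)
      s∈    : ∀ i → s i ∈ A
      t∈    : ∀ i → t i ∈ B
      disj  : ∀ i j v → v ∈ₗ L i → v ∈ₗ L j → i ≡ j

  Separator : (E : Fin m → Fin m → Set) (A B : Subset m) (k : ℕ) → Set
  Separator E A B k = ∃ λ X → ∣ X ∣ < k ×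
    (∀ {x y L} → Walk E x y L → x ∈ A → y ∈ B → ∃ λ v → v ∈ₗ L × v ∈ X)

  -- Menger's theorem is proved for directed graphs given by a list of arcs, so that the induction
  -- can add one arc at a time; an undirected graph lists both directions of every edge.
  Arc : List (Fin m × Fin m) → Fin m → Fin m → Set
  Arc es u v = (u , v) ∈ₗ es

  private

    split-at-tail : ∀ {x y es u v L} → Walk (Arc ((x , y) ∷ es)) u v L →
                    Walk (Arc es) u v L ⊎ (∃ λ L′ → Walk (Arc es) u x L′ × (∀ {z} → z ∈ₗ L′ → z ∈ₗ L))
    split-at-tail nil = inj₁ nil
    split-at-tail (cons (here refl) w) = inj₂ (_ , nil , λ { (here refl) → here refl })
    split-at-tail (cons (there e) w) with split-at-tail w
    ... | inj₁ w′ = inj₁ (cons e w′)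
    ... | inj₂ (L′ , w′ , sub) = inj₂ (_ , cons e w′ , λ { (here refl) → here refl ; (there z∈) → there (sub z∈) })

    split-at-head : ∀ {x y es u v L} → Walk (Arc ((x , y) ∷ es)) u v L →
                    Walk (Arc es) u v L ⊎ (∃ λ L′ → Walk (Arc es) y v L′ × (∀ {z} → z ∈ₗ L′ → z ∈ₗ L))
    split-at-head nil = inj₁ nil
    split-at-head (cons e w) with split-at-head w
    ... | inj₂ (L′ , w′ , sub) = inj₂ (L′ , w′ , there ∘ sub)
    split-at-head (cons (here refl) w) | inj₁ w′ = inj₂ (_ , w′ , there)
    split-at-head (cons (there e) w) | inj₁ w′ = inj₁ (cons e w′)

    lift-walks : ∀ {E E′ A B k} → (∀ {u v} → E u v → E′ u v) → DisjointWalks E A B k → DisjointWalks E′ A B k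
    lift-walks f P = record { DisjointWalks P ; walk = walk-map f ∘ DisjointWalks.walk P }

  -- Göring's proof: the two families in G - e, from A to S + x and from S + y to B,
  -- meet only in S because S separates A from B in G - e; they are glued in S and along e = xy.
  module Glue {x y : Fin m} {es} {A B S : Subset m} {k}
           (S<k : ∣ S ∣ < k) (x∉S : x ∉ S) (y∉S : y ∉ S)
           (sep : ∀ {x y L} → Walk (Arc es) x y L → x ∈ A → y ∈ B → ∃ λ v → v ∈ₗ L × v ∈ S)
           (P : DisjointWalks (Arc es) A (S ∪ ⁅ x ⁆) k) (Q : DisjointWalks (Arc es) (S ∪ ⁅ y ⁆) B k) where

    private
      module P = DisjointWalks P
      module Q = DisjointWalks Q

      ∈-insert⁻ : ∀ {v z} → v ∈ S ∪ ⁅ z ⁆ → v ∈ S ⊎ v ≡ z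
      ∈-insert⁻ {z = z} v∈ with Subₚ.x∈p∪q⁻ S ⁅ z ⁆ v∈
      ... | inj₁ v∈S = inj₁ v∈S
      ... | inj₂ v∈z = inj₂ (Subₚ.x∈⁅y⁆⇒x≡y z v∈z)

      trimP : ∀ i → _
      trimP i = first-hit (λ v → v Subₚ.∈? (S ∪ ⁅ x ⁆)) (P.walk i) (P.t∈ i)
      trimQ : ∀ j → _
      trimQ j = last-hit (λ v → v Subₚ.∈? (S ∪ ⁅ y ⁆)) (Q.walk j) (Q.s∈ j)

      t u : Fin k → Fin m
      t i = proj₁ (trimP i)
      u j = proj₁ (trimQ j)
      pre post LP LQ : Fin k → List (Fin m)
      pre i = proj₁ (proj₂ (trimP i))
      post j = proj₁ (proj₂ (trimQ j))
      LP i = pre i ++ [ t i ]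
      LQ j = u j ∷ post j
      walkP : ∀ i → Walk (Arc es) (P.s i) (t i) (LP i)
      walkP i = proj₁ (proj₂ (proj₂ (trimP i)))
      walkQ : ∀ j → Walk (Arc es) (u j) (Q.t j) (LQ j)
      walkQ j = proj₁ (proj₂ (proj₂ (trimQ j)))
      t∈ : ∀ i → t i ∈ S ∪ ⁅ x ⁆
      t∈ i = proj₁ (proj₂ (proj₂ (proj₂ (trimP i))))
      u∈ : ∀ j → u j ∈ S ∪ ⁅ y ⁆
      u∈ j = proj₁ (proj₂ (proj₂ (proj₂ (trimQ j))))
      pre∉ : ∀ i {v} → v ∈ₗ pre i → v ∉ S ∪ ⁅ x ⁆
      pre∉ i = All.lookup (proj₁ (proj₂ (proj₂ (proj₂ (proj₂ (trimP i))))))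
      post∉ : ∀ j {v} → v ∈ₗ post j → v ∉ S ∪ ⁅ y ⁆
      post∉ j = All.lookup (proj₁ (proj₂ (proj₂ (proj₂ (proj₂ (trimQ j))))))
      disjP : ∀ i j v → v ∈ₗ LP i → v ∈ₗ LP j → i ≡ j
      disjP i j v a b = P.disj i j v (proj₂ (proj₂ (proj₂ (proj₂ (proj₂ (trimP i))))) a)
                                     (proj₂ (proj₂ (proj₂ (proj₂ (proj₂ (trimP j))))) b)
      disjQ : ∀ i j v → v ∈ₗ LQ i → v ∈ₗ LQ j → i ≡ j
      disjQ i j v a b = Q.disj i j v (proj₂ (proj₂ (proj₂ (proj₂ (proj₂ (trimQ i))))) a)
                                     (proj₂ (proj₂ (proj₂ (proj₂ (proj₂ (trimQ j))))) b)

      -- S + y has at most k elements, so the k disjoint walks of `Q` start at all of them. Hence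
      -- every trimmed walk of `P`, which ends in S or at x, finds a continuation.
      onto-u : ∀ {v} → v ∈ S ∪ ⁅ y ⁆ → ∃ λ j → v ≡ u j
      onto-u = injective⇒onto (S ∪ ⁅ y ⁆) u
        (λ {i} {j} eq → disjQ i j (u i) (here refl) (subst (_∈ₗ LQ j) (≡sym eq) (here refl)))
        u∈ (ℕₚ.≤-trans (∣∣≤-insert S y) S<k)

      Matched : Fin k → Fin k → Set
      Matched i j = (t i ∈ S × t i ≡ u j) ⊎ (t i ≡ x × u j ≡ y)

      match : ∀ i → ∃ (Matched i)
      match i with ∈-insert⁻ (t∈ i)
      ... | inj₁ t∈S = let j , eq = onto-u (Subₚ.x∈p∪q⁺ (inj₁ t∈S)) in j , inj₁ (t∈S , eq)
      ... | inj₂ t≡x = let j , eq = onto-u (Subₚ.x∈p∪q⁺ (inj₂ (Subₚ.x∈⁅x⁆ y))) in j , inj₂ (t≡x , ≡sym eq)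

      matched-injective : ∀ {i i′ j} → Matched i j → Matched i′ j → i ≡ i′
      matched-injective {i} {i′} (inj₁ (_ , e)) (inj₁ (_ , e′)) =
        disjP i i′ (t i) (end∈ (walkP i)) (subst (_∈ₗ LP i′) (trans e′ (≡sym e)) (end∈ (walkP i′)))
      matched-injective (inj₁ (t∈S , e)) (inj₂ (_ , e′)) = ⊥-elim (y∉S (subst (_∈ S) (trans e e′) t∈S))
      matched-injective (inj₂ (_ , e)) (inj₁ (t∈S , e′)) = ⊥-elim (y∉S (subst (_∈ S) (trans e′ e) t∈S))
      matched-injective {i} {i′} (inj₂ (e , _)) (inj₂ (e′ , _)) =
        disjP i i′ (t i) (end∈ (walkP i)) (subst (_∈ₗ LP i′) (trans e′ (≡sym e)) (end∈ (walkP i′)))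

      S-free : ∀ {a v b L₁ L₂} → Walk (Arc es) a v L₁ → Walk (Arc es) v b L₂ → a ∈ A → b ∈ B →
               (∀ {z} → z ∈ₗ L₁ → z ∉ S) → (∀ {z} → z ∈ₗ L₂ → z ∉ S) → ⊥
      S-free {L₁ = L₁} w₁ w₂ a∈ b∈ h₁ h₂ with sep (walk-glue w₁ w₂) a∈ b∈
      ... | z , z∈ , z∈S with ∈-⊙⁻ L₁ z∈
      ... | inj₁ z∈₁ = h₁ z∈₁ z∈S
      ... | inj₂ z∈₂ = h₂ z∈₂ z∈S

      before : ∀ i {v} → v ∈ₗ pre i → ∃ λ L → Walk (Arc es) (P.s i) v L × (∀ {z} → z ∈ₗ L → z ∉ S)
      before i v∈ with walk-prefix (pre i) (walkP i) v∈
      ... | L , w , sub = L , w , λ z∈ z∈S → pre∉ i (sub z∈) (Subₚ.x∈p∪q⁺ (inj₁ z∈S))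

      upto : ∀ i → t i ∉ S → ∀ {z} → z ∈ₗ LP i → z ∉ S
      upto i t∉ z∈ z∈S with Memₚ.∈-++⁻ (pre i) z∈
      ... | inj₁ z∈p = pre∉ i z∈p (Subₚ.x∈p∪q⁺ (inj₁ z∈S))
      ... | inj₂ (here refl) = t∉ z∈S

      after : ∀ j {v} → v ∈ₗ post j → ∃ λ L → Walk (Arc es) v (Q.t j) L × (∀ {z} → z ∈ₗ L → z ∉ S)
      after j v∈ with post j | walkQ j | post∉ j
      ... | _ ∷ _ | cons _ w | h with walk-suffix w v∈
      ... | L , w′ , sub = L , w′ , λ z∈ z∈S → h (sub z∈) (Subₚ.x∈p∪q⁺ (inj₁ z∈S))

      from : ∀ j → u j ∉ S → ∀ {z} → z ∈ₗ LQ j → z ∉ S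
      from j u∉ (here refl) z∈S = u∉ z∈S
      from j u∉ (there z∈) z∈S = post∉ j z∈ (Subₚ.x∈p∪q⁺ (inj₁ z∈S))

      meet : ∀ i j {v} → v ∈ₗ LP i → v ∈ₗ LQ j → Matched i j
      meet i j v∈P v∈Q with Memₚ.∈-++⁻ (pre i) v∈P | v∈Q
      ... | inj₁ v∈pre | there v∈post =
        let _ , w₁ , h₁ = before i v∈pre
            _ , w₂ , h₂ = after j v∈post
        in ⊥-elim (S-free w₁ w₂ (P.s∈ i) (Q.t∈ j) h₁ h₂)
      ... | inj₁ v∈pre | here refl =
        let _ , w₁ , h₁ = before i v∈pre
        in ⊥-elim (S-free w₁ (walkQ j) (P.s∈ i) (Q.t∈ j) h₁ (from j (h₁ (end∈ w₁))))
      ... | inj₂ (here refl) | there v∈post =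
        let _ , w₂ , h₂ = after j v∈post
        in ⊥-elim (S-free (walkP i) w₂ (P.s∈ i) (Q.t∈ j) (upto i (h₂ (start∈ w₂))) h₂)
      ... | inj₂ (here e₁) | here e₂ with ∈-insert⁻ (t∈ i) | ∈-insert⁻ (u∈ j)
      ... | inj₁ t∈S | _ = inj₁ (t∈S , trans (≡sym e₁) e₂)
      ... | inj₂ t≡x | inj₁ u∈S = ⊥-elim (x∉S (subst (_∈ S) (trans (trans (≡sym e₂) e₁) t≡x) u∈S))
      ... | inj₂ t≡x | inj₂ u≡y = inj₂ (t≡x , u≡y)

      combined : ∀ i j → Matched i j →
        ∃ λ L → Walk (Arc ((x , y) ∷ es)) (P.s i) (Q.t j) L × (∀ {v} → v ∈ₗ L → v ∈ₗ LP i ⊎ v ∈ₗ LQ j)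
      combined i j (inj₁ (_ , e)) = _ , walk-map there (walk-glue (subst (λ z → Walk _ _ z (LP i)) e (walkP i)) (walkQ j)) , ∈-⊙⁻ (LP i)
      combined i j (inj₂ (e , e′)) = _ , walk-join (walk-map there (walkP i)) (here (cong₂ _,_ e e′)) (walk-map there (walkQ j)) , Memₚ.∈-++⁻ (LP i)

      μ : Fin k → Fin k
      μ = proj₁ ∘ match

    glued : DisjointWalks (Arc ((x , y) ∷ es)) A B k
    glued = record
      { s = P.s ; t = Q.t ∘ μ
      ; L = λ i → proj₁ (combined i (μ i) (proj₂ (match i)))
      ; walk = λ i → proj₁ (proj₂ (combined i (μ i) (proj₂ (match i))))
      ; s∈ = P.s∈ ; t∈ = Q.t∈ ∘ μ
      ; disj = λ i j v v∈i v∈j → disj i j (proj₂ (proj₂ (combined i (μ i) (proj₂ (match i)))) v∈i)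
                                          (proj₂ (proj₂ (combined j (μ j) (proj₂ (match j)))) v∈j) }
      where
      disj : ∀ i j {v} → v ∈ₗ LP i ⊎ v ∈ₗ LQ (μ i) → v ∈ₗ LP j ⊎ v ∈ₗ LQ (μ j) → i ≡ j
      disj i j (inj₁ a) (inj₁ b) = disjP i j _ a b
      disj i j (inj₁ a) (inj₂ b) = matched-injective (meet i (μ j) a b) (proj₂ (match j))
      disj i j (inj₂ a) (inj₁ b) = ≡sym (matched-injective (meet j (μ i) b a) (proj₂ (match i)))
      disj i j (inj₂ a) (inj₂ b) = matched-injective (proj₂ (match i))
        (subst (Matched j) (≡sym (disjQ (μ i) (μ j) _ a b)) (proj₂ (match j)))

  -- If an end of the new arc lies in `S`, then `S` remains a separator. Otherwise a set that
  -- separates A from S + x without the arc also separates A from B with it, because a walk from A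
  -- to B meets `S` or reaches x before its first use of the arc; symmetrically for S + y and B. If
  -- neither such set exists, the two families of walks are glued.
  menger : ∀ es A B k → DisjointWalks (Arc es) A B k ⊎ Separator (Arc es) A B k
  menger [] A B k with k ≤? ∣ A ∩ B ∣
  ... | yes k≤ = let g , inj , g∈ = enumerate k (A ∩ B) k≤ in inj₁ record
    { s = g ; t = g ; L = λ i → [ g i ] ; walk = λ _ → nil
    ; s∈ = λ i → proj₁ (Subₚ.x∈p∩q⁻ A B (g∈ i)) ; t∈ = λ i → proj₂ (Subₚ.x∈p∩q⁻ A B (g∈ i))
    ; disj = λ { i j v (here e) (here e′) → inj (trans (≡sym e) e′) } }
  ... | no k≰ = inj₂ (A ∩ B , ℕₚ.≰⇒> k≰ , λ { nil x∈ y∈ → _ , here refl , Subₚ.x∈p∩q⁺ (x∈ , y∈) })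
  menger ((x , y) ∷ es) A B k with menger es A B k
  ... | inj₁ P = inj₁ (lift-walks there P)
  ... | inj₂ (S , S<k , sep) with x Subₚ.∈? S | y Subₚ.∈? S
  ... | yes x∈S | _ = inj₂ (S , S<k , λ w a∈ b∈ → case split-at-tail w of λ
    { (inj₁ w′) → sep w′ a∈ b∈ ; (inj₂ (_ , w′ , sub)) → x , sub (end∈ w′) , x∈S })
  ... | no _ | yes y∈S = inj₂ (S , S<k , λ w a∈ b∈ → case split-at-head w of λ
    { (inj₁ w′) → sep w′ a∈ b∈ ; (inj₂ (_ , w′ , sub)) → y , sub (start∈ w′) , y∈S })
  ... | no x∉S | no y∉S with menger es A (S ∪ ⁅ x ⁆) k | menger es (S ∪ ⁅ y ⁆) B k
  ... | inj₁ P | inj₁ Q = inj₁ (Glue.glued S<k x∉S y∉S sep P Q)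
  ... | inj₂ (X , X<k , sepX) | _ = inj₂ (X , X<k , λ w a∈ b∈ → case split-at-tail w of λ
    { (inj₂ (_ , w′ , sub)) → let v , v∈ , v∈X = sepX w′ a∈ (Subₚ.x∈p∪q⁺ (inj₂ (Subₚ.x∈⁅x⁆ x))) in v , sub v∈ , v∈X
    ; (inj₁ w′) → let s , s∈ , s∈S = sep w′ a∈ b∈
                      pre , post , eq = Memₚ.∈-∃++ s∈
                      v , v∈ , v∈X = sepX (proj₁ (walk-split pre (subst (Walk _ _ _) eq w′))) a∈ (Subₚ.x∈p∪q⁺ (inj₁ s∈S))
                  in v , subst (v ∈ₗ_) (≡sym eq) (prefix⊆ pre v∈) , v∈X })
    where
    prefix⊆ : ∀ pre {s v : Fin m} {post} → v ∈ₗ pre ++ [ s ] → v ∈ₗ pre ++ s ∷ post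
    prefix⊆ pre v∈ with Memₚ.∈-++⁻ pre v∈
    ... | inj₁ v∈p = Memₚ.∈-++⁺ˡ v∈p
    ... | inj₂ (here refl) = Memₚ.∈-++⁺ʳ pre (here refl)
  ... | inj₁ _ | inj₂ (X , X<k , sepX) = inj₂ (X , X<k , λ w a∈ b∈ → case split-at-head w of λ
    { (inj₂ (_ , w′ , sub)) → let v , v∈ , v∈X = sepX w′ (Subₚ.x∈p∪q⁺ (inj₂ (Subₚ.x∈⁅x⁆ y))) b∈ in v , sub v∈ , v∈X
    ; (inj₁ w′) → let s , s∈ , s∈S = sep w′ a∈ b∈
                      L′ , w″ , sub = walk-suffix w′ s∈
                      v , v∈ , v∈X = sepX w″ (Subₚ.x∈p∪q⁺ (inj₁ s∈S)) b∈
                  in v , sub v∈ , v∈X })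

-- Separations of a graph

module GraphBasics (G : Graph) where

  _~_ : V G → V G → Set
  _~_ = Edge G

  _~?_ : ∀ u v → Dec (u ~ v)
  u ~? v = adj G u v Boolₚ.≟ true

  ~-sym : ∀ {u v} → u ~ v → v ~ u
  ~-sym {u} {v} e = trans (Graph.sym G v u) e

  ~-irrefl : ∀ {u} → ¬ (u ~ u)
  ~-irrefl {u} e with trans (≡sym e) (Graph.irrefl G u)
  ... | ()

  module _ {P : V G → Set} where

    reach-start : ∀ {x y} → Reach G P x y → P x
    reach-start (here p) = p
    reach-start (step p _ _) = p

    reach-end : ∀ {x y} → Reach G P x y → P y
    reach-end (here p) = p
    reach-end (step _ _ r) = reach-end r

    reach-trans : ∀ {x y z} → Reach G P x y → Reach G P y z → Reach G P x z
    reach-trans (here _) r′ = r′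
    reach-trans (step p e r) r′ = step p e (reach-trans r r′)

    reach-snoc : ∀ {x y z} → Reach G P x y → y ~ z → P z → Reach G P x z
    reach-snoc r e pz = reach-trans r (step (reach-end r) e (here pz))

    reach-sym : ∀ {x y} → Reach G P x y → Reach G P y x
    reach-sym (here p) = here p
    reach-sym (step p e r) = reach-snoc (reach-sym r) (~-sym e) p

    reach-map : ∀ {Q : V G → Set} → (∀ {v} → P v → Q v) → ∀ {x y} → Reach G P x y → Reach G Q x y
    reach-map f (here p) = here (f p)
    reach-map f (step p e r) = step (f p) e (reach-map f r)

    reach-self : ∀ {x y} → Reach G P x y → Reach G (λ v → P v × Reach G P x v) x y
    reach-self {x} r = go (here (reach-start r)) r
      where
      go : ∀ {u y} → Reach G P x u → Reach G P u y → Reach G (λ v → P v × Reach G P x v) u y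
      go acc (here p) = here (p , acc)
      go acc (step p e r) = step (p , acc) e (go (reach-snoc acc e (reach-start r)) r)

    -- After its last visit to `x` a walk lives in the graph without `x`. Deciding reachability,
    -- finding fans and descending into a branch of a tree all rest on this.
    last-exit : ∀ x {y z} → Reach G P y z → x ≢ z →
                Reach G (λ v → P v × v ≢ x) y z ⊎ (∃ λ w → x ~ w × Reach G (λ v → P v × v ≢ x) w z)
    last-exit x (here p) x≢z = inj₁ (here (p , x≢z ∘ ≡sym))
    last-exit x (step {x = y} p e r) x≢z with last-exit x r x≢z
    ... | inj₂ exit = inj₂ exit
    ... | inj₁ r′ with x ≟ y
    ... | yes refl = inj₂ (_ , e , r′)
    ... | no x≢y   = inj₁ (step (p , x≢y ∘ ≡sym) e r′)

    walk⇒reach : ∀ {x y L} → Walk _~_ x y L → (∀ {v} → v ∈ₗ L → P v) → Reach G P x y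
    walk⇒reach nil h = here (h (here refl))
    walk⇒reach (cons e w) h = step (h (here refl)) e (walk⇒reach w (h ∘ there))

    reach⇒walk : ∀ {x y} → Reach G P x y → ∃ λ L → Walk _~_ x y L × (∀ {v} → v ∈ₗ L → P v)
    reach⇒walk (here p) = _ , nil , λ { (here refl) → p }
    reach⇒walk (step p e r) with reach⇒walk r
    ... | L , w , h = _ , cons e w , λ { (here refl) → p ; (there v∈) → h v∈ }

    reach⇒path : ∀ {x y} → Reach G P x y → ∃ λ L → Walk _~_ x y L × Unique L × (∀ {v} → v ∈ₗ L → P v)
    reach⇒path r with reach⇒walk r
    ... | _ , w , h with walk-erase w
    ... | L , w′ , u , sub = L , w′ , u , h ∘ sub

  walk⇒linked : ∀ {x y L} → Walk _~_ x y L → Linked _~_ L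
  walk⇒linked nil = [-]
  walk⇒linked (cons e nil) = e ∷ [-]
  walk⇒linked (cons e w@(cons _ _)) = e ∷ walk⇒linked w

  walk⇒isPath : ∀ {x y L} → Walk _~_ x y L → Unique L → IsPath G L
  walk⇒isPath w u = (λ { refl → case w of λ () }) , u , walk⇒linked w

  linked⇒walk : ∀ {x y L} → Linked _~_ L → StartsAt L x → EndsAt L y → Walk _~_ x y L
  linked⇒walk {L = []} l (_ , ()) _
  linked⇒walk {L = _ ∷ []} l (_ , refl) ([] , refl) = nil
  linked⇒walk {L = _ ∷ []} l (_ , refl) (_ ∷ [] , ())
  linked⇒walk {L = _ ∷ []} l (_ , refl) (_ ∷ _ ∷ _ , ())
  linked⇒walk {L = _ ∷ _ ∷ _} l (_ , refl) ([] , ())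
  linked⇒walk {L = _ ∷ _ ∷ _} (e ∷ l) (_ , refl) (_ ∷ pre , eq) = cons e (linked⇒walk l (_ , refl) (pre , Listₚ.∷-injectiveʳ eq))

  walk-loop : ∀ {x L} → Walk _~_ x x L → Unique L → L ≡ [ x ]
  walk-loop nil _ = refl
  walk-loop (cons e w) (x∉ ∷ _) = ⊥-elim (All.lookup x∉ (end∈ w) refl)

  private
    -- A walk may be assumed to leave `x` for good, so `x` is deleted from `S` before the search
    -- continues at a neighbour; `k` bounds the depth.
    reachSub? : ∀ k S → ∣ S ∣ ≤ k → ∀ x z → Dec (Reach G (_∈ S) x z)
    reachSub? k S S≤k x z with x Subₚ.∈? S
    ... | no x∉ = no (x∉ ∘ reach-start)
    ... | yes x∈ with x ≟ z
    ... | yes refl = yes (here x∈)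
    reachSub? zero S S≤k x z | yes x∈ | no x≢z =
      ⊥-elim (ℕₚ.<-irrefl refl (ℕₚ.<-≤-trans (ℕₚ.≤-<-trans z≤n (Subₚ.x∈p⇒∣p-x∣<∣p∣ x∈)) S≤k))
    reachSub? (suc k) S S≤k x z | yes x∈ | no x≢z
      with Finₚ.any? (λ y → (x ~? y) ×-dec reachSub? k (S - x) (ℕₚ.≤-pred (ℕₚ.≤-trans (Subₚ.x∈p⇒∣p-x∣<∣p∣ x∈) S≤k)) y z)
    ... | yes (y , e , r) = yes (step x∈ e (reach-map (proj₁ ∘ ∈-remove⁻ S x) r))
    ... | no ¬found = no λ r → case last-exit x r x≢z of λ
      { (inj₁ r′) → proj₂ (reach-start r′) refl
      ; (inj₂ (y , e , r′)) → ¬found (y , e , reach-map (λ (v∈ , v≢x) → Subₚ.x∈p∧x≢y⇒x∈p-y v∈ v≢x) r′) }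

  abstract
    reach? : ∀ {P : V G → Set} → Decidable P → ∀ x y → Dec (Reach G P x y)
    reach? P? x y = map′ (reach-map (∈toSub⁻ P?)) (reach-map (∈toSub⁺ P?)) (reachSub? _ (toSub P?) ℕₚ.≤-refl x y)

  HasOutNeighbour : Subset (n G) → V G → Set
  HasOutNeighbour A v = v ∈ A × ∃ λ m → v ~ m × m ∉ A

  hasOutNeighbour? : ∀ A → Decidable (HasOutNeighbour A)
  hasOutNeighbour? A v = (v Subₚ.∈? A) ×-dec Finₚ.any? (λ m → (v ~? m) ×-dec ¬? (m Subₚ.∈? A))

  -- The inner vertex boundary: it separates the rest of `A` from the complement of `A`, and its
  -- size is the order of the separation.
  ∂ : Subset (n G) → Subset (n G)
  ∂ A = toSub (hasOutNeighbour? A)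

  ∂⁺ : ∀ A {v m} → v ∈ A → v ~ m → m ∉ A → v ∈ ∂ A
  ∂⁺ A v∈ e m∉ = ∈toSub⁺ (hasOutNeighbour? A) (v∈ , _ , e , m∉)

  ∂⁻ : ∀ A {v} → v ∈ ∂ A → HasOutNeighbour A v
  ∂⁻ A = ∈toSub⁻ (hasOutNeighbour? A)

  ∂⊆ : ∀ A {v} → v ∈ ∂ A → v ∈ A
  ∂⊆ A = proj₁ ∘ ∂⁻ A

  ∂-antitone : ∀ A A″ → A ⊆ A″ → ∀ {v} → v ∈ A → v ∈ ∂ A″ → v ∈ ∂ A
  ∂-antitone A A″ sub v∈ v∈∂ with ∂⁻ A″ v∈∂
  ... | _ , m , e , m∉ = ∂⁺ A v∈ e (m∉ ∘ sub)

  -- The part of A″ outside the interior of A.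
  Bag : Subset (n G) → Subset (n G) → V G → Set
  Bag A A″ v = v ∈ A″ × (v ∈ A → v ∈ ∂ A)

  bag? : ∀ A A″ → Decidable (Bag A A″)
  bag? A A″ v = (v Subₚ.∈? A″) ×-dec ((v Subₚ.∈? A) →-dec (v Subₚ.∈? ∂ A))

  record Paths (U : V G → Set) {q : ℕ} (s t : Fin q → V G) (R : Fin q → List (V G)) : Set where
    field
      walk   : ∀ α → Walk _~_ (s α) (t α) (R α)
      unique : ∀ α → Unique (R α)
      inside : ∀ α {v} → v ∈ₗ R α → U v
      disj   : ∀ {α β v} → v ∈ₗ R α → v ∈ₗ R β → α ≡ β

  record Brick (A A″ : Subset (n G)) (q : ℕ) : Set where
    field
      s t   : Fin q → V G
      R     : Fin q → List (V G)
      paths : Paths (Bag A A″) s t R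
      s∈    : ∀ α → s α ∈ ∂ A
      t∈    : ∀ α → t α ∈ ∂ A″

  module _ {F : V G → V G → Set} (F? : ∀ u v → Dec (F u v)) where

    private
      F′? : (a : V G × V G) → Dec (F (proj₁ a) (proj₂ a))
      F′? a = F? (proj₁ a) (proj₂ a)
      allV = Data.List.allFin (n G)

    arcs : List (V G × V G)
    arcs = filter F′? (Data.List.cartesianProduct allV allV)

    arcs⁺ : ∀ {u v} → F u v → Arc arcs u v
    arcs⁺ f = Memₚ.∈-filter⁺ F′? (Memₚ.∈-cartesianProduct⁺ (Memₚ.∈-allFin _) (Memₚ.∈-allFin _)) f

    arcs⁻ : ∀ {u v} → Arc arcs u v → F u v
    arcs⁻ a = proj₂ (Memₚ.∈-filter⁻ F′? {xs = Data.List.cartesianProduct allV allV} a)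

  module Cut (A A″ : Subset (n G)) (sub : A ⊆ A″) where

    private
      F : V G → V G → Set
      F u v = Bag A A″ u × Bag A A″ v × u ~ v
      F? : ∀ u v → Dec (F u v)
      F? u v = bag? A A″ u ×-dec bag? A A″ v ×-dec (u ~? v)

      inBag : ∀ {x y L} → Bag A A″ x → Walk F x y L → ∀ {v} → v ∈ₗ L → Bag A A″ v
      inBag bx nil (here refl) = bx
      inBag bx (cons _ _) (here refl) = bx
      inBag bx (cons (_ , by , _) w) (there v∈) = inBag by w v∈

      ∂A⇒Bag : ∀ {v} → v ∈ ∂ A → Bag A A″ v
      ∂A⇒Bag v∈ = sub (∂⊆ A v∈) , λ _ → v∈

      brick : ∀ {k} → DisjointWalks (Arc (arcs F?)) (∂ A) (∂ A″) k → Brick A A″ k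
      brick P = record
        { s = P.s ; t = P.t ; R = λ α → proj₁ (path α)
        ; paths = record
          { walk = λ α → walk-map (proj₂ ∘ proj₂) (proj₁ (proj₂ (path α)))
          ; unique = λ α → proj₁ (proj₂ (proj₂ (path α)))
          ; inside = λ α v∈ → inBag (∂A⇒Bag (P.s∈ α)) (proj₁ (proj₂ (path α))) v∈
          ; disj = λ {α} {β} v∈ v∈′ → P.disj α β _ (proj₂ (proj₂ (proj₂ (path α))) v∈)
                                                   (proj₂ (proj₂ (proj₂ (path β))) v∈′) }
        ; s∈ = P.s∈ ; t∈ = P.t∈ }
        where
        module P = DisjointWalks P
        path : ∀ α → _
        path α = walk-erase (walk-map (arcs⁻ F?) (P.walk α))

      module _ {k} (X : Subset (n G)) (X<k : ∣ X ∣ < k)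
               (sep : ∀ {x y L} → Walk (Arc (arcs F?)) x y L → x ∈ ∂ A → y ∈ ∂ A″ → ∃ λ v → v ∈ₗ L × v ∈ X) where

        Near : V G → Set
        Near v = v ∈ A″ × v ∉ X

        near? : Decidable Near
        near? v = (v Subₚ.∈? A″) ×-dec ¬? (v Subₚ.∈? X)

        InCut : V G → Set
        InCut v = v ∈ A ⊎ (v ∈ X × v ∈ A″) ⊎ (∃ λ a → a ∈ A × Reach G Near a v)

        inCut? : Decidable InCut
        inCut? v = (v Subₚ.∈? A) ⊎-dec ((v Subₚ.∈? X) ×-dec (v Subₚ.∈? A″))
                   ⊎-dec Finₚ.any? (λ a → (a Subₚ.∈? A) ×-dec reach? near? a v)

        A′ : Subset (n G)
        A′ = toSub inCut?

        -- A walk from A to ∂ A″ avoiding X contains one inside the bag: cut it at its last vertex in A.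
        avoids : ∀ {a v} → a ∈ A → Reach G Near a v → v ∈ ∂ A″ →
                 ∃₂ λ x L → Walk F x v L × x ∈ ∂ A × (∀ {z} → z ∈ₗ L → z ∉ X)
        avoids {a} {v} a∈ r v∈∂ with go r
          where
          go : ∀ {a} → Reach G Near a v →
               (∃₂ λ x L → Walk F x v L × x ∈ ∂ A × (∀ {z} → z ∈ₗ L → z ∉ X)) ⊎
               (a ∉ A × ∃ λ L → Walk F a v L × (∀ {z} → z ∈ₗ L → z ∉ X))
          go (here (v∈ , v∉X)) with v Subₚ.∈? A
          ... | yes v∈A = inj₁ (v , _ , nil , ∂-antitone A A″ sub v∈A v∈∂ , λ { (here refl) → v∉X })
          ... | no v∉A = inj₂ (v∉A , _ , nil , λ { (here refl) → v∉X })
          go (step {x = a} (a∈″ , a∉X) e r) with go r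
          ... | inj₁ done = inj₁ done
          ... | inj₂ (b∉A , L , w , h) with a Subₚ.∈? A
          ... | yes a∈A = inj₁ (a , _ , cons (∂A⇒Bag a∈∂ , (proj₁ (reach-start r) , ⊥-elim ∘ b∉A) , e) w , a∈∂ ,
                            λ { (here refl) → a∉X ; (there z∈) → h z∈ })
            where a∈∂ = ∂⁺ A a∈A e b∉A
          ... | no a∉A = inj₂ (a∉A , _ , cons ((a∈″ , ⊥-elim ∘ a∉A) , (proj₁ (reach-start r) , ⊥-elim ∘ b∉A) , e) w ,
                            λ { (here refl) → a∉X ; (there z∈) → h z∈ })
        ... | inj₁ done = done
        ... | inj₂ (a∉A , _) = ⊥-elim (a∉A a∈)

        -- This gives `∂ A′ ⊆ X`. A neighbour `m` outside `A″` would put `v` into `∂ A″`, and the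
        -- walk from `A` to `v` would contain one across the bag that misses the separator `X`.
        closed : ∀ {v m} → InCut v → v ∉ X → v ~ m → m ∈ A′
        closed {v} {m} cv v∉X e with toReach cv
          where
          toReach : InCut v → ∃ λ a → a ∈ A × Reach G Near a v
          toReach (inj₁ v∈A) = v , v∈A , here (sub v∈A , v∉X)
          toReach (inj₂ (inj₁ (v∈X , _))) = ⊥-elim (v∉X v∈X)
          toReach (inj₂ (inj₂ r)) = r
        ... | a , a∈ , r with m Subₚ.∈? A″ | m Subₚ.∈? X
        ... | yes m∈ | yes m∈X = ∈toSub⁺ inCut? (inj₂ (inj₁ (m∈X , m∈)))
        ... | yes m∈ | no m∉X = ∈toSub⁺ inCut? (inj₂ (inj₂ (a , a∈ , reach-snoc r e (m∈ , m∉X))))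
        ... | no m∉ | _ with avoids a∈ r v∈∂
          where v∈∂ = ∂⁺ A″ (proj₁ (reach-end r)) e m∉
        ... | x , L , w , x∈ , h with sep (walk-map (arcs⁺ F?) w) x∈ (∂⁺ A″ (proj₁ (reach-end r)) e m∉)
        ... | z , z∈ , z∈X = ⊥-elim (h z∈ z∈X)

        between : ∃ λ A′ → A ⊆ A′ × A′ ⊆ A″ × ∣ ∂ A′ ∣ < k
        between = A′ , (λ v∈ → ∈toSub⁺ inCut? (inj₁ v∈)) , below , ℕₚ.≤-<-trans (Subₚ.p⊆q⇒∣p∣≤∣q∣ ∂⊆X) X<k
          where
          below : A′ ⊆ A″
          below v∈ with ∈toSub⁻ inCut? v∈
          ... | inj₁ v∈A = sub v∈A
          ... | inj₂ (inj₁ (_ , v∈″)) = v∈″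
          ... | inj₂ (inj₂ (_ , _ , r)) = proj₁ (reach-end r)
          ∂⊆X : ∂ A′ ⊆ X
          ∂⊆X {v} v∈ with v Subₚ.∈? X | ∂⁻ A′ v∈
          ... | yes v∈X | _ = v∈X
          ... | no v∉X | v∈′ , m , e , m∉ = ⊥-elim (m∉ (closed (∈toSub⁻ inCut? v∈′) v∉X e))

    cut : ∀ k → Brick A A″ k ⊎ (∃ λ A′ → A ⊆ A′ × A′ ⊆ A″ × ∣ ∂ A′ ∣ < k)
    cut k with menger (arcs F?) (∂ A) (∂ A″) k
    ... | inj₁ P = inj₁ (brick P)
    ... | inj₂ (X , X<k , sep) = inj₂ (between X X<k sep)

-- Fans and subdivisions of complete bipartite graphs

module _ {K : ℕ} (f : Fin K → Fin ν) (a : ℕ) where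

  -- Induction on the number `w` of possible values: either the class of one value has `a` members,
  -- or deleting this value costs fewer than `a` indices.
  pigeonhole-class : ∀ w (S : Subset ν) (D : Subset K) → ∣ S ∣ ≤ w → (∀ {i} → i ∈ D → f i ∈ S) → a * w < ∣ D ∣ →
                     ∃ λ (h : Fin a → Fin K) → Injective _≡_ _≡_ h × (∀ i i′ → f (h i) ≡ f (h i′))
  pigeonhole-class w S D S≤w f∈ big with nonempty D (ℕₚ.≤-<-trans z≤n big)
  pigeonhole-class zero S D S≤w f∈ big | d , d∈ =
    ⊥-elim (ℕₚ.<-irrefl refl (ℕₚ.<-≤-trans (ℕₚ.≤-<-trans z≤n (Subₚ.x∈p⇒∣p-x∣<∣p∣ (f∈ d∈))) S≤w))
  pigeonhole-class (suc w) S D S≤w f∈ big | d , d∈ = split (a ≤? ∣ C ∣)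
    where
    C? : Decidable (λ i → i ∈ D × f i ≡ f d)
    C? i = (i Subₚ.∈? D) ×-dec (f i ≟ f d)
    C = toSub C?
    D′? : Decidable (λ i → i ∈ D × f i ≢ f d)
    D′? i = (i Subₚ.∈? D) ×-dec ¬? (f i ≟ f d)
    D′ = toSub D′?
    D⊆ : D ⊆ C ∪ D′
    D⊆ {i} i∈ with f i ≟ f d
    ... | yes e = Subₚ.x∈p∪q⁺ (inj₁ (∈toSub⁺ C? (i∈ , e)))
    ... | no ¬e = Subₚ.x∈p∪q⁺ (inj₂ (∈toSub⁺ D′? (i∈ , ¬e)))
    D≤ : ∣ D ∣ ≤ ∣ C ∣ + ∣ D′ ∣
    D≤ = ℕₚ.≤-trans (Subₚ.p⊆q⇒∣p∣≤∣q∣ D⊆) (∣∪∣≤ C D′)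
    split : Dec (a ≤ ∣ C ∣) → _
    split (yes a≤) = let h , inj , h∈ = enumerate a C a≤ in
      h , (λ {_} {_} → inj) , λ i i′ → trans (proj₂ (∈toSub⁻ C? (h∈ i))) (≡sym (proj₂ (∈toSub⁻ C? (h∈ i′))))
    split (no a≰) = pigeonhole-class w (S - f d) D′
      (ℕₚ.≤-pred (ℕₚ.≤-trans (Subₚ.x∈p⇒∣p-x∣<∣p∣ (f∈ d∈)) S≤w))
      (λ i∈ → let i∈D , ≢ = ∈toSub⁻ D′? i∈ in Subₚ.x∈p∧x≢y⇒x∈p-y (f∈ i∈D) ≢)
      (ℕₚ.+-cancelˡ-< a _ _ (ℕₚ.<-≤-trans (subst (_< ∣ D ∣) (ℕₚ.*-suc a w) big)
        (ℕₚ.≤-trans D≤ (ℕₚ.+-monoˡ-≤ ∣ D′ ∣ (ℕₚ.<⇒≤ (ℕₚ.≰⇒> a≰))))))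

-- So many fans contain `a` that agree in all `p` ends: for each end, pigeonhole over at most `w`
-- values needs a factor `w` and one more fan.
stars : ℕ → ℕ → ℕ → ℕ
stars a zero w = a
stars a (suc p) w = suc (stars a p w * w)

pigeonhole-classes : ∀ a p w (S : Subset ν) → ∣ S ∣ ≤ w → (f : Fin p → Fin (stars a p w) → Fin ν) →
                     (∀ j i → f j i ∈ S) →
                     ∃ λ (h : Fin a → Fin (stars a p w)) → Injective _≡_ _≡_ h × (∀ j i i′ → f j (h i) ≡ f j (h i′))
pigeonhole-classes a zero w S S≤w f f∈ = id , id , λ ()
pigeonhole-classes a (suc p) w S S≤w f f∈
  with pigeonhole-class (f zero) (stars a p w) w S full S≤w (λ {i} _ → f∈ zero i)
         (subst (stars a p w * w <_) (≡sym (Subₚ.∣⊤∣≡n _)) ℕₚ.≤-refl)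
... | h , inj , agree with pigeonhole-classes a p w S S≤w (λ j i → f (suc j) (h i)) (λ j i → f∈ (suc j) (h i))
... | h′ , inj′ , agree′ = h ∘ h′ , (λ {_} {_} → inj′ ∘ inj) , λ { zero i i′ → agree (h′ i) (h′ i′) ; (suc j) i i′ → agree′ j i i′ }

-- Two spare vertices in different components of `G - S` certify that `S` has at least p vertices.
-- The extra star in `suc a` supplies the branch vertices `B`, which are needed even for `a = 0`.
starCount : ℕ → ℕ → ℕ → ℕ
starCount p a w = suc (suc (stars (suc a) p w))

module Fans (G : Graph) (p : ℕ) (conn : Connected G p) where

  open GraphBasics G

  record Fan (S : Subset (n G)) (v : V G) : Set where
    field
      ends   : Fin p → V G
      path   : Fin p → List (V G)
      ends∈  : ∀ j → ends j ∈ S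
      walk   : ∀ j → Walk _~_ v (ends j) (path j)
      unique : ∀ j → Unique (path j)
      only   : ∀ j {z} → z ∈ₗ path j → z ∈ S → z ≡ ends j
      disj   : ∀ {i j z} → z ∈ₗ path i → z ∈ₗ path j → z ≢ v → i ≡ j

  -- Menger's theorem in G - v between the neighbours of `v` and `S`. A separator with fewer than p
  -- vertices would miss some vertex of `S`, to which p-connectedness still gives a walk from `v`.
  fan : ∀ S v → v ∉ S → p ≤ ∣ S ∣ → Fan S v
  fan S v v∉S p≤S = result (menger (arcs F?) (toSub (v ~?_)) S p)
    where
    F : V G → V G → Set
    F u w = u ≢ v × w ≢ v × u ~ w
    F? : ∀ u w → Dec (F u w)
    F? u w = ¬? (u ≟ v) ×-dec ¬? (w ≟ v) ×-dec (u ~? w)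
    ≢v : ∀ {x y L} → x ≢ v → Walk F x y L → ∀ {z} → z ∈ₗ L → z ≢ v
    ≢v x≢ nil (here refl) = x≢
    ≢v x≢ (cons _ _) (here refl) = x≢
    ≢v x≢ (cons (_ , y≢ , _) w) (there z∈) = ≢v y≢ w z∈
    fromReach : ∀ {Q : V G → Set} {x y} → Reach G (λ z → Q z × z ≢ v) x y →
                ∃ λ L → Walk F x y L × (∀ {z} → z ∈ₗ L → Q z × z ≢ v)
    fromReach (here q) = _ , nil , λ { (here refl) → q }
    fromReach (step q e r) with fromReach r
    ... | L , w , h = _ , cons (proj₂ q , proj₂ (reach-start r) , e) w , λ { (here refl) → q ; (there z∈) → h z∈ }
    result : DisjointWalks (Arc (arcs F?)) (toSub (v ~?_)) S p ⊎ Separator (Arc (arcs F?)) (toSub (v ~?_)) S p → Fan S v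
    result (inj₁ P) = record
      { ends = ends ; path = λ j → v ∷ L j ; ends∈ = ends∈
      ; walk = λ j → cons (∈toSub⁻ (v ~?_) (P.s∈ j)) (walk-map (proj₂ ∘ proj₂) (walk j))
      ; unique = λ j → All.tabulate (λ { z∈ refl → ≢v (s≢v j) (walk j) z∈ refl }) ∷ proj₁ (proj₂ (proj₂ (path j)))
      ; only = λ { j (here refl) z∈S → ⊥-elim (v∉S z∈S) ; j (there z∈) z∈S → only j z∈ z∈S }
      ; disj = λ { (here e) _ z≢ → ⊥-elim (z≢ e) ; (there _) (here e) z≢ → ⊥-elim (z≢ e)
                 ; {i} {j} (there a) (there b) _ → P.disj i j _ (⊆L i a) (⊆L j b) } }
      where
      module P = DisjointWalks P
      s≢v : ∀ j → P.s j ≢ v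
      s≢v j e = ~-irrefl (subst (v ~_) e (∈toSub⁻ (v ~?_) (P.s∈ j)))
      hit : ∀ j → _
      hit j = first-hit (λ z → z Subₚ.∈? S) (walk-map (arcs⁻ F?) (P.walk j)) (P.t∈ j)
      ends : Fin p → V G
      ends j = proj₁ (hit j)
      ends∈ : ∀ j → ends j ∈ S
      ends∈ j = proj₁ (proj₂ (proj₂ (proj₂ (hit j))))
      path : ∀ j → _
      path j = walk-erase (proj₁ (proj₂ (proj₂ (hit j))))
      L : Fin p → List (V G)
      L j = proj₁ (path j)
      walk : ∀ j → Walk F (P.s j) (ends j) (L j)
      walk j = proj₁ (proj₂ (path j))
      ⊆L : ∀ j {z} → z ∈ₗ L j → z ∈ₗ P.L j
      ⊆L j z∈ = proj₂ (proj₂ (proj₂ (proj₂ (proj₂ (hit j))))) (proj₂ (proj₂ (proj₂ (path j))) z∈)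
      only : ∀ j {z} → z ∈ₗ L j → z ∈ S → z ≡ ends j
      only j z∈ z∈S with Memₚ.∈-++⁻ (proj₁ (proj₂ (hit j))) (proj₂ (proj₂ (proj₂ (path j))) z∈)
      ... | inj₁ z∈pre = ⊥-elim (All.lookup (proj₁ (proj₂ (proj₂ (proj₂ (proj₂ (hit j)))))) z∈pre z∈S)
      ... | inj₂ (here e) = e
    result (inj₂ (X , X<p , sep)) with Finₚ.any? (λ s → (s Subₚ.∈? S) ×-dec ¬? (s Subₚ.∈? X))
    ... | no ¬ex = ⊥-elim (ℕₚ.<-irrefl refl (ℕₚ.<-≤-trans X<p (ℕₚ.≤-trans p≤S (Subₚ.p⊆q⇒∣p∣≤∣q∣ S⊆X))))
      where
      S⊆X : S ⊆ X
      S⊆X {s} s∈ with s Subₚ.∈? X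
      ... | yes s∈X = s∈X
      ... | no s∉X = ⊥-elim (¬ex (s , s∈ , s∉X))
    ... | yes (s , s∈ , s∉X)
      -- `X` might contain `v`, where the walk has to start; removing `v` is harmless because only
      -- the part after the last visit to `v` is used.
      with last-exit v (proj₂ conn (X - v) (ℕₚ.≤-<-trans (Subₚ.p⊆q⇒∣p∣≤∣q∣ (proj₁ ∘ ∈-remove⁻ X v)) X<p)
                         v s (x∉p-x X v) (s∉X ∘ proj₁ ∘ ∈-remove⁻ X v)) (λ { refl → v∉S s∈ })
    ... | inj₁ r = ⊥-elim (proj₂ (reach-start r) refl)
    ... | inj₂ (w , e , r) with fromReach r
    ... | L , walk , h with sep (walk-map (arcs⁺ F?) walk) (∈toSub⁺ (v ~?_) e) s∈
    ... | z , z∈ , z∈X = ⊥-elim (proj₁ (h z∈) (Subₚ.x∈p∧x≢y⇒x∈p-y z∈X (proj₂ (h z∈))))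

  -- It places every vertex of a fan path outside `S` in the component of the centre, so that fans
  -- with centres in different components can meet only in `S`.
  only-reach : ∀ {S : Subset (n G)} {x y L} → Walk _~_ x y L → Unique L → (∀ {z} → z ∈ₗ L → z ∈ S → z ≡ y) →
               ∀ {z} → z ∈ₗ L → z ∉ S → Reach G (_∉ S) x z
  only-reach nil u only (here refl) z∉ = here z∉
  only-reach (cons e w) u only (here refl) z∉ = here z∉
  only-reach {S} {x} (cons e w) (x∉ ∷ u) only (there z∈) z∉ =
    step x∉S e (only-reach w u (only ∘ there) z∈ z∉)
    where
    x∉S : x ∉ S
    x∉S x∈S = All.lookup x∉ (end∈ w) (only (here refl) x∈S)

  star : ∀ a w (S : Subset (n G)) → ∣ S ∣ ≤ w → (g : Fin (starCount p a w) → V G) → (∀ i → g i ∉ S) →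
         (∀ {i j} → Reach G (_∉ S) (g i) (g j) → i ≡ j) → SubdivisionK G a p
  star a w S S≤w g g∉ separated with p ≤? ∣ S ∣
  ... | no p≰ = case separated (proj₂ conn S (ℕₚ.≰⇒> p≰) (g zero) (g (suc zero)) (g∉ zero) (g∉ (suc zero))) of λ ()
  ... | yes p≤ = build (pigeonhole-classes (suc a) p w S S≤w (λ j i → Fan.ends (fans i) j) (λ j i → Fan.ends∈ (fans i) j))
    where
    fans : ∀ (i : Fin (stars (suc a) p w)) → Fan S (g (suc (suc i)))
    fans i = fan S (g (suc (suc i))) (g∉ _) p≤
    build : _ → SubdivisionK G a p
    build (h , inj , agree) = record
      { A = A ; B = B ; A-inj = λ {i} {i′} e → A-sep (subst (Reach G (_∉ S) (A i)) e (here (g∉ _)))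
      ; B-inj = λ {j} {j′} e → B-inj j j′ e
      ; AB = λ i j e → g∉ _ (subst (_∈ S) (≡sym e) (B∈ j))
      ; path = path ; isPath = λ i j → walk⇒isPath (F.walk i j) (F.unique i j)
      ; start = λ i j → walk-head (F.walk i j)
      ; end = λ i j → subst (EndsAt (path i j)) (end≡ i j) (walk-last (F.walk i j))
      ; inner-A = λ { i j i′ v v∈ refl → ≡sym (A-sep (reach i j v∈ (g∉ _))) }
      ; inner-B = λ { i j j′ v v∈ refl → B-inj j′ j (trans (F.only i j v∈ (B∈ j′)) (end≡ i j)) }
      ; disj = disj }
      where
      A : Fin a → V G
      A i = g (suc (suc (h (suc i))))
      B : Fin p → V G
      B j = Fan.ends (fans (h zero)) j
      module F (i : Fin a) = Fan (fans (h (suc i)))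
      path : Fin a → Fin p → List (V G)
      path = F.path
      B∈ : ∀ j → B j ∈ S
      B∈ = Fan.ends∈ (fans (h zero))
      end≡ : ∀ i j → F.ends i j ≡ B j
      end≡ i j = agree j (suc i) zero
      A-sep : ∀ {i i′} → Reach G (_∉ S) (A i) (A i′) → i ≡ i′
      A-sep r = Finₚ.suc-injective (inj (Finₚ.suc-injective (Finₚ.suc-injective (separated r))))
      reach : ∀ i j {v} → v ∈ₗ path i j → v ∉ S → Reach G (_∉ S) (A i) v
      reach i j = only-reach (F.walk i j) (F.unique i j) (F.only i j)
      B-inj : ∀ j j′ → B j ≡ B j′ → j ≡ j′
      B-inj j j′ e = Fan.disj (fans (h zero)) (end∈ (Fan.walk (fans (h zero)) j))
        (subst (_∈ₗ Fan.path (fans (h zero)) j′) (≡sym e) (end∈ (Fan.walk (fans (h zero)) j′)))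
        (λ e′ → g∉ _ (subst (_∈ S) e′ (B∈ j)))
      disj : ∀ i j i′ j′ v → ¬ (i ≡ i′ × j ≡ j′) → v ∈ₗ path i j → v ∈ₗ path i′ j′ →
             (∃ λ k → v ≡ A k) ⊎ (∃ λ k → v ≡ B k)
      disj i j i′ j′ v ne v∈ v∈′ with v Subₚ.∈? S
      ... | yes v∈S = inj₂ (j , trans (F.only i j v∈ v∈S) (end≡ i j))
      ... | no v∉S with A-sep (reach-trans (reach i j v∈ v∉S) (reach-sym (reach i′ j′ v∈′ v∉S)))
      ... | refl with v ≟ A i
      ... | yes v≡ = inj₁ (i , v≡)
      ... | no v≢ = ⊥-elim (ne (refl , F.disj i v∈ v∈′ v≢))

-- Long chains of separations from a tree-decomposition

record SetChain (G : Graph) (w M : ℕ) : Set where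
  open GraphBasics G
  field
    A      : ℕ → Subset (n G)
    strict : ∀ i → i < M → A i ⊆ A (suc i) × ∃ λ x → x ∈ A (suc i) × x ∉ A i
    small  : ∀ i → i ≤ M → ∣ ∂ (A i) ∣ ≤ w

-- A set larger than w + K F, torn by a bag of at most `w` vertices, has a piece with at least F
-- vertices or else more than K pieces; F is the bound for a chain that is one step shorter.
chainBound : ℕ → ℕ → ℕ → ℕ
chainBound K w zero = 0
chainBound K w (suc M) = suc (w + K * chainBound K w M)

module TreeChain (G : Graph) (p : ℕ) (conn : Connected G p) (w : ℕ) where

  open GraphBasics G
  open Fans G p conn

  -- All that is used of a tree-decomposition: a bag b separates the pieces D′ from the rest of the graph,
  -- and each piece is torn by the next bag, to depth k.
  Torn : ℕ → Subset (n G) → Set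
  Torn zero D = ⊥
  Torn (suc k) D = Σ (Subset (n G)) λ b → ∣ b ∣ ≤ w ×
    (∀ v → v ∈ D → v ∉ b → Σ (Subset (n G)) λ D′ →
      v ∈ D′ × D′ ⊆ D × (∀ {u} → u ∈ D′ → u ∉ b) ×
      (∀ {u x} → u ∈ D′ → u ~ x → x ∉ b → x ∈ D′) × Torn k D′)

  module FromTree (td : TreeDecomposition G w) where

    open TreeDecomposition td
    module 𝕋 = GraphBasics T

    private
      acyclic = proj₂ (proj₂ tree)

      On : (U : V T → Set) → V G → Set
      On U v = ∀ t → v ∈ bag t → U t

      on? : ∀ {U} → Decidable U → Decidable (On U)
      on? U? v = Finₚ.all? (λ t → (v Subₚ.∈? bag t) →-dec U? t)

      -- Returning from t″ to t without passing through t′ would close a cycle.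
      no-return : ∀ {t t′ t″} → t 𝕋.~ t′ → t′ 𝕋.~ t″ → t″ ≢ t → ∀ {y} → Reach T (_≢ t′) t″ y → y ≢ t
      no-return {t} {t′} e e′ t″≢t r refl with 𝕋.reach⇒path r
      ... | L , walk , u , avoid = cycle walk u avoid (walk-last walk)
        where
        cycle : ∀ {L} → Walk 𝕋._~_ _ t L → Unique L → (∀ {v} → v ∈ₗ L → v ≢ t′) → (∃ λ pre → L ≡ pre ++ [ t ]) → ⊥
        cycle nil _ _ _ = t″≢t refl
        cycle (cons d w) u avoid ([] , eq) with walk-head w
        ... | _ , refl with eq
        ... | ()
        cycle (cons d w) u avoid (_ ∷ pre , refl) = acyclic
          (t′ , t , _ ∷ pre , 𝕋.walk⇒isPath (cons e′ (cons d w)) (All.tabulate (λ { z∈ refl → avoid z∈ refl }) ∷ u) ,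
           (λ ()) , e)

    -- The set `D` consists of the vertices all of whose bags lie in the subtree reachable from `t`
    -- in `P`. A vertex outside the bag of `t` has its bags in one branch of T - t, and the vertices
    -- confined to this branch form its piece. By `key` that branch lies within `P`, so the
    -- recursion may replace `P` by `_≢ t`; the subtree loses `t`, which bounds the depth.
    torn : ∀ k t {P : V T → Set} (P? : Decidable P) → P t →
           (∀ {t′} → t 𝕋.~ t′ → P t′ → ∀ {y} → Reach T (_≢ t) t′ y → P y) →
           ∣ toSub (𝕋.reach? P? t) ∣ ≤ k → Torn k (toSub (on? (𝕋.reach? P? t)))
    torn zero t P? pt key small = ℕₚ.<-irrefl refl
      (ℕₚ.<-≤-trans (ℕₚ.≤-<-trans z≤n (Subₚ.x∈p⇒∣p-x∣<∣p∣ (∈toSub⁺ (𝕋.reach? P? t) (here pt)))) small)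
    torn (suc k) t {P} P? pt key sm = bag t , small t , piece
      where
      U? = 𝕋.reach? P? t
      ≢t? : Decidable (_≢ t)
      ≢t? y = ¬? (y ≟ t)
      D = toSub (on? U?)
      along : ∀ {v x y} → v ∉ bag t → v ∈ bag x → v ∈ bag y → Reach T (_≢ t) x y
      along {v} v∉ x∈ y∈ = 𝕋.reach-map (λ { z∈ refl → v∉ z∈ }) (coh v _ _ x∈ y∈)
      piece : ∀ v → v ∈ D → v ∉ bag t → _
      piece v v∈ v∉ with covers v
      ... | x , x∈ with 𝕋.last-exit t (∈toSub⁻ (on? U?) v∈ x x∈) (λ { refl → v∉ x∈ })
      ... | inj₁ r = ⊥-elim (proj₂ (𝕋.reach-start r) refl)
      ... | inj₂ (t′ , e , r) =
        D′ , ∈toSub⁺ (on? U′?) (λ y y∈ → 𝕋.reach-trans t′x (along v∉ x∈ y∈)) , (λ {_} → D′⊆D) ,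
        (λ {_} u∈ u∈t → 𝕋.reach-end (∈toSub⁻ (on? U′?) u∈ t u∈t) refl) , (λ {_} {_} → closed) ,
        torn k t′ ≢t? (proj₂ (𝕋.reach-start r)) (λ e′ → no-return e e′)
          (ℕₚ.≤-pred (ℕₚ.≤-trans (Subₚ.p⊂q⇒∣p∣<∣q∣ U′⊂U) sm))
        where
        U′? = 𝕋.reach? ≢t? t′
        D′ = toSub (on? U′?)
        t′x : Reach T (_≢ t) t′ x
        t′x = 𝕋.reach-map proj₂ r
        U′⊆U : ∀ {y} → Reach T (_≢ t) t′ y → Reach T P t y
        U′⊆U r′ = step pt e (𝕋.reach-map (λ (_ , r″) → key e (proj₁ (𝕋.reach-start r)) r″) (𝕋.reach-self r′))
        U′⊂U : toSub U′? Data.Fin.Subset.⊂ toSub U?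
        U′⊂U = (λ y∈ → ∈toSub⁺ U? (U′⊆U (∈toSub⁻ U′? y∈))) ,
               t , ∈toSub⁺ U? (here pt) , λ t∈ → 𝕋.reach-end (∈toSub⁻ U′? t∈) refl
        D′⊆D : D′ ⊆ D
        D′⊆D u∈ = ∈toSub⁺ (on? U?) (λ y y∈ → U′⊆U (∈toSub⁻ (on? U′?) u∈ y y∈))
        closed : ∀ {u z} → u ∈ D′ → u ~ z → z ∉ bag t → z ∈ D′
        closed u∈ e z∉ with edges _ _ e
        ... | y , u∈y , z∈y = ∈toSub⁺ (on? U′?) λ s s∈ → 𝕋.reach-trans (∈toSub⁻ (on? U′?) u∈ y u∈y) (along z∉ z∈y s∈)

    torn-all : ∃₂ λ k D → Torn k D × (∀ v → v ∈ D)
    torn-all = _ , _ , torn _ root (λ _ → yes tt) tt (λ _ _ _ → tt) ℕₚ.≤-refl ,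
      λ v → ∈toSub⁺ (on? (𝕋.reach? (λ _ → yes tt) root)) (λ t _ → proj₁ (proj₂ tree) root t tt tt)
      where
      root : V T
      root = Data.Fin.fromℕ< (proj₁ tree)

  module _ (a : ℕ) where

    private
      K : ℕ
      K = starCount p a w

    module Greedy {k} {D} (b : Subset (n G)) (b≤ : ∣ b ∣ ≤ w)
           (h : ∀ v → v ∈ D → v ∉ b → Σ (Subset (n G)) λ D′ →
                v ∈ D′ × D′ ⊆ D × (∀ {u} → u ∈ D′ → u ∉ b) ×
                (∀ {u x} → u ∈ D′ → u ~ x → x ∉ b → x ∈ D′) × Torn k D′) (F : ℕ) where

      LargePiece : Set
      LargePiece = Σ (Subset (n G)) λ D′ → D′ ⊆ D × F ≤ ∣ D′ ∣ ×
                   (∀ {u x} → u ∈ D′ → u ~ x → x ∉ b → x ∈ D′) × Torn k D′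

      -- Each of the `r` remaining rounds picks a vertex of `R` and deletes its piece. Pieces are
      -- closed under adjacency outside `b`, so later picks lie in other components of `G - b`, and
      -- as long as pieces have fewer than `F` vertices, `R` stays non-empty for all K rounds.
      greedy : ∀ r j → r + j ≡ K → (R : Subset (n G)) → r * F < ∣ R ∣ → (∀ {v} → v ∈ R → v ∈ D × v ∉ b) →
               (g : Fin j → V G) → (∀ i → g i ∉ b) → (∀ {i i′} → Reach G (_∉ b) (g i) (g i′) → i ≡ i′) →
               (∀ i {v} → v ∈ R → ¬ Reach G (_∉ b) (g i) v) → SubdivisionK G a p ⊎ LargePiece
      greedy zero j refl R _ _ g g∉ sep _ = inj₁ (star a w b b≤ g g∉ sep)
      greedy (suc r) j eq R big R∈ g g∉ sep far with nonempty R (ℕₚ.≤-<-trans z≤n big)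
      ... | v , v∈ with h v (proj₁ (R∈ v∈)) (proj₂ (R∈ v∈))
      ... | D′ , v∈D′ , D′⊆D , _ , closed , torn′ with F ≤? ∣ D′ ∣
      ... | yes F≤ = inj₂ (D′ , (λ {_} → D′⊆D) , F≤ , (λ {_} {_} → closed) , torn′)
      ... | no F≰ = greedy r (suc j) (trans (ℕₚ.+-suc r j) eq) R′ big′ (R∈ ∘ proj₁ ∘ ∈toSub⁻ R′?)
                     g′ g′∉ sep′ far′
        where
        R′? : Decidable (λ u → u ∈ R × u ∉ D′)
        R′? u = (u Subₚ.∈? R) ×-dec ¬? (u Subₚ.∈? D′)
        R′ = toSub R′?
        R⊆ : R ⊆ D′ ∪ R′
        R⊆ {u} u∈ with u Subₚ.∈? D′
        ... | yes u∈′ = Subₚ.x∈p∪q⁺ (inj₁ u∈′)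
        ... | no u∉′ = Subₚ.x∈p∪q⁺ (inj₂ (∈toSub⁺ R′? (u∈ , u∉′)))
        big′ : r * F < ∣ R′ ∣
        big′ = ℕₚ.+-cancelˡ-< F _ _ (ℕₚ.<-≤-trans big (ℕₚ.≤-trans (ℕₚ.≤-trans (Subₚ.p⊆q⇒∣p∣≤∣q∣ R⊆) (∣∪∣≤ D′ R′))
                 (ℕₚ.+-monoˡ-≤ ∣ R′ ∣ (ℕₚ.<⇒≤ (ℕₚ.≰⇒> F≰)))))
        stays : ∀ {u x} → u ∈ D′ → Reach G (_∉ b) u x → x ∈ D′
        stays u∈ (here _) = u∈
        stays u∈ (step _ e r) = stays (closed u∈ e (reach-start r)) r
        g′ : Fin (suc j) → V G
        g′ zero = v
        g′ (suc i) = g i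
        g′∉ : ∀ i → g′ i ∉ b
        g′∉ zero = proj₂ (R∈ v∈)
        g′∉ (suc i) = g∉ i
        sep′ : ∀ {i i′} → Reach G (_∉ b) (g′ i) (g′ i′) → i ≡ i′
        sep′ {zero} {zero} _ = refl
        sep′ {zero} {suc i} r = ⊥-elim (far i v∈ (reach-sym r))
        sep′ {suc i} {zero} r = ⊥-elim (far i v∈ r)
        sep′ {suc i} {suc i′} r = cong suc (sep r)
        far′ : ∀ i {u} → u ∈ R′ → ¬ Reach G (_∉ b) (g′ i) u
        far′ zero u∈ r = proj₂ (∈toSub⁻ R′? u∈) (stays v∈D′ r)
        far′ (suc i) u∈ r = far i (proj₁ (∈toSub⁻ R′? u∈)) r

      largePiece : w + K * F < ∣ D ∣ → SubdivisionK G a p ⊎ LargePiece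
      largePiece big = greedy K 0 (ℕₚ.+-identityʳ K) R bigR (∈toSub⁻ R?) (λ ()) (λ ()) (λ { {()} }) (λ ())
        where
        R? : Decidable (λ u → u ∈ D × u ∉ b)
        R? u = (u Subₚ.∈? D) ×-dec ¬? (u Subₚ.∈? b)
        R = toSub R?
        D⊆ : D ⊆ b ∪ R
        D⊆ {u} u∈ with u Subₚ.∈? b
        ... | yes u∈′ = Subₚ.x∈p∪q⁺ (inj₁ u∈′)
        ... | no u∉′ = Subₚ.x∈p∪q⁺ (inj₂ (∈toSub⁺ R? (u∈ , u∉′)))
        bigR : K * F < ∣ R ∣
        bigR = ℕₚ.+-cancelˡ-< w _ _ (ℕₚ.<-≤-trans big (ℕₚ.≤-trans (ℕₚ.≤-trans (Subₚ.p⊆q⇒∣p∣≤∣q∣ D⊆) (∣∪∣≤ b R))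
                 (ℕₚ.+-monoˡ-≤ ∣ R ∣ b≤)))

    private
      ∁ = Data.Fin.Subset.∁

    ∂∁≤ : ∀ b D → ∣ b ∣ ≤ w → (∀ {u x} → u ∈ D → u ~ x → x ∉ b → x ∈ D) → ∣ ∂ (∁ D) ∣ ≤ w
    ∂∁≤ b D b≤ closed = ℕₚ.≤-trans (Subₚ.p⊆q⇒∣p∣≤∣q∣ ∂⊆b) b≤
      where
      ∂⊆b : ∂ (∁ D) ⊆ b
      ∂⊆b {v} v∈ with v Subₚ.∈? b | ∂⁻ (∁ D) v∈
      ... | yes v∈b | _ = v∈b
      ... | no v∉b | v∉ , m , e , m∈ = ⊥-elim (Subₚ.x∈∁p⇒x∉p v∉ (closed (Subₚ.x∉∁p⇒x∈p m∈) (~-sym e) v∉b))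

    -- The chain consists of complements of ever smaller pieces, whose boundaries lie in bags. A
    -- piece equal to `D` adds no strict step, so it consumes depth of the tree but no length;
    -- `∁ D ⊆ A 0` allows `∁ D` to be prepended one level up.
    extract : ∀ k M D → Torn k D → ∣ ∂ (∁ D) ∣ ≤ w → chainBound K w M ≤ ∣ D ∣ →
              SubdivisionK G a p ⊎ (Σ (SetChain G w M) λ C → ∁ D ⊆ SetChain.A C 0)
    extract k zero D _ small _ = inj₂ (record { A = λ _ → ∁ D ; strict = λ _ () ; small = λ _ _ → small } , id)
    extract (suc k) (suc M) D (b , b≤ , h) small big with Greedy.largePiece b b≤ h (chainBound K w M) big
    ... | inj₁ K = inj₁ K
    ... | inj₂ (D′ , D′⊆D , F≤ , closed , torn′) with Finₚ.any? (λ v → (v Subₚ.∈? D) ×-dec ¬? (v Subₚ.∈? D′))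
    ... | no ¬ex with extract k (suc M) D′ torn′ (∂∁≤ b D′ b≤ closed) (ℕₚ.≤-trans big (Subₚ.p⊆q⇒∣p∣≤∣q∣ D⊆D′))
      where
      D⊆D′ : D ⊆ D′
      D⊆D′ {v} v∈ with v Subₚ.∈? D′
      ... | yes v∈′ = v∈′
      ... | no v∉′ = ⊥-elim (¬ex (v , v∈ , v∉′))
    ... | inj₁ K = inj₁ K
    ... | inj₂ (C , sub) = inj₂ (C , sub ∘ Subₚ.p⊆q⇒∁p⊇∁q D′⊆D)
    extract (suc k) (suc M) D (b , b≤ , h) small big | inj₂ (D′ , D′⊆D , F≤ , closed , torn′) | yes (v , v∈ , v∉)
      with extract k M D′ torn′ (∂∁≤ b D′ b≤ closed) F≤
    ... | inj₁ K = inj₁ K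
    ... | inj₂ (C , sub) = inj₂ (record
      { A = λ { zero → ∁ D ; (suc i) → C.A i }
      ; strict = λ { zero _ → sub ∘ Subₚ.p⊆q⇒∁p⊇∁q D′⊆D , v , sub (Subₚ.x∉p⇒x∈∁p v∉) , λ v∈∁ → Subₚ.x∈∁p⇒x∉p v∈∁ v∈
                   ; (suc i) (s≤s i<) → C.strict i i< }
      ; small = λ { zero _ → small ; (suc i) (s≤s i≤) → C.small i i≤ } } , id)
      where module C = SetChain C

    longChain : ∀ M → TreeDecomposition G w → chainBound K w M ≤ n G → SubdivisionK G a p ⊎ SetChain G w M
    longChain M td big with FromTree.torn-all td
    ... | k , D , torn , all∈ with extract k M D torn small big′
      where
      small : ∣ ∂ (∁ D) ∣ ≤ w
      small = ℕₚ.≤-trans (Subₚ.p⊆q⇒∣p∣≤∣q∣ {q = ∅} λ v∈ → ⊥-elim (Subₚ.x∈∁p⇒x∉p (∂⊆ (∁ D) v∈) (all∈ _)))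
                (ℕₚ.≤-trans (ℕₚ.≤-reflexive (Subₚ.∣⊥∣≡0 (n G))) z≤n)
      big′ : chainBound K w M ≤ ∣ D ∣
      big′ = ℕₚ.≤-trans big (ℕₚ.≤-trans (ℕₚ.≤-reflexive (≡sym (Subₚ.∣⊤∣≡n (n G)))) (Subₚ.p⊆q⇒∣p∣≤∣q∣ {p = full} {q = D} λ _ → all∈ _))
    ... | inj₁ K = inj₁ K
    ... | inj₂ (C , _) = inj₂ C

-- Chains of linked separations of constant order

-- One block more than the steps of the chain of smaller order, each with `l (suc q)` steps of its
-- own and one step that separates it from the next block. The length `l` is a function because the
-- final order is not known beforehand.
slimBound : (ℕ → ℕ) → ℕ → ℕ
slimBound l zero = l 0
slimBound l (suc q) = suc (slimBound l q) * suc (l (suc q))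

module Chains (G : Graph) (o o′ : V G) where

  open GraphBasics G public

  Proper : Subset (n G) → Set
  Proper A = o ∉ A × o′ ∈ A × o′ ∉ ∂ A

  proper-between : ∀ {A A′ A″} → A ⊆ A′ → A′ ⊆ A″ → Proper A → Proper A″ → Proper A′
  proper-between {A} {A′} ⊆₁ ⊆₂ (_ , o′∈ , o′∉) (o∉ , _) = o∉ ∘ ⊆₂ , ⊆₁ o′∈ , o′∉ ∘ ∂-antitone A A′ ⊆₁ o′∈

  infix 4 _⊏_
  _⊏_ : Subset (n G) → Subset (n G) → Set
  A ⊏ A″ = (∀ {v} → v ∈ A → v ∈ A″) × ∃ λ x → x ∈ A″ × x ∉ A

  record ProperChain (w M : ℕ) : Set where
    field
      A      : ℕ → Subset (n G)
      strict : ∀ i → i < M → A i ⊏ A (suc i)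
      small  : ∀ i → i ≤ M → ∣ ∂ (A i) ∣ ≤ w
      proper : ∀ i → i ≤ M → Proper (A i)

  -- A i stands for the separation (A i , V ∖ interior of A i) of order |∂ (A i)|, so ∂ (A i) will be an adhesion set
  -- and Bag (A i) (A (suc i)) an inner bag; o and o′ witness that no end bag is contained in its neighbour.
  record BrickChain (q M : ℕ) : Set where
    field
      A      : ℕ → Subset (n G)
      strict : ∀ i → i < M → A i ⊏ A (suc i)
      card   : ∀ i → i ≤ M → ∣ ∂ (A i) ∣ ≡ q
      proper : ∀ i → i ≤ M → Proper (A i)
      s t    : ℕ → Fin q → V G
      R      : ℕ → Fin q → List (V G)
      paths  : ∀ i → i < M → Paths (Bag (A i) (A (suc i))) (s i) (t i) (R i)
      s∈     : ∀ i → i < M → ∀ α → s i α ∈ ∂ (A i)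
      t∈     : ∀ i → i < M → ∀ α → t i α ∈ ∂ (A (suc i))

  monotone : ∀ (A : ℕ → Subset (n G)) {M} → (∀ i → i < M → A i ⊏ A (suc i)) →
             ∀ {i j} → i ≤ j → j ≤ M → ∀ {v} → v ∈ A i → v ∈ A j
  monotone A strict {j = zero} z≤n j≤ v∈ = v∈
  monotone A strict {i} {suc j} i≤ j≤ v∈ with ℕₚ.m≤n⇒m<n∨m≡n i≤
  ... | inj₂ refl = v∈
  ... | inj₁ i<   = proj₁ (strict j j≤) (monotone A strict (ℕₚ.≤-pred i<) (ℕₚ.<⇒≤ j≤) v∈)

  assemble : ∀ {q M} (A : ℕ → Subset (n G)) → (∀ i → i < M → A i ⊏ A (suc i)) → (∀ i → i ≤ M → ∣ ∂ (A i) ∣ ≡ q) →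
             (∀ i → i ≤ M → Proper (A i)) → (∀ i → i < M → Brick (A i) (A (suc i)) q) → BrickChain q M
  assemble {q} {M} A strict card proper brick = record
    { A = A ; strict = strict ; card = card ; proper = proper
    ; s = proj₁ ∘ f ; t = proj₁ ∘ proj₂ ∘ f ; R = proj₂ ∘ proj₂ ∘ f
    ; paths = λ i i< → proj₁ (is i i<) ; s∈ = λ i i< → proj₁ (proj₂ (is i i<)) ; t∈ = λ i i< → proj₂ (proj₂ (is i i<)) }
    where
    IsBrick : ℕ → (Fin q → V G) × (Fin q → V G) × (Fin q → List (V G)) → Set
    IsBrick i (s , t , R) = Paths (Bag (A i) (A (suc i))) s t R × (∀ α → s α ∈ ∂ (A i)) × (∀ α → t α ∈ ∂ (A (suc i)))
    chosen = choose M {P = IsBrick} ((λ _ → o) , (λ _ → o) , λ _ → [])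
      (λ i i< → let open Brick (brick i i<) in (s , t , R) , paths , s∈ , t∈)
    f = proj₁ chosen
    is = proj₂ chosen

  -- Either some block of consecutive separations has order exactly w and is linked at every step, or every block
  -- yields a separation of smaller order, and these again form a chain.
  slim : ∀ l w → ProperChain w (slimBound l w) → ∃ λ q → q ≤ w × BrickChain q (l q)
  slim l zero C = zero , z≤n ,
    assemble A strict (λ i i≤ → ℕₚ.n≤0⇒n≡0 (small i i≤)) proper
      λ i i< → case Cut.cut (A i) (A (suc i)) (proj₁ (strict i i<)) 0 of λ { (inj₁ b) → b ; (inj₂ (_ , _ , _ , ())) }
    where open ProperChain C
  slim l (suc w) C with all<⊎ (suc (slimBound l w)) block
    where
    open ProperChain C
    L = l (suc w)
    M = slimBound l (suc w)
    inRange : ∀ k → k < suc (slimBound l w) → ∀ i → i ≤ L → k * suc L + i < M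
    inRange k k< i i≤ = ℕₚ.<-≤-trans (ℕₚ.+-monoʳ-< (k * suc L) (s≤s i≤))
      (ℕₚ.≤-trans (ℕₚ.≤-reflexive (ℕₚ.+-comm (k * suc L) (suc L))) (ℕₚ.*-monoˡ-≤ (suc L) k<))
    Gap : ℕ → Subset (n G) → Set
    Gap k A′ = (∀ {v} → v ∈ A (k * suc L) → v ∈ A′) × (∀ {v} → v ∈ A′ → v ∈ A (k * suc L + L)) × ∣ ∂ A′ ∣ ≤ w
    block : ∀ k → k < suc (slimBound l w) → ∃ (Gap k) ⊎ BrickChain (suc w) L
    block k k< with all<⊎ (suc L) sizes
      where
      sizes : ∀ i → i < suc L → ∣ ∂ (A (k * suc L + i)) ∣ ≡ suc w ⊎ ∃ (Gap k)
      sizes i (s≤s i≤) with ℕₚ.m≤n⇒m<n∨m≡n (small _ (ℕₚ.<⇒≤ (inRange k k< i i≤)))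
      ... | inj₂ eq = inj₁ eq
      ... | inj₁ lt = inj₂ (A (k * suc L + i) ,
        monotone A strict (ℕₚ.m≤m+n (k * suc L) i) (ℕₚ.<⇒≤ (inRange k k< i i≤)) ,
        monotone A strict (ℕₚ.+-monoʳ-≤ (k * suc L) i≤) (ℕₚ.<⇒≤ (inRange k k< L ℕₚ.≤-refl)) , ℕₚ.≤-pred lt)
    ... | inj₂ gap = inj₁ gap
    ... | inj₁ card with all<⊎ L bricks
      where
      bricks : ∀ i → i < L → Brick (A (k * suc L + i)) (A (k * suc L + suc i)) (suc w) ⊎ ∃ (Gap k)
      bricks i i< with Cut.cut (A (k * suc L + i)) (A (k * suc L + suc i))
                         (λ v∈ → monotone A strict (ℕₚ.+-monoʳ-≤ (k * suc L) (ℕₚ.n≤1+n i)) (ℕₚ.<⇒≤ (inRange k k< (suc i) i<)) v∈) (suc w)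
      ... | inj₁ b = inj₁ b
      ... | inj₂ (A′ , ⊆₁ , ⊆₂ , lt) = inj₂ (A′ ,
        (λ v∈ → ⊆₁ (monotone A strict (ℕₚ.m≤m+n (k * suc L) i) (ℕₚ.<⇒≤ (inRange k k< i (ℕₚ.<⇒≤ i<))) v∈)) ,
        (λ v∈ → monotone A strict (ℕₚ.+-monoʳ-≤ (k * suc L) i<) (ℕₚ.<⇒≤ (inRange k k< L ℕₚ.≤-refl)) (⊆₂ v∈)) , ℕₚ.≤-pred lt)
    ... | inj₂ gap = inj₁ gap
    ... | inj₁ brick = inj₂ (assemble (λ i → A (k * suc L + i))
      (λ i i< → subst (λ j → A (k * suc L + i) ⊏ A j) (≡sym (ℕₚ.+-suc (k * suc L) i)) (strict _ (inRange k k< i (ℕₚ.<⇒≤ i<))))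
      (λ i i≤ → card i (s≤s i≤)) (λ i i≤ → proper _ (ℕₚ.<⇒≤ (inRange k k< i i≤))) brick)
  ... | inj₂ done = suc w , ℕₚ.≤-refl , done
  ... | inj₁ gaps with choose _ (ProperChain.A C 0) gaps
  ... | A′ , gap = let q , q≤ , D = slim l w C′ in q , ℕₚ.m≤n⇒m≤1+n q≤ , D
    where
    open ProperChain C
    L = l (suc w)
    end< : ∀ {k} → k < suc (slimBound l w) → k * suc L + L < slimBound l (suc w)
    end< {k} k< = ℕₚ.≤-trans (ℕₚ.≤-reflexive (trans (≡sym (ℕₚ.+-suc (k * suc L) L)) (ℕₚ.+-comm (k * suc L) (suc L))))
                    (ℕₚ.*-monoˡ-≤ (suc L) k<)
    suc≡ : ∀ k → suc (k * suc L + L) ≡ suc k * suc L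
    suc≡ k = trans (≡sym (ℕₚ.+-suc (k * suc L) L)) (ℕₚ.+-comm (k * suc L) (suc L))
    C′ : ProperChain w (slimBound l w)
    C′ = record
      { A = A′
      -- The new separations of two consecutive blocks may touch the ends of these blocks; the step
      -- between the blocks makes the inclusion strict.
      ; strict = λ k k< →
          let up = strict (k * suc L + L) (end< (ℕₚ.m≤n⇒m≤1+n k<))
              next : ∀ {v} → v ∈ A (suc (k * suc L + L)) → v ∈ A′ (suc k)
              next {v} v∈ = proj₁ (gap (suc k) (s≤s k<)) (subst (λ j → v ∈ A j) (suc≡ k) v∈)
              below = proj₁ (proj₂ (gap k (ℕₚ.m≤n⇒m≤1+n k<)))
          in (λ v∈ → next (proj₁ up (below v∈))) ,
             proj₁ (proj₂ up) , next (proj₁ (proj₂ (proj₂ up))) , proj₂ (proj₂ (proj₂ up)) ∘ below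
      ; small = λ k k≤ → proj₂ (proj₂ (gap k (s≤s k≤)))
      ; proper = λ k k≤ → proper-between (proj₁ (gap k (s≤s k≤))) (proj₁ (proj₂ (gap k (s≤s k≤))))
          (proper _ (ℕₚ.≤-trans (ℕₚ.m≤m+n (k * suc L) L) (ℕₚ.<⇒≤ (end< (s≤s k≤))))) (proper _ (ℕₚ.<⇒≤ (end< (s≤s k≤)))) }

-- The first `suc w` sets and the last one are given up. The set `A (suc w)` has more than `w`
-- elements, so one of them, `o′`, is off its boundary; and a vertex `o` gained in the last step
-- lies in none of the sets that are kept.
properChain : ∀ (G : Graph) w M → SetChain G w (suc (suc w + M)) → ∃₂ λ o o′ → Chains.ProperChain G o o′ w M
properChain G w M C = o , o′ , record
  { A = λ i → A (suc w + i)
  ; strict = λ i i< → let sub , x , x∈ , x∉ = strict (suc w + i) (s≤s (ℕₚ.<⇒≤ (ℕₚ.+-monoʳ-< (suc w) i<))) in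
      subst (λ j → A (suc w + i) ⊏ A j) (≡sym (ℕₚ.+-suc (suc w) i)) (sub , x , x∈ , x∉)
  ; small = λ i i≤ → small _ (ℕₚ.m≤n⇒m≤1+n (ℕₚ.+-monoʳ-≤ (suc w) i≤))
  ; proper = λ i i≤ →
      (λ o∈ → o∉ (up (ℕₚ.+-monoʳ-≤ (suc w) i≤) (ℕₚ.n≤1+n _) o∈)) ,
      up (ℕₚ.m≤m+n (suc w) i) (ℕₚ.m≤n⇒m≤1+n (ℕₚ.+-monoʳ-≤ (suc w) i≤)) o′∈ ,
      o′∉ ∘ ∂-antitone (A (suc w)) (A (suc w + i)) (up (ℕₚ.m≤m+n (suc w) i) (ℕₚ.m≤n⇒m≤1+n (ℕₚ.+-monoʳ-≤ (suc w) i≤))) o′∈ }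
  where
  open SetChain C
  top = strict (suc w + M) ℕₚ.≤-refl
  o = proj₁ (proj₂ top)
  o∉ = proj₂ (proj₂ (proj₂ top))
  open Chains G o o using (_⊏_; monotone; ∂; ∂-antitone)
  strict′ : ∀ i → i < suc (suc w + M) → A i ⊏ A (suc i)
  strict′ i i< = let sub , r = strict i i< in sub , r
  up : ∀ {i j} → i ≤ j → j ≤ suc (suc w + M) → ∀ {v} → v ∈ A i → v ∈ A j
  up = monotone A strict′
  large : ∀ i → i ≤ suc (suc w + M) → i ≤ ∣ A i ∣
  large zero _ = z≤n
  large (suc i) i< = ℕₚ.≤-trans (s≤s (large i (ℕₚ.<⇒≤ i<)))
    (Subₚ.p⊂q⇒∣p∣<∣q∣ (let sub , x , x∈ , x∉ = strict i i< in (λ {_} → sub) , x , x∈ , x∉))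
  inner : ∃ λ x → x ∈ A (suc w) × x ∉ ∂ (A (suc w))
  inner with Finₚ.any? (λ x → (x Subₚ.∈? A (suc w)) ×-dec ¬? (x Subₚ.∈? ∂ (A (suc w))))
  ... | yes found = found
  ... | no ¬ex = ⊥-elim (ℕₚ.<-irrefl refl (ℕₚ.≤-trans (large (suc w) w<) (ℕₚ.≤-trans (Subₚ.p⊆q⇒∣p∣≤∣q∣ A⊆∂) (small (suc w) w<))))
    where
    w< : suc w ≤ suc (suc w + M)
    w< = ℕₚ.m≤n⇒m≤1+n (ℕₚ.m≤m+n (suc w) M)
    A⊆∂ : A (suc w) ⊆ ∂ (A (suc w))
    A⊆∂ {x} x∈ with x Subₚ.∈? ∂ (A (suc w))
    ... | yes x∈∂ = x∈∂
    ... | no x∉∂ = ⊥-elim (¬ex (x , x∈ , x∉∂))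
  o′ = proj₁ inner
  o′∈ = proj₁ (proj₂ inner)
  o′∉ = proj₂ (proj₂ inner)

-- Labelling and merging

-- New bag `i` is the union of the old bags `k` with `Within i k`, so a selection both drops bags at
-- the two ends and merges consecutive ones.
record Selection (M M′ : ℕ) : Set where
  field
    f   : ℕ → ℕ
    inc : ∀ i → i < M′ → f i < f (suc i)
    end : f M′ ≤ M

  f-mono : ∀ {i j} → i ≤ j → j ≤ M′ → f i ≤ f j
  f-mono {j = zero} z≤n _ = ℕₚ.≤-refl
  f-mono {i} {suc j} i≤ j≤ with ℕₚ.m≤n⇒m<n∨m≡n i≤
  ... | inj₂ refl = ℕₚ.≤-refl
  ... | inj₁ i<   = ℕₚ.≤-trans (f-mono (ℕₚ.≤-pred i<) (ℕₚ.<⇒≤ j≤)) (ℕₚ.<⇒≤ (inc j j≤))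

  f≤ : ∀ {i} → i ≤ M′ → f i ≤ M
  f≤ i≤ = ℕₚ.≤-trans (f-mono i≤ ℕₚ.≤-refl) end

  Within : ℕ → ℕ → Set
  Within i k = f i ≤ k × k < f (suc i)

find-step : ∀ {P : ℕ → Set} → (∀ k → Dec (P k)) → ∀ {i j} → i ≤ j → ¬ P i → P j →
            ∃ λ k → i ≤ k × k < j × ¬ P k × P (suc k)
find-step P? {i} {zero} z≤n ¬p p = ⊥-elim (¬p p)
find-step P? {i} {suc j} i≤ ¬p p with ℕₚ.m≤n⇒m<n∨m≡n i≤ | P? j
... | inj₂ refl | _ = ⊥-elim (¬p p)
... | inj₁ i< | no ¬pj = j , ℕₚ.≤-pred i< , ℕₚ.≤-refl , ¬pj , p
... | inj₁ i< | yes pj with find-step P? (ℕₚ.≤-pred i<) ¬p pj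
... | k , i≤k , k<j , ¬pk , pk = k , i≤k , ℕₚ.m≤n⇒m≤1+n k<j , ¬pk , pk

walk-glue-suffix : ∀ {A : Set} {E : A → A → Set} {x y z L L′} → Walk E x y L → Walk E y z L′ →
                   ∃ λ init → L ⊙ L′ ≡ init ++ L′
walk-glue-suffix nil w′ with walk-head w′
... | _ , refl = [] , refl
walk-glue-suffix (cons {x = x} _ w) w′ with walk-glue-suffix w w′
... | init , eq = x ∷ init , cong (x ∷_) eq

infix-++ˡ : {A : Set} {Q P : List A} (init : List A) → Infix Q P → Infix Q (init ++ P)
infix-++ˡ init (ls , rs , refl) = init ++ ls , rs , ≡sym (Listₚ.++-assoc init ls _)

infix-pathEdge : {A : Set} {Q P : List A} → Infix Q P → ∀ {u v} → PathEdge Q u v → PathEdge P u v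
infix-pathEdge {A} (ls , rs , refl) = λ { (inj₁ c) → inj₁ (shift c) ; (inj₂ c) → inj₂ (shift c) }
  where
  shift : ∀ {Q u v} → Consec Q u v → Consec (ls ++ (Q ++ rs)) u v
  shift {u = u} {v} (ls′ , rs′ , refl) = ls ++ ls′ , rs′ ++ rs ,
    trans (cong (ls ++_) (Listₚ.++-assoc ls′ (u ∷ v ∷ rs′) rs)) (≡sym (Listₚ.++-assoc ls ls′ _))

module Connections (G : Graph) where

  open GraphBasics G

  module _ (U : V G → Set) {q : ℕ} (on : Fin q → V G → Set) where

    Out : V G → Set
    Out v = U v × ¬ ∃ λ γ → on γ v

    -- A form of `Attaches2` in terms of vertex sets alone: demanding `α ≢ β` for a single edge
    -- replaces the exclusion of path edges. For disjoint induced paths the two notions agree, also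
    -- for `α ≡ β`, where only non-trivial bridges count.
    Joined : Fin q → Fin q → Set
    Joined α β = ∃₂ λ u v → on α u × on β v ×
      ((α ≢ β × u ~ v) ⊎ ∃₂ λ c c′ → u ~ c × v ~ c′ × Reach G Out c c′)

    Att : V G → Fin q → Set
    Att c α = Out c × ∃₂ λ c′ u → Reach G Out c c′ × on α u × c′ ~ u

    module _ (U? : Decidable U) (on? : ∀ α → Decidable (on α)) where

      out? : Decidable Out
      out? v = U? v ×-dec ¬? (Finₚ.any? λ γ → on? γ v)

      joined? : ∀ α β → Dec (Joined α β)
      joined? α β = Finₚ.any? λ u → Finₚ.any? λ v → on? α u ×-dec on? β v ×-dec
        ((¬? (α ≟ β) ×-dec (u ~? v)) ⊎-dec
         Finₚ.any? λ c → Finₚ.any? λ c′ → (u ~? c) ×-dec (v ~? c′) ×-dec reach? out? c c′)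

      att? : ∀ c α → Dec (Att c α)
      att? c α = out? c ×-dec Finₚ.any? λ c′ → Finₚ.any? λ u → reach? out? c c′ ×-dec on? α u ×-dec (c′ ~? u)

    joined-sym : ∀ {α β} → Joined α β → Joined β α
    joined-sym (u , v , u∈ , v∈ , inj₁ (≢ , e)) = v , u , v∈ , u∈ , inj₁ (≢ ∘ ≡sym , ~-sym e)
    joined-sym (u , v , u∈ , v∈ , inj₂ (c , c′ , e , e′ , r)) = v , u , v∈ , u∈ , inj₂ (c′ , c , e′ , e , reach-sym r)

    att-reach : ∀ {c d α} → Reach G Out c d → Att d α → Att c α
    att-reach r (_ , c′ , u , r′ , u∈ , e) = reach-start r , c′ , u , reach-trans r r′ , u∈ , e

  -- The sets `on` and `on′` must agree, since the ends of a bridge need one inclusion and `Out` the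
  -- reverse one.
  joined-cong : ∀ {U U′ : V G → Set} {q} {on on′ : Fin q → V G → Set} → (∀ {v} → U v → U′ v) →
                (∀ {γ v} → on γ v → on′ γ v) → (∀ {γ v} → on′ γ v → on γ v) →
                ∀ {α β} → Joined U on α β → Joined U′ on′ α β
  joined-cong f g g⁻ (u , v , u∈ , v∈ , inj₁ e) = u , v , g u∈ , g v∈ , inj₁ e
  joined-cong f g g⁻ (u , v , u∈ , v∈ , inj₂ (c , c′ , e , e′ , r)) = u , v , g u∈ , g v∈ ,
    inj₂ (c , c′ , e , e′ , reach-map (λ (a , b) → f a , λ (γ , h) → b (γ , g⁻ h)) r)

  att-cong : ∀ {U U′ : V G → Set} {q} {on on′ : Fin q → V G → Set} → (∀ {v} → U v → U′ v) →
             (∀ {γ v} → on γ v → on′ γ v) → (∀ {γ v} → on′ γ v → on γ v) →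
             ∀ {c α} → Att U on c α → Att U′ on′ c α
  att-cong {U} {U′} {on = on} {on′} f g g⁻ (o , c′ , u , r , u∈ , e) =
    out o , c′ , u , reach-map out r , g u∈ , e
    where
    out : ∀ {v} → Out U on v → Out U′ on′ v
    out (a , b) = f a , λ (γ , h) → b (γ , g⁻ h)

module LabelledChains (G : Graph) (o o′ : V G) where

  open Chains G o o′ public
  open Connections G public

  -- Unlike in a `BrickChain`, paths with the same label in consecutive bags share the vertex
  -- `x (suc i) α`, so they concatenate.
  record Chain (q M : ℕ) : Set where
    field
      A      : ℕ → Subset (n G)
      strict : ∀ i → i < M → A i ⊏ A (suc i)
      card   : ∀ i → i ≤ M → ∣ ∂ (A i) ∣ ≡ q
      proper : ∀ i → i ≤ M → Proper (A i)
      x      : ℕ → Fin q → V G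
      R      : ℕ → Fin q → List (V G)
      paths  : ∀ i → i < M → Paths (Bag (A i) (A (suc i))) (x i) (x (suc i)) (R i)
      x∈ˡ    : ∀ i → i < M → ∀ α → x i α ∈ ∂ (A i)
      x∈ʳ    : ∀ i → i < M → ∀ α → x (suc i) α ∈ ∂ (A (suc i))

    U : ℕ → V G → Set
    U i = Bag (A i) (A (suc i))

    on : ℕ → Fin q → V G → Set
    on i α v = v ∈ₗ R i α

    NT : ℕ → Fin q → Set
    NT i α = x i α ≢ x (suc i) α

    E : ℕ → Fin q → Fin q → Set
    E i = Joined (U i) (on i)

    nt? : ∀ i α → Dec (NT i α)
    nt? i α = ¬? (x i α ≟ x (suc i) α)

    e? : ∀ i α β → Dec (E i α β)
    e? i = joined? (U i) (on i) (bag? (A i) (A (suc i))) (λ α v → v ∈L? R i α)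

  module Stitch {q M} (C : BrickChain q M) where

    open BrickChain C

    private
      τ : ℕ → Fin q → Fin q
      τ i β with Finₚ.any? (λ γ → t i β ≟ s (suc i) γ)
      ... | yes (γ , _) = γ
      -- A default value; `τ-matches` shows that the case does not occur within the chain.
      ... | no _        = β

    -- The index, in brick `i`, of the path that continues the path with index α of brick 0.
    σ : ℕ → Fin q → Fin q
    σ zero α = α
    σ (suc i) α = τ i (σ i α)

    private
      module P {i} (i< : i < M) = Paths (paths i i<)

      s-injective : ∀ {i} → i < M → Injective _≡_ _≡_ (s i)
      s-injective {i} i< {α} {β} e =
        P.disj i< (start∈ (P.walk i< α)) (subst (_∈ₗ R i β) (≡sym e) (start∈ (P.walk i< β)))

      t-injective : ∀ {i} → i < M → Injective _≡_ _≡_ (t i)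
      t-injective {i} i< {α} {β} e =
        P.disj i< (end∈ (P.walk i< α)) (subst (_∈ₗ R i β) (≡sym e) (end∈ (P.walk i< β)))

      τ-matches : ∀ {i} → suc i < M → ∀ β → t i β ≡ s (suc i) (τ i β)
      τ-matches {i} i< β with Finₚ.any? (λ γ → t i β ≟ s (suc i) γ)
      ... | yes (γ , e) = e
      ... | no ¬found = ⊥-elim (¬found (injective⇒onto (∂ (A (suc i))) (s (suc i)) (s-injective i<) (s∈ (suc i) i<)
                          (ℕₚ.≤-reflexive (card (suc i) (ℕₚ.<⇒≤ i<))) (t∈ i (ℕₚ.<⇒≤ i<) β)))

    σ-injective : ∀ {i} → i < M → Injective _≡_ _≡_ (σ i)
    σ-injective {zero} _ e = e
    σ-injective {suc i} i< {α} {β} e = σ-injective (ℕₚ.<⇒≤ i<) (t-injective (ℕₚ.<⇒≤ i<)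
      (trans (τ-matches i< (σ i α)) (trans (cong (s (suc i)) e) (≡sym (τ-matches i< (σ i β))))))

    σ-step : ∀ {i} → suc i < M → ∀ α γ → t i (σ i α) ≡ s (suc i) γ → σ (suc i) α ≡ γ
    σ-step i< α γ e = s-injective i< (trans (≡sym (τ-matches i< _)) e)

    labels : ℕ → Fin q → V G
    labels zero α = s zero α
    labels (suc i) α = t i (σ i α)

    labels≡s : ∀ {i} → i < M → ∀ α → labels i α ≡ s i (σ i α)
    labels≡s {zero} _ α = refl
    labels≡s {suc i} i< α = τ-matches i< (σ i α)

    stitched : Chain q M
    stitched = record
      { A = A ; strict = strict ; card = card ; proper = proper ; x = labels ; R = λ i α → R i (σ i α)
      ; paths = λ i i< → record
        { walk = λ α → subst (λ z → Walk _~_ z (t i (σ i α)) (R i (σ i α))) (≡sym (labels≡s i< α)) (P.walk i< (σ i α))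
        ; unique = λ α → P.unique i< (σ i α) ; inside = λ α → P.inside i< (σ i α)
        ; disj = λ a b → σ-injective i< (P.disj i< a b) }
      ; x∈ˡ = λ i i< α → subst (_∈ ∂ (A i)) (≡sym (labels≡s i< α)) (s∈ i i< (σ i α))
      ; x∈ʳ = λ i i< α → t∈ i i< (σ i α) }

  module Theory {q M} (C : Chain q M) where

    open Chain C
    private module P {i} (i< : i < M) = Paths (paths i i<)

    up : ∀ {i j} → i ≤ j → j ≤ M → ∀ {v} → v ∈ A i → v ∈ A j
    up = monotone A strict

    -- Membership in the right-hand side of separation `i`: outside the interior of `A i`.
    Past : ℕ → V G → Set
    Past i v = v ∈ A i → v ∈ ∂ (A i)

    past-down : ∀ {i j} → i ≤ j → j ≤ M → ∀ {v} → Past j v → Past i v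
    past-down {i} {j} i≤ j≤ h v∈ = ∂-antitone (A i) (A j) (up i≤ j≤) v∈ (h (up i≤ j≤ v∈))

    ontoˡ : ∀ {i} → i < M → ∀ {v} → v ∈ ∂ (A i) → ∃ λ α → v ≡ x i α
    ontoˡ {i} i< = injective⇒onto (∂ (A i)) (x i)
      (λ {α} {β} e → P.disj i< (start∈ (P.walk i< α)) (subst (_∈ₗ R i β) (≡sym e) (start∈ (P.walk i< β))))
      (x∈ˡ i i<) (ℕₚ.≤-reflexive (card i (ℕₚ.<⇒≤ i<)))

    ontoʳ : ∀ {i} → i < M → ∀ {v} → v ∈ ∂ (A (suc i)) → ∃ λ α → v ≡ x (suc i) α
    ontoʳ {i} i< = injective⇒onto (∂ (A (suc i))) (x (suc i))
      (λ {α} {β} e → P.disj i< (end∈ (P.walk i< α)) (subst (_∈ₗ R i β) (≡sym e) (end∈ (P.walk i< β))))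
      (x∈ʳ i i<) (ℕₚ.≤-reflexive (card (suc i) i<))

    cutˡ : ∀ {i} → i < M → ∀ {α v} → v ∈ₗ R i α → v ∈ ∂ (A i) → v ≡ x i α
    cutˡ i< v∈ v∈∂ with ontoˡ i< v∈∂
    ... | β , refl = cong (x _) (P.disj i< (start∈ (P.walk i< β)) v∈)

    cutʳ : ∀ {i} → i < M → ∀ {α v} → v ∈ₗ R i α → v ∈ ∂ (A (suc i)) → v ≡ x (suc i) α
    cutʳ i< v∈ v∈∂ with ontoʳ i< v∈∂
    ... | β , refl = cong (x _) (P.disj i< (end∈ (P.walk i< β)) v∈)

    passʳ : ∀ {i} → i < M → ∀ {α v} → v ∈ₗ R i α → Past (suc i) v → v ≡ x (suc i) α
    passʳ i< v∈ h = cutʳ i< v∈ (h (proj₁ (P.inside i< _ v∈)))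

    -- Since the q disjoint paths use up ∂ (A i), the path with label α meets it in x i α only; hence R k α contains
    -- every vertex of the α-th path in the bag U k.
    localʳ : ∀ {i k} → i ≤ k → k < M → ∀ {α v} → v ∈ₗ R i α → Past k v → v ∈ₗ R k α
    localʳ {k = zero} z≤n k< v∈ h = v∈
    localʳ {k = suc k} i≤ k< {α} v∈ h with ℕₚ.m≤n⇒m<n∨m≡n i≤
    ... | inj₂ refl = v∈
    ... | inj₁ i< = subst (_∈ₗ R (suc k) α)
      (≡sym (passʳ (ℕₚ.<⇒≤ k<) (localʳ (ℕₚ.≤-pred i<) (ℕₚ.<⇒≤ k<) v∈ (past-down (ℕₚ.n≤1+n k) (ℕₚ.<⇒≤ k<) h)) h))
      (start∈ (P.walk k< α))

    localˡ : ∀ {i k} → k ≤ i → i < M → ∀ {α v} → v ∈ₗ R i α → v ∈ A (suc k) → v ∈ₗ R k α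
    localˡ {zero} z≤n i< v∈ h = v∈
    localˡ {suc i} k≤ i< {α} v∈ h with ℕₚ.m≤n⇒m<n∨m≡n k≤
    ... | inj₂ refl = v∈
    ... | inj₁ k< = localˡ (ℕₚ.≤-pred k<) (ℕₚ.<⇒≤ i<)
      (subst (_∈ₗ R i α) (≡sym (cutˡ i< v∈ (proj₂ (P.inside i< α v∈) (up k< (ℕₚ.<⇒≤ i<) h)))) (end∈ (P.walk (ℕₚ.<⇒≤ i<) α))) h

    local : ∀ {i k} → i < M → k < M → ∀ {α v} → v ∈ₗ R i α → U k v → v ∈ₗ R k α
    local {i} {k} i< k< v∈ (v∈A , h) with ℕₚ.≤-total i k
    ... | inj₁ i≤k = localʳ i≤k k< v∈ h
    ... | inj₂ k≤i = localˡ k≤i i< v∈ v∈A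

    module _ {i j} (i<j : i < j) (j≤ : j ≤ M) where

      private
        k<M : ∀ {k} → k < j → k < M
        k<M k< = ℕₚ.<-≤-trans k< j≤

      onI : Fin q → V G → Set
      onI α v = ∃ λ k → i ≤ k × k < j × v ∈ₗ R k α

      UI : V G → Set
      UI = Bag (A i) (A j)

      bag-widen : ∀ {k} → i ≤ k → k < j → ∀ {v} → U k v → UI v
      bag-widen i≤ k< (v∈ , h) = up k< j≤ v∈ , past-down i≤ (ℕₚ.<⇒≤ (k<M k<)) h

      onI⇒UI : ∀ {α v} → onI α v → UI v
      onI⇒UI (k , i≤ , k< , v∈) = bag-widen i≤ k< (P.inside (k<M k<) _ v∈)

      -- Take a step at which both ends become members. An end that was a member before has the
      -- other end as a neighbour outside, hence lies on the boundary.
      edge-cover : ∀ {u v} → UI u → UI v → u ~ v → ∃ λ k → i ≤ k × k < j × U k u × U k v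
      edge-cover {u} {v} (u∈ , hu) (v∈ , hv) e with (u Subₚ.∈? A i) ×-dec (v Subₚ.∈? A i)
      ... | yes (u∈i , v∈i) = i , ℕₚ.≤-refl , i<j ,
              (up (ℕₚ.n≤1+n i) (k<M i<j) u∈i , hu) , (up (ℕₚ.n≤1+n i) (k<M i<j) v∈i , hv)
      ... | no ¬both with find-step (λ k → (u Subₚ.∈? A k) ×-dec (v Subₚ.∈? A k)) (ℕₚ.<⇒≤ i<j) ¬both (u∈ , v∈)
      ... | k , i≤ , k< , ¬p , (u∈k , v∈k) = k , i≤ , k< ,
              (u∈k , λ u∈′ → ∂⁺ (A k) u∈′ e (λ v∈′ → ¬p (u∈′ , v∈′))) ,
              (v∈k , λ v∈′ → ∂⁺ (A k) v∈′ (~-sym e) (λ u∈′ → ¬p (u∈′ , v∈′)))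

      vertex-cover : ∀ {u} → UI u → ∃ λ k → i ≤ k × k < j × U k u
      vertex-cover {u} (u∈ , hu) with u Subₚ.∈? A i
      ... | yes u∈i = i , ℕₚ.≤-refl , i<j , up (ℕₚ.n≤1+n i) (k<M i<j) u∈i , hu
      ... | no u∉i with find-step (λ k → u Subₚ.∈? A k) (ℕₚ.<⇒≤ i<j) u∉i u∈
      ... | k , i≤ , k< , u∉k , u∈k = k , i≤ , k< , u∈k , ⊥-elim ∘ u∉k

      OutI : V G → Set
      OutI = Out UI onI

      out-widen : ∀ {k} → i ≤ k → k < j → ∀ {v} → Out (U k) (on k) v → OutI v
      out-widen i≤ k< (u , ¬on) = bag-widen i≤ k< u , λ (γ , k′ , _ , k′< , v∈) → ¬on (γ , local (k<M k′<) (k<M k<) v∈ u)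

      out-narrow : ∀ {k} → i ≤ k → k < j → ∀ {v} → OutI v → U k v → Out (U k) (on k) v
      out-narrow i≤ k< (_ , ¬on) u = u , λ (γ , v∈) → ¬on (γ , _ , i≤ , k< , v∈)

      private
        distinct-bags : ∀ {k k′} → i ≤ k → k < k′ → k′ < j → ∀ {v} → OutI v → U k v → U k′ v → ⊥
        distinct-bags i≤ k<k′ k′< (_ , ¬on) (v∈ , _) (_ , h′) with ontoˡ (k<M k′<) (h′ (up k<k′ (ℕₚ.<⇒≤ (k<M k′<)) v∈))
        ... | α , refl = ¬on (α , _ , ℕₚ.≤-trans i≤ (ℕₚ.<⇒≤ k<k′) , k′< , start∈ (P.walk (k<M k′<) α))

      -- A vertex in two bags lies in an adhesion set and therefore on a path. So a vertex off the
      -- paths has a unique bag, which contains all its edges and, step by step, its entire bridge.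
      same-bag : ∀ {k} → i ≤ k → k < j → ∀ {c d} → OutI c → U k c → c ~ d → UI d → U k d
      same-bag {k} i≤ k< outc uc e ud with edge-cover (proj₁ outc) ud e
      ... | k′ , i≤′ , k<′ , uc′ , ud′ with ℕₚ.<-cmp k k′
      ... | Relation.Binary.Definitions.tri≈ _ refl _ = ud′
      ... | Relation.Binary.Definitions.tri< lt _ _ = ⊥-elim (distinct-bags i≤ lt k<′ outc uc uc′)
      ... | Relation.Binary.Definitions.tri> _ _ gt = ⊥-elim (distinct-bags i≤′ gt k< outc uc′ uc)

      reach-narrow : ∀ {k} → i ≤ k → k < j → ∀ {c d} → Reach G OutI c d → U k c → Reach G (Out (U k) (on k)) c d
      reach-narrow i≤ k< (here p) u = here (out-narrow i≤ k< p u)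
      reach-narrow i≤ k< (step p e r) u =
        step (out-narrow i≤ k< p u) e (reach-narrow i≤ k< r (same-bag i≤ k< p u e (proj₁ (reach-start r))))

      on-narrow : ∀ {k} → k < j → ∀ {α v} → onI α v → U k v → v ∈ₗ R k α
      on-narrow k< (k′ , _ , k′< , v∈) u = local (k<M k′<) (k<M k<) v∈ u

      joined-widen : ∀ {k} → i ≤ k → k < j → ∀ {α β} → E k α β → Joined UI onI α β
      joined-widen i≤ k< (u , v , u∈ , v∈ , inj₁ e) = u , v , (_ , i≤ , k< , u∈) , (_ , i≤ , k< , v∈) , inj₁ e
      joined-widen i≤ k< (u , v , u∈ , v∈ , inj₂ (c , c′ , e , e′ , r)) = u , v , (_ , i≤ , k< , u∈) , (_ , i≤ , k< , v∈) ,
        inj₂ (c , c′ , e , e′ , reach-map (out-widen i≤ k<) r)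

      joined-narrow : ∀ {α β} → Joined UI onI α β → ∃ λ k → i ≤ k × k < j × E k α β
      joined-narrow (u , v , u∈ , v∈ , inj₁ (≢ , e)) with edge-cover (onI⇒UI u∈) (onI⇒UI v∈) e
      ... | k , i≤ , k< , uu , uv = k , i≤ , k< , u , v , on-narrow k< u∈ uu , on-narrow k< v∈ uv , inj₁ (≢ , e)
      joined-narrow (u , v , u∈ , v∈ , inj₂ (c , c′ , e , e′ , r)) with vertex-cover (proj₁ (reach-start r))
      ... | k , i≤ , k< , uc = k , i≤ , k< , u , v ,
        on-narrow k< u∈ (same-bag i≤ k< (reach-start r) uc (~-sym e) (onI⇒UI u∈)) ,
        on-narrow k< v∈ (same-bag i≤ k< (reach-end r) (proj₁ (reach-end r′)) (~-sym e′) (onI⇒UI v∈)) ,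
        inj₂ (c , c′ , e , e′ , r′)
        where r′ = reach-narrow i≤ k< r uc

      att-widen : ∀ {k} → i ≤ k → k < j → ∀ {c α} → Att (U k) (on k) c α → Att UI onI c α
      att-widen i≤ k< (out , c′ , u , r , u∈ , e) =
        out-widen i≤ k< out , c′ , u , reach-map (out-widen i≤ k<) r , (_ , i≤ , k< , u∈) , e

      att-narrow : ∀ {c α} → Att UI onI c α → ∃ λ k → i ≤ k × k < j × Att (U k) (on k) c α
      att-narrow (out , c′ , u , r , u∈ , e) with vertex-cover (proj₁ out)
      ... | k , i≤ , k< , uc = k , i≤ , k< , out-narrow i≤ k< out uc , c′ , u , r′ ,
        on-narrow k< u∈ (same-bag i≤ k< (reach-end r) (proj₁ (reach-end r′)) e (onI⇒UI u∈)) , e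
        where r′ = reach-narrow i≤ k< r uc

      -- If the α-vertices at both ends of the merged bag coincide, this vertex lies in every
      -- boundary in between and, by locality, is the α-vertex there.
      nt-widen : ∀ {k} → i ≤ k → k < j → ∀ {α} → NT k α → x i α ≢ x j α
      nt-widen {k} i≤ k< {α} nt eq = nt (trans (≡sym v≡k) v≡k+)
        where
        j-pred : ∃ λ j′ → j ≡ suc j′
        j-pred = case i<j of λ { (s≤s _) → _ , refl }
        v∈∂j : x i α ∈ ∂ (A j)
        v∈∂j = subst (_∈ ∂ (A j)) (≡sym eq)
          (subst (λ z → x z α ∈ ∂ (A z)) (≡sym (proj₂ j-pred)) (x∈ʳ _ (subst (_≤ M) (proj₂ j-pred) j≤) α))
        past : ∀ {k} → k ≤ j → Past k (x i α)
        past k≤ = past-down k≤ j≤ (λ _ → v∈∂j)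
        v∈Ai = ∂⊆ (A i) (x∈ˡ i (k<M i<j) α)
        v∈k = localʳ i≤ (k<M k<) (start∈ (P.walk (k<M i<j) α)) (past (ℕₚ.<⇒≤ k<))
        v≡k = cutˡ (k<M k<) v∈k (past (ℕₚ.<⇒≤ k<) (up i≤ (ℕₚ.<⇒≤ (k<M k<)) v∈Ai))
        v≡k+ = cutʳ (k<M k<) v∈k (past k< (up (ℕₚ.m≤n⇒m≤1+n i≤) (k<M k<) v∈Ai))

    nt-narrow : ∀ {i j} → i ≤ j → ∀ {α} → x i α ≢ x j α → ∃ λ k → i ≤ k × k < j × NT k α
    nt-narrow {i} {j} i≤ {α} ≢ with find-step (λ k → ¬? (x i α ≟ x k α)) i≤ (λ h → h refl) ≢
    ... | k , i≤k , k< , ¬¬eq , ≢+ = k , i≤k , k< , λ eq → ¬¬eq (λ e → ≢+ (trans e eq))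

    -- Covers the `suc d` bags from `i` to `d + i`; counting from zero rules out an empty range.
    catR : ℕ → ℕ → Fin q → List (V G)
    catR i zero α = R i α
    catR i (suc d) α = R i α ⊙ catR (suc i) d α

    catR-walk : ∀ i d → d + i < M → ∀ α → Walk _~_ (x i α) (x (suc (d + i)) α) (catR i d α)
    catR-walk i zero d< α = P.walk d< α
    catR-walk i (suc d) d< α = walk-glue (P.walk (ℕₚ.≤-<-trans (ℕₚ.m≤n+m i (suc d)) d<) α)
      (subst (λ z → Walk _~_ (x (suc i) α) (x (suc z) α) (catR (suc i) d α)) (ℕₚ.+-suc d i)
        (catR-walk (suc i) d (subst (_< M) (≡sym (ℕₚ.+-suc d i)) d<) α))

    catR-∈⁻ : ∀ i d {α v} → v ∈ₗ catR i d α → ∃ λ k → i ≤ k × k < suc (d + i) × v ∈ₗ R k α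
    catR-∈⁻ i zero v∈ = i , ℕₚ.≤-refl , ℕₚ.≤-refl , v∈
    catR-∈⁻ i (suc d) {α} v∈ with ∈-⊙⁻ (R i α) v∈
    ... | inj₁ v∈i = i , ℕₚ.≤-refl , s≤s (ℕₚ.m≤n+m i (suc d)) , v∈i
    ... | inj₂ v∈d with catR-∈⁻ (suc i) d v∈d
    ... | k , i≤ , k< , v∈k = k , ℕₚ.<⇒≤ i≤ , subst (λ z → k < suc z) (ℕₚ.+-suc d i) k< , v∈k

    catR-∈⁺ : ∀ i d → d + i < M → ∀ {k α v} → i ≤ k → k < suc (d + i) → v ∈ₗ R k α → v ∈ₗ catR i d α
    catR-∈⁺ i zero d< i≤ (s≤s k≤) v∈ with ℕₚ.≤-antisym i≤ k≤
    ... | refl = v∈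
    catR-∈⁺ i (suc d) d< {k} {α} i≤ k< v∈ with ℕₚ.m≤n⇒m<n∨m≡n i≤
    ... | inj₂ refl = Memₚ.∈-++⁺ˡ v∈
    ... | inj₁ i< = ∈-⊙⁺ʳ (P.walk (ℕₚ.≤-<-trans (ℕₚ.m≤n+m i (suc d)) d<) α) (catR-walk (suc i) d d<′ α)
      (catR-∈⁺ (suc i) d d<′ i< (subst (λ z → k < suc z) (≡sym (ℕₚ.+-suc d i)) k<) v∈)
      where d<′ = subst (_< M) (≡sym (ℕₚ.+-suc d i)) d<

    catR-unique : ∀ i d → d + i < M → ∀ α → Unique (catR i d α)
    catR-unique i zero d< α = P.unique d< α
    catR-unique i (suc d) d< α = glue (catR-walk (suc i) d d<′ α) (catR-unique (suc i) d d<′ α) meet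
      where
      d<′ = subst (_< M) (≡sym (ℕₚ.+-suc d i)) d<
      i<M = ℕₚ.≤-<-trans (ℕₚ.m≤n+m i (suc d)) d<
      meet : ∀ {v} → v ∈ₗ R i α → v ∈ₗ catR (suc i) d α → v ≡ x (suc i) α
      meet v∈ v∈′ with catR-∈⁻ (suc i) d v∈′
      ... | k , i≤ , k< , v∈k = passʳ i<M v∈ (past-down i≤ (ℕₚ.<⇒≤ k<M) (proj₂ (P.inside k<M α v∈k)))
        where k<M = ℕₚ.<-≤-trans k< d<′
      glue : ∀ {y z L} → Walk _~_ y z L → Unique L → (∀ {v} → v ∈ₗ R i α → v ∈ₗ L → v ≡ y) → Unique (R i α ⊙ L)
      glue nil u m = subst Unique (≡sym (Listₚ.++-identityʳ _)) (P.unique i<M α)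
      glue (cons e w) (y∉ ∷ u) m = Uniqueₚ.++⁺ (P.unique i<M α) u
        λ (v∈ , v∈L) → All.lookup y∉ v∈L (≡sym (m v∈ (there v∈L)))

    catR-infix : ∀ i d → d + i < M → ∀ {k} → i ≤ k → k < suc (d + i) → ∀ α → Infix (R k α) (catR i d α)
    catR-infix i zero d< i≤ (s≤s k≤) α with ℕₚ.≤-antisym i≤ k≤
    ... | refl = [] , [] , ≡sym (Listₚ.++-identityʳ _)
    catR-infix i (suc d) d< {k} i≤ k< α with ℕₚ.m≤n⇒m<n∨m≡n i≤
    ... | inj₂ refl = [] , drop 1 (catR (suc i) d α) , refl
    ... | inj₁ i< with walk-glue-suffix (P.walk (ℕₚ.≤-<-trans (ℕₚ.m≤n+m i (suc d)) d<) α) (catR-walk (suc i) d d<′ α)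
      where d<′ = subst (_< M) (≡sym (ℕₚ.+-suc d i)) d<
    ... | init , eq = subst (Infix (R k α)) (≡sym eq) (infix-++ˡ init
      (catR-infix (suc i) d (subst (_< M) (≡sym (ℕₚ.+-suc d i)) d<) i< (subst (λ z → k < suc z) (≡sym (ℕₚ.+-suc d i)) k<) α))

    module Merge {M′} (S : Selection M M′) where

      open Selection S

      private
        d : ℕ → ℕ
        d i = f (suc i) ∸ suc (f i)

        d≡ : ∀ {i} → i < M′ → suc (d i + f i) ≡ f (suc i)
        d≡ {i} i< = trans (≡sym (ℕₚ.+-suc (d i) (f i))) (ℕₚ.m∸n+n≡m (inc i i<))

        d< : ∀ {i} → i < M′ → d i + f i < M
        d< i< = ℕₚ.≤-trans (ℕₚ.≤-reflexive (d≡ i<)) (f≤ i<)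

        R′ : ℕ → Fin q → List (V G)
        R′ i = catR (f i) (d i)

      merged-∈⁻ : ∀ {i} → (i< : i < M′) → ∀ {α v} → v ∈ₗ R′ i α → onI (inc i i<) (f≤ i<) α v
      merged-∈⁻ {i} i< v∈ with catR-∈⁻ (f i) (d i) v∈
      ... | k , f≤k , k< , v∈k = k , f≤k , subst (k <_) (d≡ i<) k< , v∈k

      merged-∈⁺ : ∀ {i} → (i< : i < M′) → ∀ {α v} → onI (inc i i<) (f≤ i<) α v → v ∈ₗ R′ i α
      merged-∈⁺ {i} i< (k , f≤k , k< , v∈) = catR-∈⁺ (f i) (d i) (d< i<) f≤k (subst (k <_) (≡sym (d≡ i<)) k<) v∈

      merged-infix : ∀ {i} → i < M′ → ∀ {k} → Within i k → ∀ α → Infix (R k α) (R′ i α)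
      merged-infix {i} i< {k} (f≤k , k<) = catR-infix (f i) (d i) (d< i<) f≤k (subst (k <_) (≡sym (d≡ i<)) k<)

      merged : Chain q M′
      merged = record
        { A = A ∘ f
        ; strict = λ i i< → let sub , z , z∈ , z∉ = strict (f i) (ℕₚ.<-≤-trans (inc i i<) (f≤ i<)) in
            up (ℕₚ.<⇒≤ (inc i i<)) (f≤ i<) , z , up (inc i i<) (f≤ i<) z∈ , z∉
        ; card = λ i i≤ → card (f i) (f≤ i≤) ; proper = λ i i≤ → proper (f i) (f≤ i≤)
        ; x = x ∘ f ; R = R′
        ; paths = λ i i< → record
          { walk = λ α → subst (λ z → Walk _~_ (x (f i) α) (x z α) (R′ i α)) (d≡ i<) (catR-walk (f i) (d i) (d< i<) α)
          ; unique = λ α → catR-unique (f i) (d i) (d< i<) α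
          ; inside = λ α v∈ → onI⇒UI (inc i i<) (f≤ i<) (merged-∈⁻ i< v∈)
          ; disj = λ v∈ v∈′ → disj i< (merged-∈⁻ i< v∈) (merged-∈⁻ i< v∈′) }
        ; x∈ˡ = λ i i< → x∈ˡ (f i) (ℕₚ.<-≤-trans (inc i i<) (f≤ i<))
        ; x∈ʳ = λ i i< α → subst (λ z → x z α ∈ ∂ (A z)) (d≡ i<) (x∈ʳ (d i + f i) (d< i<) α) }
        where
        disj : ∀ {i} (i< : i < M′) {α β v} → onI (inc i i<) (f≤ i<) α v → onI (inc i i<) (f≤ i<) β v → α ≡ β
        disj i< (k , _ , k< , v∈) (k′ , _ , k′< , v∈′) =
          P.disj k′<M (local k<M k′<M v∈ (P.inside k′<M _ v∈′)) v∈′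
          where k<M = ℕₚ.<-≤-trans k< (f≤ i<)
                k′<M = ℕₚ.<-≤-trans k′< (f≤ i<)

      private module C′ = Chain merged

      module _ {i} (i< : i < M′) where

        merged-e⁺ : ∀ {k α β} → Within i k → E k α β → C′.E i α β
        merged-e⁺ (f≤k , k<) e = joined-cong id (merged-∈⁺ i<) (merged-∈⁻ i<) (joined-widen (inc i i<) (f≤ i<) f≤k k< e)

        merged-e⁻ : ∀ {α β} → C′.E i α β → ∃ λ k → Within i k × E k α β
        merged-e⁻ e with joined-narrow (inc i i<) (f≤ i<) (joined-cong id (merged-∈⁻ i<) (merged-∈⁺ i<) e)
        ... | k , f≤k , k< , e′ = k , (f≤k , k<) , e′

        merged-att⁺ : ∀ {k c α} → Within i k → Att (U k) (on k) c α → Att (C′.U i) (C′.on i) c α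
        merged-att⁺ (f≤k , k<) a = att-cong id (merged-∈⁺ i<) (merged-∈⁻ i<) (att-widen (inc i i<) (f≤ i<) f≤k k< a)

        merged-att⁻ : ∀ {c α} → Att (C′.U i) (C′.on i) c α → ∃ λ k → Within i k × Att (U k) (on k) c α
        merged-att⁻ a with att-narrow (inc i i<) (f≤ i<) (att-cong id (merged-∈⁻ i<) (merged-∈⁺ i<) a)
        ... | k , f≤k , k< , a′ = k , (f≤k , k<) , a′

        merged-nt⁺ : ∀ {k α} → Within i k → NT k α → C′.NT i α
        merged-nt⁺ (f≤k , k<) nt = nt-widen (inc i i<) (f≤ i<) f≤k k< nt

        merged-nt⁻ : ∀ {α} → C′.NT i α → ∃ λ k → Within i k × NT k α
        merged-nt⁻ nt with nt-narrow (ℕₚ.<⇒≤ (inc i i<)) nt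
        ... | k , f≤k , k< , nt′ = k , (f≤k , k<) , nt′

  window : ∀ {q M} (C : Chain q M) b {M′} → M′ + b ≤ M → Chain q M′
  window C b {M′} le = record
    { A = λ i → A (i + b) ; strict = λ i i< → strict (i + b) (lt i<) ; card = λ i i≤ → card (i + b) (leq i≤)
    ; proper = λ i i≤ → proper (i + b) (leq i≤) ; x = λ i → x (i + b) ; R = λ i → R (i + b)
    ; paths = λ i i< → paths (i + b) (lt i<) ; x∈ˡ = λ i i< → x∈ˡ (i + b) (lt i<) ; x∈ʳ = λ i i< → x∈ʳ (i + b) (lt i<) }
    where
    open Chain C
    leq : ∀ {i} → i ≤ M′ → i + b ≤ _
    leq i≤ = ℕₚ.≤-trans (ℕₚ.+-monoˡ-≤ b i≤) le
    lt : ∀ {i} → i < M′ → i + b < _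
    lt i< = leq i<

-- Rerouting a linkage to a p-attached one

++-distinct : {A : Set} (xs : List A) {ys : List A} → Unique (xs ++ ys) → ∀ {x y} → x ∈ₗ xs → y ∈ₗ ys → x ≢ y
++-distinct (_ ∷ xs) (x∉ ∷ u) (here refl) y∈ = All.lookup x∉ (Memₚ.∈-++⁺ʳ xs y∈)
++-distinct (_ ∷ xs) (_ ∷ u) (there x∈) y∈ = ++-distinct xs u x∈ y∈

walk-tail : ∀ {A : Set} {E : A → A → Set} {x y post v} → Walk E x y (x ∷ post) → v ∈ₗ post →
            ∃ λ L → Walk E v y L × (∀ {z} → z ∈ₗ L → z ∈ₗ post)
walk-tail {post = _ ∷ _} (cons _ w) v∈ = walk-suffix w v∈

module _ {A : Set} (N : A → Set) where

  ordered-pair : ∀ L {x y} → x ∈ₗ L → y ∈ₗ L → N x → N y → x ≢ y →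
                 ∃₂ λ pre b → ∃ λ post → L ≡ pre ++ b ∷ post × N b × ∃ λ c → c ∈ₗ post × N c
  ordered-pair (_ ∷ L) (here refl) (here refl) nx ny x≢y = ⊥-elim (x≢y refl)
  ordered-pair (h ∷ L) (here refl) (there y∈) nx ny _ = [] , h , L , refl , nx , _ , y∈ , ny
  ordered-pair (h ∷ L) (there x∈) (here refl) nx ny _ = [] , h , L , refl , ny , _ , x∈ , nx
  ordered-pair (h ∷ L) (there x∈) (there y∈) nx ny x≢y with ordered-pair L x∈ y∈ nx ny x≢y
  ... | pre , b , post , refl , r = h ∷ pre , b , post , refl , r

  Middle : List A → Set
  Middle L = ∃₂ λ pre b → ∃ λ post → L ≡ pre ++ b ∷ post × N b ×
             (∃ λ a → a ∈ₗ pre × N a) × (∃ λ c → c ∈ₗ post × N c)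

  private
    extend : ∀ {L h y z} → N h → y ∈ₗ L → z ∈ₗ L → N y → N z → y ≢ z → Middle (h ∷ L)
    extend {L} {h} nh y∈ z∈ ny nz y≢z with ordered-pair L y∈ z∈ ny nz y≢z
    ... | pre , b , post , refl , nb , c = h ∷ pre , b , post , refl , nb , (h , here refl , nh) , c

  middle : ∀ L {x y z} → x ∈ₗ L → y ∈ₗ L → z ∈ₗ L → N x → N y → N z → x ≢ y → x ≢ z → y ≢ z → Middle L
  middle (h ∷ L) (here refl) (here refl) _ _ _ _ x≢y _ _ = ⊥-elim (x≢y refl)
  middle (h ∷ L) (here refl) (there _) (here refl) _ _ _ _ x≢z _ = ⊥-elim (x≢z refl)
  middle (h ∷ L) (here refl) (there y∈) (there z∈) nx ny nz _ _ y≢z = extend nx y∈ z∈ ny nz y≢z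
  middle (h ∷ L) (there x∈) (here refl) (here refl) _ _ _ _ _ y≢z = ⊥-elim (y≢z refl)
  middle (h ∷ L) (there x∈) (here refl) (there z∈) nx ny nz _ x≢z _ = extend ny x∈ z∈ nx nz x≢z
  middle (h ∷ L) (there x∈) (there y∈) (here refl) nx ny nz x≢y _ _ = extend nz x∈ y∈ nx ny x≢y
  middle (h ∷ L) (there x∈) (there y∈) (there z∈) nx ny nz x≢y x≢z y≢z with middle L x∈ y∈ z∈ nx ny nz x≢y x≢z y≢z
  ... | pre , b , post , refl , nb , (a , a∈ , na) , c = h ∷ pre , b , post , refl , nb , (a , there a∈ , na) , c

image-≤ : ∀ {m k} (T : Subset k) (g : Fin k → Fin m) (X : Subset m) →
          (∀ {v} → v ∈ X → ∃ λ γ → γ ∈ T × v ≡ g γ) → ∣ X ∣ ≤ ∣ T ∣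
image-≤ T g X h with enumerate ∣ X ∣ X ℕₚ.≤-refl
... | f , inj , f∈ = injective⇒≤∣∣ T (λ i → proj₁ (h (f∈ i)))
  (λ {i} {j} e → inj (trans (proj₂ (proj₂ (h (f∈ i)))) (trans (cong g e) (≡sym (proj₂ (proj₂ (h (f∈ j))))))))
  (λ i → proj₁ (proj₂ (h (f∈ i))))

three-remain : ∀ {t p x a b} → t < p ∸ 2 → p ≤ x → x ≤ a + b → a ≤ t → 3 ≤ b
three-remain {t} {p} {x} {a} {b} small p≤x x≤ a≤t = ℕₚ.+-cancelˡ-≤ t 3 b (begin
  t + 3        ≡⟨ ℕₚ.+-suc t 2 ⟩
  suc t + 2    ≤⟨ ℕₚ.+-monoˡ-≤ 2 small ⟩
  -- Here `small` excludes `p ≤ 2`, where the subtraction would be truncated.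
  (p ∸ 2) + 2  ≡⟨ ℕₚ.m∸n+n≡m (ℕₚ.<⇒≤ (ℕₚ.m∸n≢0⇒n<m {p} {2} λ e → ℕₚ.n≮0 (subst (t <_) e small))) ⟩
  p            ≤⟨ p≤x ⟩
  x            ≤⟨ x≤ ⟩
  a + b        ≤⟨ ℕₚ.+-monoˡ-≤ b a≤t ⟩
  t + b        ∎)
  where open ℕₚ.≤-Reasoning

module Reroute (G : Graph) (p : ℕ) (conn : Connected G p) where

  open GraphBasics G
  open Connections G

  record PAttached (U : V G → Set) {q : ℕ} (s t : Fin q → V G) (R : Fin q → List (V G)) : Set where
    field
      induced  : ∀ α u v → u ∈ₗ R α → v ∈ₗ R α → u ~ v → PathEdge (R α) u v
      attached : ∀ α c → s α ≢ t α → Att U (λ α → _∈ₗ R α) c α →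
        (∃ λ β → β ≢ α × s β ≢ t β × Att U (λ α → _∈ₗ R α) c β) ⊎
        (∃ λ (f : Fin (p ∸ 2) → Fin q) → Injective _≡_ _≡_ f ×
           (∀ k → s (f k) ≡ t (f k) × Joined U (λ α → _∈ₗ R α) α (f k)))

  -- The outside vertex `o` and `boundary` let p-connectedness act inside the bag: a connected part
  -- of `U` away from the ends `s` and `t` has all its neighbours in `U`, and at least p of them,
  -- since they separate it from `o`.
  module _ {U : V G → Set} (U? : Decidable U) (o : V G) (o∉ : ¬ U o) {q : ℕ} (s t : Fin q → V G)
           (boundary : ∀ {v m} → U v → v ~ m → ¬ U m → ∃ λ α → v ≡ s α ⊎ v ≡ t α) where

    NT : Fin q → Set
    NT α = s α ≢ t α

    nt? : ∀ α → Dec (NT α)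
    nt? α = ¬? (s α ≟ t α)

    module State (R : Fin q → List (V G)) where

      on : Fin q → V G → Set
      on α v = v ∈ₗ R α

      on? : ∀ α → Decidable (on α)
      on? α v = v ∈L? R α

      O : V G → Set
      O = Out U on

      T : V G → Fin q → Set
      T = Att U on

      t? : ∀ c α → Dec (T c α)
      t? = att? U on U? on?

      J : Fin q → Fin q → Set
      J = Joined U on

      Rich : V G → Set
      Rich v = ∃₂ λ β γ → β ≢ γ × NT β × NT γ × T v β × T v γ

      rich? : Decidable Rich
      rich? v = Finₚ.any? λ β → Finₚ.any? λ γ → ¬? (β ≟ γ) ×-dec nt? β ×-dec nt? γ ×-dec t? v β ×-dec t? v γ

      Poor : Fin q → V G → Set
      Poor α v = T v α × (∀ β → β ≢ α → NT β → ¬ T v β)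

      poor? : ∀ α → Decidable (Poor α)
      poor? α v = t? v α ×-dec Finₚ.all? (λ β → ¬? (β ≟ α) →-dec (nt? β →-dec ¬? (t? v β)))

      poor-reach : ∀ {α v w} → Poor α v → Reach G O v w → Poor α w
      poor-reach (a , h) r = att-reach U on (reach-sym r) a , λ β ne nt a′ → h β ne nt (att-reach U on r a′)

      rich⇒¬poor : ∀ {α v} → Rich v → ¬ Poor α v
      rich⇒¬poor {α} (β , γ , β≢γ , ntβ , ntγ , aβ , aγ) (_ , h) with β ≟ α
      ... | yes refl = h γ (β≢γ ∘ ≡sym) ntγ aγ
      ... | no β≢α   = h β β≢α ntβ aβ

      Z : Fin q → V G → Set
      Z α v = on α v ⊎ Poor α v

      nonrich onSet : Subset (n G)
      nonrich = toSub (λ v → ¬? (rich? v))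
      onSet = toSub (λ v → Finₚ.any? λ γ → on? γ v)

    -- Pairs of trivial labels are left out because a detour may run through a bridge that joins two
    -- trivial paths.
    Kept : (R R′ : Fin q → List (V G)) → Set
    Kept R R′ = ∀ {β γ} → β ≢ γ → NT β ⊎ NT γ → State.J R β γ → State.J R′ β γ

    Better : (R R′ : Fin q → List (V G)) → Set
    Better R R′ = ∣ nonrich R′ ∣ < ∣ nonrich R ∣ ⊎ (∣ nonrich R′ ∣ ≤ ∣ nonrich R ∣ × ∣ onSet R′ ∣ < ∣ onSet R ∣)
      where open State

    Improved : (R : Fin q → List (V G)) → Set
    Improved R = ∃ λ R′ → Paths U s t R′ × Kept R R′ × Better R R′

    -- The path R α is replaced by a path L′ inside the connected set Z α formed by R α and the components
    -- attached to no other non-trivial path; whatever L′ leaves behind in Z α stays attached to L′.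
    module Detour (R : Fin q → List (V G)) (P : Paths U s t R) (α : Fin q) (L′ : List (V G))
                  (walk′ : Walk _~_ (s α) (t α) L′) (unique′ : Unique L′)
                  (L′⊆Z : ∀ {v} → v ∈ₗ L′ → State.Z R α v) where

      open State R
      private module P = Paths P

      private
        override : ∀ β → Dec (β ≡ α) → List (V G)
        override β (yes _) = L′
        override β (no _)  = R β

      Z-on : ∀ {β v} → Z α v → v ∈ₗ R β → β ≡ α
      Z-on (inj₁ v∈α) v∈ = P.disj v∈ v∈α
      Z-on (inj₂ (((_ , ¬on) , _) , _)) v∈ = ⊥-elim (¬on (_ , v∈))

      Z⊆U : ∀ {v} → Z α v → U v
      Z⊆U (inj₁ v∈) = P.inside α v∈
      Z⊆U (inj₂ (((u , _) , _) , _)) = u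

      abstract

        R′ : Fin q → List (V G)
        R′ β = override β (β ≟ α)

        on′⁻ : ∀ {β v} → v ∈ₗ R′ β → (β ≡ α × v ∈ₗ L′) ⊎ (β ≢ α × v ∈ₗ R β)
        on′⁻ {β} v∈ with β ≟ α
        ... | yes β≡α = inj₁ (β≡α , v∈)
        ... | no β≢α  = inj₂ (β≢α , v∈)

        on′α : ∀ {v} → v ∈ₗ L′ → v ∈ₗ R′ α
        on′α v∈ with α ≟ α
        ... | yes _ = v∈
        ... | no ne  = ⊥-elim (ne refl)

        on′≢ : ∀ {β v} → β ≢ α → v ∈ₗ R β → v ∈ₗ R′ β
        on′≢ {β} β≢α v∈ with β ≟ α
        ... | yes β≡α = ⊥-elim (β≢α β≡α)
        ... | no _    = v∈

        P′ : Paths U s t R′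
        P′ = record { walk = walk ; unique = unique ; inside = inside′ ; disj = disj }
          where
          walk : ∀ β → Walk _~_ (s β) (t β) (R′ β)
          walk β with β ≟ α
          ... | yes refl = walk′
          ... | no _     = P.walk β
          unique : ∀ β → Unique (R′ β)
          unique β with β ≟ α
          ... | yes refl = unique′
          ... | no _     = P.unique β
          inside′ : ∀ β {v} → v ∈ₗ R′ β → U v
          inside′ β v∈ with on′⁻ v∈
          ... | inj₁ (_ , v∈L) = Z⊆U (L′⊆Z v∈L)
          ... | inj₂ (_ , v∈R) = P.inside β v∈R
          disj : ∀ {β γ v} → v ∈ₗ R′ β → v ∈ₗ R′ γ → β ≡ γ
          disj a b with on′⁻ a | on′⁻ b
          ... | inj₁ (e , _) | inj₁ (e′ , _) = trans e (≡sym e′)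
          ... | inj₁ (e , v∈) | inj₂ (ne , v∈′) = ⊥-elim (ne (Z-on (L′⊆Z v∈) v∈′))
          ... | inj₂ (ne , v∈′) | inj₁ (e , v∈) = ⊥-elim (ne (Z-on (L′⊆Z v∈) v∈′))
          ... | inj₂ (_ , v∈) | inj₂ (_ , v∈′) = P.disj v∈ v∈′

      private module S′ = State R′

      out-keep : ∀ {v} → O v → ¬ Poor α v → S′.O v
      out-keep (u , ¬on) ¬poor = u , λ (γ , v∈) → case on′⁻ v∈ of λ
        { (inj₂ (_ , v∈R)) → ¬on (γ , v∈R)
        ; (inj₁ (_ , v∈L)) → case L′⊆Z v∈L of λ { (inj₁ v∈R) → ¬on (α , v∈R) ; (inj₂ poor) → ¬poor poor } }

      off : ∀ {z} → Z α z → ¬ z ∈ₗ L′ → S′.O z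
      off z∈ z∉ = Z⊆U z∈ , λ (γ , z∈′) → case on′⁻ z∈′ of λ
        { (inj₁ (_ , z∈L)) → z∉ z∈L ; (inj₂ (ne , z∈R)) → ne (Z-on z∈ z∈R) }

      Z-reach : ∀ {z} → Z α z → Reach G (Z α) z (s α)
      Z-reach (inj₁ z∈) = reach-sym (path-reach z∈)
        where
        path-reach : ∀ {z} → z ∈ₗ R α → Reach G (Z α) (s α) z
        path-reach z∈ with Memₚ.∈-∃++ z∈
        ... | pre , post , eq = walk⇒reach (proj₁ (walk-split pre (subst (Walk _ _ _) eq (P.walk α))))
                (λ {v} v∈ → inj₁ (subst (v ∈ₗ_) (≡sym eq) (prefix v∈)))
          where
          prefix : ∀ {v z post} → v ∈ₗ pre ++ [ z ] → v ∈ₗ pre ++ z ∷ post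
          prefix v∈ with Memₚ.∈-++⁻ pre v∈
          ... | inj₁ v∈p = Memₚ.∈-++⁺ˡ v∈p
          ... | inj₂ (here refl) = Memₚ.∈-++⁺ʳ pre (here refl)
      Z-reach z∈@(inj₂ poor@((_ , c , u , r , u∈ , e) , _)) =
        reach-trans (reach-snoc (reach-map (λ (_ , r′) → inj₂ (poor-reach poor r′)) (reach-self r)) e (inj₁ u∈)) (Z-reach (inj₁ u∈))

      -- On a walk in `Z α` towards `L′`, the vertices before the first one on `L′` lie off all new
      -- paths, hence in one bridge attached to the new path α.
      hits : ∀ {z y} → Reach G (Z α) z y → y ∈ₗ L′ → z ∈ₗ L′ ⊎ S′.T z α
      hits (here _) y∈ = inj₁ y∈
      hits {z} (step z∈ e r) y∈ with z ∈L? L′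
      ... | yes z∈L = inj₁ z∈L
      ... | no z∉L with hits r y∈
      ... | inj₁ w∈L = inj₂ (off z∈ z∉L , z , _ , here (off z∈ z∉L) , on′α w∈L , e)
      ... | inj₂ a   = inj₂ (att-reach U S′.on (step (off z∈ z∉L) e (here (proj₁ a))) a)

      Z-hits : ∀ {z} → Z α z → z ∈ₗ L′ ⊎ S′.T z α
      Z-hits z∈ = hits (Z-reach z∈) (start∈ walk′)

      -- The detour uses only `R α` and poor vertices, so any other component is disjoint from it
      -- and survives, possibly inside a larger one.
      reach-keep : ∀ {v c} → ¬ Poor α v → Reach G O v c → Reach G S′.O v c
      reach-keep ¬poor r = reach-map (λ (out , r′) → out-keep out (λ poor → ¬poor (poor-reach poor (reach-sym r′)))) (reach-self r)

      att-keep : ∀ {c β} → ¬ Poor α c → β ≢ α → T c β → S′.T c β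
      att-keep ¬poor β≢ (out , c′ , u , r , u∈ , e) = out-keep out ¬poor , c′ , u , reach-keep ¬poor r , on′≢ β≢ u∈ , e

      att-keepα : ∀ {c} → T c α → c ∈ₗ L′ ⊎ S′.T c α
      att-keepα {c} a@(out , c′ , u , r , u∈ , e) with poor? α c
      ... | yes poor = Z-hits (inj₂ poor)
      ... | no ¬poor with Z-hits (inj₁ u∈)
      ... | inj₁ u∈L = inj₂ (out-keep out ¬poor , c′ , u , reach-keep ¬poor r , on′α u∈L , e)
      ... | inj₂ a′ = inj₂ (att-reach U S′.on (reach-snoc (reach-keep ¬poor r) e (proj₁ a′)) a′)

      att-rich : ∀ {v β} → Rich v → T v β → S′.T v β
      att-rich {v} {β} rich a with β ≟ α
      ... | no β≢ = att-keep (rich⇒¬poor rich) β≢ a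
      ... | yes refl with att-keepα a
      ... | inj₁ v∈L = ⊥-elim (proj₂ (out-keep (proj₁ a) (rich⇒¬poor rich)) (α , on′α v∈L))
      ... | inj₂ a′ = a′

      rich-keep : ∀ {v} → Rich v → S′.Rich v
      rich-keep rich@(β , γ , β≢γ , ntβ , ntγ , aβ , aγ) = β , γ , β≢γ , ntβ , ntγ , att-rich rich aβ , att-rich rich aγ

      -- Only the neighbour of `v` on the side of α matters: it is on `L′`, which gives a single
      -- edge, or it belongs to a bridge attached to the new path α.
      joined-keepα : ∀ {γ} → γ ≢ α → J α γ → S′.J α γ
      joined-keepα {γ} γ≢ (u , v , u∈ , v∈ , how) = finish (near how)
        where
        near : _ → ∃ λ z → (z ∈ₗ L′ ⊎ S′.T z α) × z ~ v
        near (inj₁ (_ , e)) = u , Z-hits (inj₁ u∈) , e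
        near (inj₂ (c , c′ , e , e′ , r)) = c′ , att-keepα (reach-end r , c , u , reach-sym r , u∈ , ~-sym e) , ~-sym e′
        finish : (∃ λ z → (z ∈ₗ L′ ⊎ S′.T z α) × z ~ v) → S′.J α γ
        finish (z , inj₁ z∈L , e) = z , v , on′α z∈L , on′≢ γ≢ v∈ , inj₁ (γ≢ ∘ ≡sym , e)
        finish (z , inj₂ (_ , c′ , u′ , r , u∈′ , e′) , e) =
          u′ , v , u∈′ , on′≢ γ≢ v∈ , inj₂ (c′ , z , ~-sym e′ , ~-sym e , reach-sym r)

      joined-keep : Kept R R′
      joined-keep {β} {γ} β≢γ nt j with β ≟ α | γ ≟ α
      ... | yes refl | _ = joined-keepα (β≢γ ∘ ≡sym) j
      ... | no β≢ | yes refl = joined-sym U S′.on (joined-keepα β≢ (joined-sym U on j))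
      joined-keep {β} {γ} β≢γ nt (u , v , u∈ , v∈ , inj₁ e) | no β≢ | no γ≢ = u , v , on′≢ β≢ u∈ , on′≢ γ≢ v∈ , inj₁ e
      joined-keep {β} {γ} β≢γ nt (u , v , u∈ , v∈ , inj₂ (c , c′ , e , e′ , r)) | no β≢ | no γ≢ =
        u , v , on′≢ β≢ u∈ , on′≢ γ≢ v∈ , inj₂ (c , c′ , e , e′ , reach-keep (¬poor nt) r)
        where
        ¬poor : NT β ⊎ NT γ → ¬ Poor α c
        ¬poor (inj₁ ntβ) (_ , h) = h β β≢ ntβ (reach-start r , c , u , here (reach-start r) , u∈ , ~-sym e)
        ¬poor (inj₂ ntγ) (_ , h) = h γ γ≢ ntγ (reach-start r , c′ , v , r , v∈ , ~-sym e′)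

      nonrich-⊆ : S′.nonrich ⊆ nonrich
      nonrich-⊆ v∈ = ∈toSub⁺ _ λ rich → ∈toSub⁻ (λ v → ¬? (S′.rich? v)) v∈ (rich-keep rich)

      shorter : (∀ {v} → v ∈ₗ L′ → v ∈ₗ R α) → ∀ {b} → b ∈ₗ R α → ¬ b ∈ₗ L′ → Improved R
      shorter sub {b} b∈ b∉ = R′ , P′ , (λ {_} {_} → joined-keep) , inj₂ (Subₚ.p⊆q⇒∣p∣≤∣q∣ nonrich-⊆ , Subₚ.p⊂q⇒∣p∣<∣q∣ smaller)
        where
        on′? : Decidable (λ v → ∃ λ γ → S′.on γ v)
        on′? v = Finₚ.any? λ γ → S′.on? γ v
        onAny? : Decidable (λ v → ∃ λ γ → on γ v)
        onAny? v = Finₚ.any? λ γ → on? γ v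
        lower : ∀ {v} → (∃ λ γ → S′.on γ v) → ∃ λ γ → on γ v
        lower (γ , v∈) with on′⁻ v∈
        ... | inj₁ (_ , v∈L) = α , sub v∈L
        ... | inj₂ (_ , v∈R) = γ , v∈R
        smaller : S′.onSet Data.Fin.Subset.⊂ onSet
        smaller = (λ {v} v∈ → ∈toSub⁺ onAny? (lower (∈toSub⁻ on′? v∈))) , b , ∈toSub⁺ onAny? (α , b∈) ,
          λ b∈′ → proj₂ (off (inj₁ b∈) b∉) (∈toSub⁻ on′? b∈′)

      richer : ∀ {b} → b ∈ₗ R α → S′.Rich b → Improved R
      richer {b} b∈ rich′ = R′ , P′ , (λ {_} {_} → joined-keep) , inj₁ (Subₚ.p⊂q⇒∣p∣<∣q∣ ((λ {_} → nonrich-⊆) ,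
        -- Rich vertices lie off the paths, so `b`, being on `R α`, was not rich before.
        b , ∈toSub⁺ _ (λ (_ , _ , _ , _ , _ , ((_ , ¬on) , _) , _) → ¬on (α , b∈)) ,
        λ b∈′ → ∈toSub⁻ (λ v → ¬? (S′.rich? v)) b∈′ rich′))

    module Step (R : Fin q → List (V G)) (P : Paths U s t R) where

      open State R
      private module P = Paths P

      -- The subgraph on `R α` without a vertex `b` skipped by the chord still connects the ends, so
      -- a shorter path exists within `R α`.
      chord : ∀ α u v pre mid post → R α ≡ pre ++ u ∷ (mid ++ v ∷ post) → u ~ v → Consec (R α) u v ⊎ Improved R
      chord α u v pre [] post eq e = inj₁ (pre , post , eq)
      chord α u v pre (b ∷ mid) post eq e = inj₂ (improve (reach⇒path detour))
        where
        u′ : Unique (pre ++ u ∷ (b ∷ mid ++ v ∷ post))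
        u′ = subst Unique eq (P.unique α)
        w′ : Walk _~_ (s α) (t α) (pre ++ u ∷ (b ∷ mid ++ v ∷ post))
        w′ = subst (Walk _~_ (s α) (t α)) eq (P.walk α)
        regroup : pre ++ u ∷ (b ∷ mid ++ v ∷ post) ≡ (pre ++ u ∷ b ∷ mid) ++ v ∷ post
        regroup = ≡sym (Listₚ.++-assoc pre (u ∷ b ∷ mid) (v ∷ post))
        regroup₁ : pre ++ u ∷ (b ∷ mid ++ v ∷ post) ≡ (pre ++ [ u ]) ++ (b ∷ mid ++ v ∷ post)
        regroup₁ = ≡sym (Listₚ.++-assoc pre [ u ] _)
        toR : ∀ {z} → z ∈ₗ pre ++ u ∷ (b ∷ mid ++ v ∷ post) → z ∈ₗ R α
        toR {z} = subst (z ∈ₗ_) (≡sym eq)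
        OnWithout : V G → Set
        OnWithout z = z ∈ₗ R α × z ≢ b
        first : Reach G OnWithout (s α) u
        first = walk⇒reach (proj₁ (walk-split pre w′)) λ {z} z∈ →
          toR (subst (z ∈ₗ_) (≡sym regroup₁) (Memₚ.∈-++⁺ˡ z∈)) ,
          ++-distinct (pre ++ [ u ]) (subst Unique regroup₁ u′) z∈ (here refl)
        last : Reach G OnWithout v (t α)
        last = walk⇒reach (proj₂ (walk-split (pre ++ u ∷ b ∷ mid) (subst (Walk _ _ _) regroup w′))) λ {z} z∈ →
          toR (subst (z ∈ₗ_) (≡sym regroup) (Memₚ.∈-++⁺ʳ (pre ++ u ∷ b ∷ mid) z∈)) ,
          λ z≡b → ++-distinct (pre ++ u ∷ b ∷ mid) (subst Unique regroup u′)
                    (Memₚ.∈-++⁺ʳ pre (there (here refl))) z∈ (≡sym z≡b)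
        detour : Reach G OnWithout (s α) (t α)
        detour = reach-trans (reach-snoc first e (reach-start last)) last
        improve : _ → Improved R
        improve (L′ , walk′ , unique′ , h) = Detour.shorter R P α L′ walk′ unique′ (inj₁ ∘ proj₁ ∘ h)
          (proj₁ ∘ h) (toR (Memₚ.∈-++⁺ʳ pre (there (here refl)))) (λ b∈ → proj₂ (h b∈) refl)

      induced⊎ : ∀ α u v → (u ∈ₗ R α → v ∈ₗ R α → u ~ v → PathEdge (R α) u v) ⊎ Improved R
      induced⊎ α u v with u ∈L? R α | v ∈L? R α | u ~? v
      ... | no u∉ | _ | _ = inj₁ λ u∈ → ⊥-elim (u∉ u∈)
      ... | yes _ | no v∉ | _ = inj₁ λ _ v∈ → ⊥-elim (v∉ v∈)
      ... | yes _ | yes _ | no ≁ = inj₁ λ _ _ e → ⊥-elim (≁ e)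
      ... | yes u∈ | yes v∈ | yes e with Memₚ.∈-∃++ u∈
      ... | pre , post , eq with Memₚ.∈-++⁻ pre (subst (v ∈ₗ_) eq v∈)
      ... | inj₂ (here refl) = ⊥-elim (~-irrefl e)
      ... | inj₂ (there v∈post) with Memₚ.∈-∃++ v∈post
      ... | mid , post′ , refl with chord α u v pre mid post′ eq e
      ... | inj₁ c = inj₁ λ _ _ _ → inj₁ c
      ... | inj₂ imp = inj₂ imp
      induced⊎ α u v | yes u∈ | yes v∈ | yes e | pre , post , eq | inj₁ v∈pre with Memₚ.∈-∃++ v∈pre
      ... | pre′ , mid , refl with chord α v u pre′ mid post (trans eq (Listₚ.++-assoc pre′ (v ∷ mid) (u ∷ post))) (~-sym e)
      ... | inj₁ c = inj₁ λ _ _ _ → inj₂ c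
      ... | inj₂ imp = inj₂ imp

      -- The component K of c among the free vertices is separated from o by its neighbours: touching vertices of R α
      -- and at most p - 3 trivial paths. By p-connectedness K is adjacent to three touching vertices; a detour
      -- through K around the middle one makes the latter rich.
      module Stuck (α : Fin q) (ntα : NT α) (c : V G) (poor-c : Poor α c)
                   (Tr : Subset q) (∈Tr : ∀ {γ} → s γ ≡ t γ → J α γ → γ ∈ Tr) (small : ∣ Tr ∣ < p ∸ 2) where

        -- A touching vertex of `R α` other than its ends becomes rich as soon as the path bypasses
        -- it. The ends are included so that free vertices stay away from them.
        Touching : V G → Set
        Touching z = z ≡ s α ⊎ z ≡ t α ⊎ ∃ λ m → z ~ m × ((∃ λ β → β ≢ α × NT β × on β m) ⊎ Rich m)

        touching? : Decidable Touching
        touching? z = (z ≟ s α) ⊎-dec (z ≟ t α) ⊎-dec Finₚ.any? λ m → (z ~? m) ×-dec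
          (Finₚ.any? (λ β → ¬? (β ≟ α) ×-dec nt? β ×-dec on? β m) ⊎-dec rich? m)

        Free : V G → Set
        Free v = Poor α v ⊎ (on α v × ¬ Touching v)

        free? : Decidable Free
        free? v = poor? α v ⊎-dec (on? α v ×-dec ¬? (touching? v))

        K : V G → Set
        K = Reach G Free c

        k? : Decidable K
        k? = reach? free? c

        NK : V G → Set
        NK m = ¬ K m × ∃ λ k → K k × k ~ m

        nk? : Decidable NK
        nk? m = ¬? (k? m) ×-dec Finₚ.any? (λ k → k? k ×-dec (k ~? m))

        X = toSub nk?

        free⊆U : ∀ {v} → Free v → U v
        free⊆U (inj₁ (((u , _) , _) , _)) = u
        free⊆U (inj₂ (v∈ , _)) = P.inside α v∈

        -- Vertices with neighbours outside the bag are ends of paths; poor vertices lie on no path,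
        -- and the ends of `R α` are touching.
        free-interior : ∀ {k m} → Free k → k ~ m → U m
        free-interior {k} {m} fk e with U? m
        ... | yes um = um
        ... | no ¬um with boundary (free⊆U fk) e ¬um | fk
        ... | β , inj₁ refl | inj₁ (((_ , ¬on) , _) , _) = ⊥-elim (¬on (β , start∈ (P.walk β)))
        ... | β , inj₂ refl | inj₁ (((_ , ¬on) , _) , _) = ⊥-elim (¬on (β , end∈ (P.walk β)))
        ... | β , inj₁ refl | inj₂ (k∈ , ¬touch) with P.disj k∈ (start∈ (P.walk β))
        ... | refl = ⊥-elim (¬touch (inj₁ refl))
        free-interior fk e | no ¬um | β , inj₂ refl | inj₂ (k∈ , ¬touch) with P.disj k∈ (end∈ (P.walk β))
        ... | refl = ⊥-elim (¬touch (inj₂ (inj₁ refl)))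

        -- A neighbour off the paths would be free: a second non-trivial path attached to its
        -- component would make it rich and its neighbour on `R α` touching. A neighbour on another
        -- non-trivial path likewise contradicts poorness or non-touching, and one on a trivial path
        -- joins that path to α.
        classify : ∀ {m} → NK m → (on α m × Touching m) ⊎ (∃ λ γ → γ ∈ Tr × m ≡ s γ)
        classify {m} (¬Km , k , Kk , e) with Finₚ.any? (λ γ → on? γ m)
        ... | no ¬on = ⊥-elim (¬Km (reach-snoc Kk e (inj₁ (poor-m (reach-end Kk)))))
          where
          out-m : O m
          out-m = free-interior (reach-end Kk) e , ¬on
          poor-m : Free k → Poor α m
          poor-m (inj₁ poor) = poor-reach poor (step (proj₁ (proj₁ poor)) e (here out-m))
          poor-m (inj₂ (k∈ , ¬touch)) = att , λ β β≢ ntβ a →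
            ¬touch (inj₂ (inj₂ (m , e , inj₂ (β , α , β≢ , ntβ , ntα , a , att))))
            where
            att : T m α
            att = out-m , m , k , here out-m , k∈ , ~-sym e
        ... | yes (γ , m∈) with γ ≟ α
        ... | yes refl with touching? m
        ... | yes touch = inj₁ (m∈ , touch)
        ... | no ¬touch = ⊥-elim (¬Km (reach-snoc Kk e (inj₂ (m∈ , ¬touch))))
        classify {m} (¬Km , k , Kk , e) | yes (γ , m∈) | no γ≢ with s γ ≟ t γ | reach-end Kk
        ... | no ntγ | inj₁ (a , h) = ⊥-elim (h γ γ≢ ntγ (proj₁ a , k , m , here (proj₁ a) , m∈ , e))
        ... | no ntγ | inj₂ (k∈ , ¬touch) = ⊥-elim (¬touch (inj₂ (inj₂ (m , e , inj₁ (γ , γ≢ , ntγ , m∈)))))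
        ... | yes eq | fk = inj₂ (γ , ∈Tr eq (joined fk) , m≡s)
          where
          m≡s : m ≡ s γ
          m≡s with subst (m ∈ₗ_) (walk-loop (subst (λ z → Walk _~_ (s γ) z (R γ)) (≡sym eq) (P.walk γ)) (P.unique γ)) m∈
          ... | here m≡ = m≡
          joined : Free k → J α γ
          joined (inj₁ ((_ , c′ , u , r , u∈ , e′) , _)) = u , m , u∈ , m∈ , inj₂ (c′ , k , ~-sym e′ , ~-sym e , reach-sym r)
          joined (inj₂ (k∈ , _)) = k , m , k∈ , m∈ , inj₁ (γ≢ ∘ ≡sym , e)

        c∈K : K c
        c∈K = here (inj₁ poor-c)

        c∉X : c ∉ X
        c∉X c∈ = proj₁ (∈toSub⁻ nk? c∈) c∈K

        o∉X : o ∉ X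
        o∉X o∈ = case classify (∈toSub⁻ nk? o∈) of λ
          { (inj₁ (o∈R , _)) → o∉ (P.inside α o∈R)
          ; (inj₂ (γ , _ , o≡)) → o∉ (subst U (≡sym o≡) (P.inside γ (start∈ (P.walk γ)))) }

        K-closed : ∀ {u v} → Reach G (_∉ X) u v → K u → K v
        K-closed (here _) Ku = Ku
        K-closed {u} (step {y = v} _ e r) Ku = K-closed r (extend (k? v))
          where
          extend : Dec (K v) → K v
          extend (yes Kv) = Kv
          extend (no ¬Kv) = ⊥-elim (reach-start r (∈toSub⁺ nk? (¬Kv , u , Ku , e)))

        p≤X : p ≤ ∣ X ∣
        p≤X = ℕₚ.≮⇒≥ λ lt → o∉ (free⊆U (reach-end (K-closed (proj₂ conn X lt c o c∉X o∉X) c∈K)))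

        Xα? : Decidable (λ m → NK m × on α m × Touching m)
        Xα? m = nk? m ×-dec on? α m ×-dec touching? m

        XT? : Decidable (λ m → ∃ λ γ → γ ∈ Tr × m ≡ s γ)
        XT? m = Finₚ.any? λ γ → (γ Subₚ.∈? Tr) ×-dec (m ≟ s γ)

        Xα XT : Subset (n G)
        Xα = toSub Xα?
        XT = toSub XT?

        cover : X ⊆ XT ∪ Xα
        cover {m} m∈ = place (classify nk)
          where
          nk : NK m
          nk = ∈toSub⁻ nk? m∈
          place : (on α m × Touching m) ⊎ (∃ λ γ → γ ∈ Tr × m ≡ s γ) → m ∈ XT ∪ Xα
          place (inj₁ on-touch) = Subₚ.x∈p∪q⁺ (inj₂ (∈toSub⁺ Xα? (nk , on-touch)))
          place (inj₂ trivial) = Subₚ.x∈p∪q⁺ (inj₁ (∈toSub⁺ XT? trivial))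

        three : 3 ≤ ∣ Xα ∣
        three = three-remain small p≤X (ℕₚ.≤-trans (Subₚ.p⊆q⇒∣p∣≤∣q∣ cover) (∣∪∣≤ XT Xα)) (image-≤ Tr s XT (∈toSub⁻ XT?))

        N : V G → Set
        N m = NK m × Touching m

        middle-touch : Middle N (R α)
        middle-touch = find (enumerate 3 Xα three)
          where
          find : (∃ λ (g : Fin 3 → V G) → Injective _≡_ _≡_ g × (∀ i → g i ∈ Xα)) → Middle N (R α)
          find (g , inj , g∈) = middle N (R α) (onα zero) (onα (suc zero)) (onα (suc (suc zero)))
            (Ng zero) (Ng (suc zero)) (Ng (suc (suc zero)))
            (λ e → case inj e of λ ()) (λ e → case inj e of λ ()) (λ e → case inj e of λ ())
            where
            onα : ∀ i → on α (g i)
            onα i = proj₁ (proj₂ (∈toSub⁻ Xα? (g∈ i)))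
            Ng : ∀ i → N (g i)
            Ng i = proj₁ (∈toSub⁻ Xα? (g∈ i)) , proj₂ (proj₂ (∈toSub⁻ Xα? (g∈ i)))

        bypass : Middle N (R α) → Improved R
        bypass (pre , b , post , eq , (NKb , touch-b) , (a , a∈ , ((_ , k , Kk , ka) , _)) , (d , d∈ , ((_ , k′ , Kk′ , kd) , _))) =
          improve (reach⇒path detour)
          where
          w′ = subst (Walk _~_ (s α) (t α)) eq (P.walk α)
          u′ = subst Unique eq (P.unique α)
          Zb : V G → Set
          Zb z = Z α z × z ≢ b
          b∈ : on α b
          b∈ = subst (b ∈ₗ_) (≡sym eq) (Memₚ.∈-++⁺ʳ pre (here refl))
          pre-Zb : ∀ {z} → z ∈ₗ pre → Zb z
          pre-Zb {z} z∈ = inj₁ (subst (z ∈ₗ_) (≡sym eq) (Memₚ.∈-++⁺ˡ z∈)) , ++-distinct pre u′ z∈ (here refl)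
          regroup : pre ++ b ∷ post ≡ (pre ++ [ b ]) ++ post
          regroup = ≡sym (Listₚ.++-assoc pre [ b ] post)
          post-Zb : ∀ {z} → z ∈ₗ post → Zb z
          post-Zb {z} z∈ = inj₁ (subst (z ∈ₗ_) (≡sym eq) (Memₚ.∈-++⁺ʳ pre (there z∈))) ,
            λ z≡b → ++-distinct (pre ++ [ b ]) (subst Unique regroup u′) (Memₚ.∈-++⁺ʳ pre (here refl)) z∈ (≡sym z≡b)
          free-Zb : ∀ {z} → Free z → Zb z
          free-Zb (inj₁ poor) = inj₂ poor , λ { refl → proj₂ (proj₁ (proj₁ poor)) (α , b∈) }
          free-Zb (inj₂ (z∈ , ¬touch)) = inj₁ z∈ , λ { refl → ¬touch touch-b }
          head-walk = walk-prefix pre w′ a∈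
          head : Reach G Zb (s α) a
          head = walk⇒reach (proj₁ (proj₂ head-walk)) (pre-Zb ∘ proj₂ (proj₂ head-walk))
          tail-walk = walk-tail (proj₂ (walk-split pre w′)) d∈
          tail : Reach G Zb d (t α)
          tail = walk⇒reach (proj₁ (proj₂ tail-walk)) (post-Zb ∘ proj₂ (proj₂ tail-walk))
          across : Reach G Zb k k′
          across = reach-map free-Zb (reach-trans (reach-sym Kk) Kk′)
          detour : Reach G Zb (s α) (t α)
          detour = reach-trans head (step (reach-end head) (~-sym ka)
                     (reach-trans across (step (reach-end across) kd tail)))
          s≢b : b ≢ s α
          s≢b e = proj₂ (reach-start head) (≡sym e)
          t≢b : b ≢ t α
          t≢b e = proj₂ (reach-end tail) (≡sym e)
          improve : (∃ λ L → Walk _~_ (s α) (t α) L × Unique L × (∀ {v} → v ∈ₗ L → Zb v)) → Improved R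
          improve (L′ , walk′ , unique′ , h) = richer b∈ (rich-b touch-b)
            where
            open Detour R P α L′ walk′ unique′ (proj₁ ∘ h)
            b∉ : ¬ b ∈ₗ L′
            b∉ b∈L = proj₂ (h b∈L) refl
            att-b : State.T R′ b α
            att-b with Z-hits (inj₁ b∈)
            ... | inj₁ b∈L = ⊥-elim (b∉ b∈L)
            ... | inj₂ a = a
            rich-with : ∀ {β} → β ≢ α → NT β → State.T R′ b β → State.Rich R′ b
            rich-with β≢ ntβ a = _ , α , β≢ , ntβ , ntα , a , att-b
            rich-b : Touching b → State.Rich R′ b
            rich-b (inj₁ e) = ⊥-elim (s≢b e)
            rich-b (inj₂ (inj₁ e)) = ⊥-elim (t≢b e)
            rich-b (inj₂ (inj₂ (m , e , inj₁ (β , β≢ , ntβ , m∈)))) =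
              rich-with β≢ ntβ (proj₁ att-b , b , m , here (proj₁ att-b) , on′≢ β≢ m∈ , e)
            rich-b (inj₂ (inj₂ (m , e , inj₂ rich@(β , γ , β≢γ , ntβ , ntγ , aβ , aγ)))) with β ≟ α
            ... | yes refl = rich-with (β≢γ ∘ ≡sym) ntγ (att-reach U (State.on R′) (step (proj₁ att-b) e (here (proj₁ a′))) a′)
              where a′ = att-rich rich aγ
            ... | no β≢ = rich-with β≢ ntβ (att-reach U (State.on R′) (step (proj₁ att-b) e (here (proj₁ a′))) a′)
              where a′ = att-rich rich aβ

        improved : Improved R
        improved = bypass middle-touch

      attached⊎ : ∀ α c → (NT α → T c α → (∃ λ β → β ≢ α × NT β × T c β) ⊎
        (∃ λ (f : Fin (p ∸ 2) → Fin q) → Injective _≡_ _≡_ f × (∀ k → s (f k) ≡ t (f k) × J α (f k)))) ⊎ Improved R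
      attached⊎ α c with nt? α | t? c α | Finₚ.any? (λ β → ¬? (β ≟ α) ×-dec nt? β ×-dec t? c β)
      ... | no ¬nt | _ | _ = inj₁ λ nt → ⊥-elim (¬nt nt)
      ... | yes _ | no ¬a | _ = inj₁ λ _ a → ⊥-elim (¬a a)
      ... | yes _ | yes _ | yes other = inj₁ λ _ _ → inj₁ other
      ... | yes nt | yes a | no ¬other = decide (p ∸ 2 ≤? ∣ toSub Tr? ∣)
        where
        Tr? : Decidable (λ γ → s γ ≡ t γ × J α γ)
        Tr? γ = (s γ ≟ t γ) ×-dec joined? U on U? on? α γ
        decide : Dec (p ∸ 2 ≤ ∣ toSub Tr? ∣) → _
        decide (yes le) with enumerate (p ∸ 2) (toSub Tr?) le
        ... | f , inj , f∈ = inj₁ λ _ _ → inj₂ (f , (λ {_} {_} → inj) , λ k → ∈toSub⁻ Tr? (f∈ k))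
        decide (no ≰) = inj₂ (Stuck.improved α nt c (a , λ β β≢ ntβ aβ → ¬other (β , β≢ , ntβ , aβ))
          (toSub Tr?) (λ e j → ∈toSub⁺ Tr? (e , j)) (ℕₚ.≰⇒> ≰))

      attached-or-improved : PAttached U s t R ⊎ Improved R
      attached-or-improved with all⊎ (λ α → all⊎ λ u → all⊎ λ v → induced⊎ α u v) | all⊎ (λ α → all⊎ λ c → attached⊎ α c)
      ... | inj₂ imp | _ = inj₂ imp
      ... | inj₁ _ | inj₂ imp = inj₂ imp
      ... | inj₁ i | inj₁ a = inj₁ (record { induced = i ; attached = a })

    Result : (R : Fin q → List (V G)) → Set
    Result R = ∃ λ R′ → Paths U s t R′ × PAttached U s t R′ × Kept R R′

    -- Lexicographic descent on the number of vertices that are not rich and the number of vertices on the paths.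
    reroute′ : ∀ a b R → Paths U s t R → ∣ State.nonrich R ∣ ≤ a → ∣ State.onSet R ∣ ≤ b → Result R
    reroute′ a b R P a≤ b≤ with Step.attached-or-improved R P
    ... | inj₁ done = R , P , done , λ _ _ j → j
    reroute′ zero b R P a≤ b≤ | inj₂ (R′ , P′ , kept , inj₁ lt) = ⊥-elim (ℕₚ.n≮0 (ℕₚ.<-≤-trans lt a≤))
    reroute′ (suc a) b R P a≤ b≤ | inj₂ (R′ , P′ , kept , inj₁ lt)
      with reroute′ a (n G) R′ P′ (ℕₚ.≤-pred (ℕₚ.≤-trans lt a≤)) (Subₚ.∣p∣≤n (State.onSet R′))
    ... | R″ , P″ , att , kept′ = R″ , P″ , att , λ ne nt j → kept′ ne nt (kept ne nt j)
    reroute′ a zero R P a≤ b≤ | inj₂ (R′ , P′ , kept , inj₂ (le , lt)) = ⊥-elim (ℕₚ.n≮0 (ℕₚ.<-≤-trans lt b≤))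
    reroute′ a (suc b) R P a≤ b≤ | inj₂ (R′ , P′ , kept , inj₂ (le , lt))
      with reroute′ a b R′ P′ (ℕₚ.≤-trans le a≤) (ℕₚ.≤-pred (ℕₚ.≤-trans lt b≤))
    ... | R″ , P″ , att , kept′ = R″ , P″ , att , λ ne nt j → kept′ ne nt (kept ne nt j)

    reroute : ∀ R → Paths U s t R → Result R
    reroute R P = reroute′ _ _ R P ℕₚ.≤-refl ℕₚ.≤-refl

-- Regular chains

compose : ∀ {M M₁ M₂} → Selection M M₁ → Selection M₁ M₂ → Selection M M₂
compose {M} {M₁} {M₂} S S′ = record
  { f = F.f ∘ F′.f
  ; inc = λ i i< → strictly (F′.inc i i<) (F′.f≤ i<)
  ; end = F.f≤ F′.end }
  where
  module F = Selection S
  module F′ = Selection S′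
  strictly : ∀ {i j} → i < j → j ≤ M₁ → F.f i < F.f j
  strictly {i} i< j≤ = ℕₚ.<-≤-trans (F.inc i (ℕₚ.<-≤-trans i< j≤)) (F.f-mono i< j≤)

module _ {M M₁ M₂} (S : Selection M M₁) (S′ : Selection M₁ M₂) where

  private
    module F = Selection S
    module F′ = Selection S′
    module FF = Selection (compose S S′)

  within-compose⁻ : ∀ {i k} → i < M₂ → FF.Within i k → ∃ λ j → F′.Within i j × F.Within j k
  within-compose⁻ {i} {k} i< (lo , hi) with find-step (λ j → k <? F.f j) (ℕₚ.<⇒≤ (F′.inc i i<)) (ℕₚ.≤⇒≯ lo) hi
  ... | j , a , b , c , d = j , (a , b) , (ℕₚ.≮⇒≥ c , d)

  within-compose⁺ : ∀ {i j k} → i < M₂ → F′.Within i j → F.Within j k → FF.Within i k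
  within-compose⁺ i< (a , b) (c , d) =
    ℕₚ.≤-trans (F.f-mono a (ℕₚ.≤-trans (ℕₚ.<⇒≤ b) (F′.f≤ i<))) c ,
    ℕₚ.<-≤-trans d (F.f-mono b (F′.f≤ i<))

within-< : ∀ {M M′} (S : Selection M M′) → ∀ {i k} → i < M′ → Selection.Within S i k → k < M
within-< S i< (_ , k<) = ℕₚ.<-≤-trans k< (Selection.f≤ S i<)

within-start : ∀ {M M′} (S : Selection M M′) → ∀ {i} → i < M′ → Selection.Within S i (Selection.f S i)
within-start S i< = ℕₚ.≤-refl , Selection.inc S _ i<

shiftSelection : ∀ {M M′} b → M′ + b ≤ M → Selection M M′
shiftSelection b le = record { f = _+ b ; inc = λ _ _ → ℕₚ.≤-refl ; end = le }

blockSelection : ∀ {M} B s → 0 < s → B * s ≤ M → Selection M B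
blockSelection B s 0<s le = record { f = _* s ; inc = λ i _ → ℕₚ.+-monoˡ-< (i * s) 0<s ; end = le }

block-≤ : ∀ {B} b s → b < B → s + b * s ≤ B * s
block-≤ b s b< = ℕₚ.*-monoˡ-≤ s b<

uniBound : ℕ → ℕ → ℕ
uniBound zero M′ = M′
uniBound (suc r) M′ = uniBound r M′ * uniBound r M′

module _ {M M′ : ℕ} (S : Selection M M′) (T : ℕ → Set) where

  open Selection S

  Everywhere Nowhere : Set
  Everywhere = ∀ i → i < M′ → ∃ λ k → Within i k × T k
  Nowhere = ∀ i → i < M′ → ∀ k → Within i k → ¬ T k

module _ (T : ℕ → Set) (T? : ∀ k → Dec (T k)) where

  -- Cut into `M₁` blocks of `M₁` bags. If every block contains a bag with the property, the blocks
  -- are merged; otherwise the bags of a block without it are taken singly. Hence one squaring per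
  -- property in `uniBound`.
  uniformize₁ : ∀ {M} M₁ → M₁ * M₁ ≤ M → Σ (Selection M M₁) λ S → Everywhere S T ⊎ Nowhere S T
  uniformize₁ zero le = shiftSelection 0 z≤n , inj₂ λ _ ()
  uniformize₁ {M} M₁@(suc _) le with all<⊎ M₁ block
    where
    block : ∀ b → b < M₁ → (∃ λ i → i < M₁ × T (i + b * M₁)) ⊎ (∃ λ b → b < M₁ × ∀ i → i < M₁ → ¬ T (i + b * M₁))
    block b b< with all<⊎ M₁ {P = λ i → ¬ T (i + b * M₁)} {Q = ∃ λ i → i < M₁ × T (i + b * M₁)}
                      (λ i i< → case T? (i + b * M₁) of λ { (yes t) → inj₂ (i , i< , t) ; (no ¬t) → inj₁ ¬t })
    ... | inj₁ none = inj₂ (b , b< , none)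
    ... | inj₂ some = inj₁ some
  ... | inj₁ some = blockSelection M₁ M₁ (s≤s z≤n) le , inj₁ λ b b< →
      let i , i< , t = some b b< in i + b * M₁ , (ℕₚ.m≤n+m (b * M₁) i , ℕₚ.+-monoˡ-< (b * M₁) i<) , t
  ... | inj₂ (b , b< , none) = shiftSelection (b * M₁) (ℕₚ.≤-trans (block-≤ b M₁ b<) le) , inj₂ λ i i< k (lo , hi) t →
      none i i< (subst T (ℕₚ.≤-antisym (ℕₚ.≤-pred hi) lo) t)

-- A merged bag counts as having a property when one of its parts has it. With this reading,
-- everywhere and nowhere both persist under further merging, so the properties can be treated one
-- at a time.
uniformize : ∀ r M′ (T : Fin r → ℕ → Set) → (∀ c k → Dec (T c k)) → ∀ {M} → uniBound r M′ ≤ M →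
             Σ (Selection M M′) λ S → ∀ c → Everywhere S (T c) ⊎ Nowhere S (T c)
uniformize zero M′ T T? le = shiftSelection 0 (ℕₚ.≤-trans (ℕₚ.≤-reflexive (ℕₚ.+-identityʳ M′)) le) , λ ()
uniformize (suc r) M′ T T? le with uniformize₁ (T zero) (T? zero) (uniBound r M′) le
... | S , first with uniformize r M′ T′ T′? ℕₚ.≤-refl
  where
  open Selection S
  T′ : Fin r → ℕ → Set
  T′ c j = ∃ λ k → Within j k × T (suc c) k
  T′? : ∀ c j → Dec (T′ c j)
  T′? c j = map′ (λ (k , k< , lo , t) → k , (lo , k<) , t) (λ (k , (lo , k<) , t) → k , k< , lo , t)
    (ℕₚ.anyUpTo? (λ k → (f j ≤? k) ×-dec T? (suc c) k) (f (suc j)))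
... | S′ , rest = compose S S′ , λ
  { zero → case first of λ
    { (inj₁ every) → inj₁ λ i i< →
        let k , w , t = every _ (within-< S′ i< (within-start S′ i<))
        in k , within-compose⁺ S S′ i< (within-start S′ i<) w , t
    ; (inj₂ none) → inj₂ λ i i< k w → let j , w′ , w″ = within-compose⁻ S S′ i< w in none j (within-< S′ i< w′) k w″ }
  ; (suc c) → case rest c of λ
    { (inj₁ every) → inj₁ λ i i< → let j , w′ , k , w″ , t = every i i< in k , within-compose⁺ S S′ i< w′ w″ , t
    ; (inj₂ none) → inj₂ λ i i< k w t → let j , w′ , w″ = within-compose⁻ S S′ i< w in none i i< j w′ (k , w″ , t) } }

-- Non-triviality of the q labels is made uniform before rerouting, which does not move the ends;
-- the q² possible edges only afterwards, because rerouting changes them.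
regularBound : ℕ → ℕ → ℕ
regularBound q M = uniBound q (uniBound (q * q) M)

module Regularity (G : Graph) (p : ℕ) (conn : Connected G p) (o o′ : V G) where

  open LabelledChains G o o′ public
  open Reroute G p conn public using (PAttached; reroute)

  -- Distinct ordered pairs are counted, so their number never exceeds q². As a mere lower bound
  -- this is stable under every operation on chains.
  Many : ∀ {q} → ℕ → (Fin q → Fin q → Set) → (Fin q → Set) → Set
  Many {q} e E NT = ∃ λ (f : Fin e → Fin q × Fin q) → Injective _≡_ _≡_ f ×
    (∀ k → proj₁ (f k) ≢ proj₂ (f k) × (NT (proj₁ (f k)) ⊎ NT (proj₂ (f k))) × E (proj₁ (f k)) (proj₂ (f k)))

  many-map : ∀ {q e} {E E′ : Fin q → Fin q → Set} {NT NT′ : Fin q → Set} →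
             (∀ {α β} → α ≢ β → NT α ⊎ NT β → E α β → E′ α β) → (∀ {α} → NT α → NT′ α) →
             Many e E NT → Many e E′ NT′
  many-map g h (f , inj , ok) = f , inj , λ k →
    let ne , nt , e = ok k in ne , map-⊎ h h nt , g ne nt e

  module _ {q M} (C : Chain q M) where

    open Chain C
    open Theory C

    AttachedAt : ℕ → Set
    AttachedAt i = PAttached (U i) (x i) (x (suc i)) (R i)

    UniformNT : Set
    UniformNT = ∀ α → (∀ i → i < M → NT i α) ⊎ (∀ i → i < M → ¬ NT i α)

    UniformE : Set
    UniformE = ∀ α β → (∀ i → i < M → E i α β) ⊎ (∀ i → i < M → ¬ E i α β)

    ManyEdges : ℕ → Set
    ManyEdges e = ∀ i → i < M → Many e (E i) (NT i)

    module _ (i : ℕ) (i< : i < M) where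

      unit-boundary : ∀ {v m} → U i v → v ~ m → ¬ U i m → ∃ λ α → v ≡ x i α ⊎ v ≡ x (suc i) α
      unit-boundary {v} {m} (v∈ , h) e ¬um with m Subₚ.∈? A (suc i) | m Subₚ.∈? A i | m Subₚ.∈? ∂ (A i)
      ... | no m∉ | _ | _ = let α , eq = ontoʳ i< (∂⁺ (A (suc i)) v∈ e m∉) in α , inj₂ eq
      ... | yes m∈ | no m∉ | _ = ⊥-elim (¬um (m∈ , ⊥-elim ∘ m∉))
      ... | yes m∈ | yes _ | yes m∈∂ = ⊥-elim (¬um (m∈ , λ _ → m∈∂))
      ... | yes m∈ | yes m∈i | no m∉∂ with v Subₚ.∈? A i
      ... | yes v∈i = let α , eq = ontoˡ i< (h v∈i) in α , inj₁ eq
      ... | no v∉i = ⊥-elim (m∉∂ (∂⁺ (A i) m∈i (~-sym e) v∉i))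

      rerouted : ∃ λ R′ → Paths (U i) (x i) (x (suc i)) R′ × PAttached (U i) (x i) (x (suc i)) R′ ×
        (∀ {β γ} → β ≢ γ → NT i β ⊎ NT i γ → E i β γ → Joined (U i) (λ α → _∈ₗ R′ α) β γ)
      rerouted with reroute (bag? (A i) (A (suc i))) o (λ uo → proj₁ (proper (suc i) i<) (proj₁ uo))
                      (x i) (x (suc i)) unit-boundary (R i) (paths i i<)
      ... | R′ , P′ , att , kept = R′ , P′ , att , λ {_} {_} → kept

    private
      chosen = choose M (λ _ → []) rerouted

    rerouteChain : Chain q M
    rerouteChain = record
      { A = A ; strict = strict ; card = card ; proper = proper ; x = x ; R = proj₁ chosen
      ; paths = λ i i< → proj₁ (proj₂ chosen i i<) ; x∈ˡ = x∈ˡ ; x∈ʳ = x∈ʳ }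

    reroute-attached : ∀ i → i < M → PAttached (U i) (x i) (x (suc i)) (Chain.R rerouteChain i)
    reroute-attached i i< = proj₁ (proj₂ (proj₂ chosen i i<))

    reroute-many : ∀ {e i} → i < M → Many e (E i) (NT i) → Many e (Chain.E rerouteChain i) (NT i)
    reroute-many {e} {i} i< = many-map (proj₂ (proj₂ (proj₂ chosen i i<))) id

  module _ {q M M′} (C : Chain q M) (S : Selection M M′) where

    open Chain C
    open Theory C
    open Selection S
    open Merge S

    private module C′ = Chain merged

    merge-many : ∀ {e} → ManyEdges C e → ManyEdges merged e
    merge-many many i i< = many-map {E = E (f i)} {E′ = C′.E i} {NT = NT (f i)} {NT′ = C′.NT i} (λ _ _ → merged-e⁺ i< (within-start S i<)) (merged-nt⁺ i< (within-start S i<))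
      (many (f i) (within-< S i< (within-start S i<)))

    merge-uniformNT : (∀ α → Everywhere S (λ k → NT k α) ⊎ Nowhere S (λ k → NT k α)) → UniformNT merged
    merge-uniformNT u α with u α
    ... | inj₁ every = inj₁ λ i i< → let k , w , nt = every i i< in merged-nt⁺ i< w nt
    ... | inj₂ none = inj₂ λ i i< nt → let k , w , nt′ = merged-nt⁻ i< nt in none i i< k w nt′

    merge-uniformNT′ : UniformNT C → UniformNT merged
    merge-uniformNT′ u = merge-uniformNT λ α → case u α of λ
      { (inj₁ all) → inj₁ λ i i< → f i , within-start S i< , all _ (within-< S i< (within-start S i<))
      ; (inj₂ none) → inj₂ λ i i< k w → none k (within-< S i< w) }

    merge-uniformE : (∀ α β → Everywhere S (λ k → E k α β) ⊎ Nowhere S (λ k → E k α β)) → UniformE merged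
    merge-uniformE u α β with u α β
    ... | inj₁ every = inj₁ λ i i< → let k , w , e = every i i< in merged-e⁺ i< w e
    ... | inj₂ none = inj₂ λ i i< e → let k , w , e′ = merged-e⁻ i< e in none i i< k w e′

    -- A chord or a non-trivial bridge of a merged bag lies in one old bag, where attachedness is
    -- known. Uniformity makes a label trivial there exactly when it is trivial in the merged bag.
    merge-attached : UniformNT C → (∀ i → i < M → AttachedAt C i) → ∀ i → i < M′ → AttachedAt merged i
    merge-attached u att i i< = record { induced = induced ; attached = attached }
      where
      nt-at : ∀ {α k} → C′.NT i α → Within i k → NT k α
      nt-at {α} {k} nt w with u α
      ... | inj₁ all = all k (within-< S i< w)
      ... | inj₂ none = let k′ , w′ , nt′ = merged-nt⁻ i< nt in ⊥-elim (none k′ (within-< S i< w′) nt′)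
      trivial : ∀ {α k} → Within i k → x k α ≡ x (suc k) α → C′.x i α ≡ C′.x (suc i) α
      trivial {α} w eq with C′.x i α ≟ C′.x (suc i) α
      ... | yes eq′ = eq′
      ... | no nt = ⊥-elim (nt-at nt w eq)
      induced : ∀ α u v → u ∈ₗ C′.R i α → v ∈ₗ C′.R i α → u ~ v → PathEdge (C′.R i α) u v
      induced α u v u∈ v∈ e with edge-cover (inc i i<) (f≤ i<) (onI⇒UI (inc i i<) (f≤ i<) (merged-∈⁻ i< u∈))
                                   (onI⇒UI (inc i i<) (f≤ i<) (merged-∈⁻ i< v∈)) e
      ... | k , lo , hi , uu , uv = infix-pathEdge (merged-infix i< (lo , hi) α)
        (PAttached.induced (att k (within-< S i< (lo , hi))) α u v
          (on-narrow (inc i i<) (f≤ i<) hi (merged-∈⁻ i< u∈) uu) (on-narrow (inc i i<) (f≤ i<) hi (merged-∈⁻ i< v∈) uv) e)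
      attached : ∀ α c → C′.NT i α → Att (C′.U i) (C′.on i) c α →
        (∃ λ β → β ≢ α × C′.NT i β × Att (C′.U i) (C′.on i) c β) ⊎
        (∃ λ (g : Fin (p ∸ 2) → Fin q) → Injective _≡_ _≡_ g ×
           (∀ k → C′.x i (g k) ≡ C′.x (suc i) (g k) × C′.E i α (g k)))
      attached α c nt a with merged-att⁻ i< a
      ... | k , w , a′ with PAttached.attached (att k (within-< S i< w)) α c (nt-at nt w) a′
      ... | inj₁ (β , β≢ , ntβ , aβ) = inj₁ (β , β≢ , merged-nt⁺ i< w ntβ , merged-att⁺ i< w aβ)
      ... | inj₂ (g , inj , ok) = inj₂ (g , (λ {_} {_} → inj) , λ j → trivial w (proj₁ (ok j)) , merged-e⁺ i< w (proj₂ (ok j)))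

  record Regular (q M e : ℕ) : Set where
    field
      C        : Chain q M
      uniNT    : UniformNT C
      uniE     : UniformE C
      attached : ∀ i → i < M → AttachedAt C i
      many     : ManyEdges C e

  regularize : ∀ {q M M′ e} (C : Chain q M) → ManyEdges C e → regularBound q M′ ≤ M → Regular q M′ e
  regularize {q} {M} {M′} {e} C many le = record
    { C = C₃ ; uniNT = merge-uniformNT′ C₂ S₂ uniNT₁
    ; uniE = merge-uniformE C₂ S₂ uniE
    ; attached = merge-attached C₂ S₂ uniNT₁ (reroute-attached C₁)
    ; many = merge-many C₂ S₂ (λ i i< → reroute-many C₁ i< (merge-many C S₁ many i i<)) }
    where
    sel₁ = uniformize q (uniBound (q * q) M′) (λ α k → Chain.NT C k α) (λ α k → Chain.nt? C k α) le
    S₁ = proj₁ sel₁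
    C₁ = Theory.Merge.merged C S₁
    uniNT₁ = merge-uniformNT C S₁ (proj₂ sel₁)
    C₂ = rerouteChain C₁
    pair : Fin (q * q) → Fin q × Fin q
    pair = Data.Fin.remQuot {q} q
    sel₂ = uniformize (q * q) M′ (λ c k → Chain.E C₂ k (proj₁ (pair c)) (proj₂ (pair c)))
             (λ c k → Chain.e? C₂ k (proj₁ (pair c)) (proj₂ (pair c))) ℕₚ.≤-refl
    S₂ = proj₁ sel₂
    C₃ = Theory.Merge.merged C₂ S₂
    uniE : ∀ α β → Everywhere S₂ (λ k → Chain.E C₂ k α β) ⊎ Nowhere S₂ (λ k → Chain.E C₂ k α β)
    uniE α β = subst (λ (γ , δ) → Everywhere S₂ (λ k → Chain.E C₂ k γ δ) ⊎ Nowhere S₂ (λ k → Chain.E C₂ k γ δ))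
      (Finₚ.remQuot-combine α β) (proj₂ sel₂ (combine α β))

-- The last argument counts the gains of an edge still allowed for. A block has l + 2 bags: the
-- inner l are tested for stability, and the outer two guarantee that a replaced bag has untouched
-- neighbours in its block. When no gain is left, a single bag suffices for a contradiction.
mainBound : ℕ → ℕ → ℕ → ℕ
mainBound q l zero = 1
mainBound q l (suc r) = regularBound q (mainBound q l r * suc (suc l))

-- Stability

allFinVecs⊎ : ∀ {m} q {P : Vec (Fin m) q → Set} {Q : Set} → (∀ v → P v ⊎ Q) → (∀ v → P v) ⊎ Q
allFinVecs⊎ zero f with f []
... | inj₁ p = inj₁ λ { [] → p }
... | inj₂ q = inj₂ q
allFinVecs⊎ (suc q) f with all⊎ (λ i → allFinVecs⊎ q (λ v → f (i ∷ v)))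
... | inj₂ r = inj₂ r
... | inj₁ g = inj₁ λ { (i ∷ v) → g i v }

module Stability (G : Graph) (p : ℕ) (conn : Connected G p) (o o′ : V G) where

  open Regularity G p conn o o′ public

  walk? : ∀ x y L → Dec (Walk _~_ x y L)
  walk? x y [] = no λ ()
  walk? x y (z ∷ []) with x ≟ z | y ≟ z
  ... | yes refl | yes refl = yes nil
  ... | yes refl | no y≢ = no λ { nil → y≢ refl }
  ... | no x≢ | _ = no λ { nil → x≢ refl }
  walk? x y (z ∷ L@(z′ ∷ _)) with x ≟ z | x ~? z′ | walk? z′ y L
  ... | no x≢ | _ | _ = no λ { (cons _ _) → x≢ refl }
  ... | yes refl | no ≁ | _ = no λ { (cons e nil) → ≁ e ; (cons e (cons _ _)) → ≁ e }
  ... | yes refl | yes _ | no ¬w = no λ { (cons e nil) → ¬w nil ; (cons e w@(cons _ _)) → ¬w w }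
  ... | yes refl | yes e | yes w = yes (cons e w)

  unique? : Decidable {A = List (V G)} Unique
  unique? = AllPairsₚ.allPairs? (λ x y → ¬? (x ≟ y))
    where import Data.List.Relation.Unary.AllPairs as AllPairsₚ

  paths? : ∀ {U : V G → Set} (U? : Decidable U) {q} (s t : Fin q → V G) R → Dec (Paths U s t R)
  paths? U? s t R = map′
    (λ (w , u , i , d) → record { walk = w ; unique = u ; inside = λ α → All.lookup (i α)
                                ; disj = λ {α} {β} {v} a b → d α β v a b })
    (λ P → let open Paths P in walk , unique , (λ α → All.tabulate (inside α)) , λ α β v → disj)
    (Finₚ.all? (λ α → walk? (s α) (t α) (R α)) ×-dec Finₚ.all? (λ α → unique? (R α)) ×-dec
     Finₚ.all? (λ α → All.all? U? (R α)) ×-dec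
     Finₚ.all? (λ α → Finₚ.all? λ β → Finₚ.all? λ v → (v ∈L? R α) →-dec ((v ∈L? R β) →-dec (α ≟ β))))

  paths-cong : ∀ {U : V G → Set} {q} {s t t′ : Fin q → V G} {R R′} → (∀ α → t α ≡ t′ α) → (∀ α → R α ≡ R′ α) →
               Paths U s t R → Paths U s t′ R′
  paths-cong {U} {q} {s} {t} {t′} {R} {R′} t≗ R≗ P = record
    { walk = λ α → subst (λ z → Walk _~_ (s α) z (R′ α)) (t≗ α) (subst (Walk _~_ (s α) (t α)) (R≗ α) (walk α))
    ; unique = λ α → subst Unique (R≗ α) (unique α)
    ; inside = λ α v∈ → inside α (back α v∈)
    ; disj = λ {α} {β} a b → disj (back α a) (back β b) }
    where
    open Paths P
    back : ∀ α {v} → v ∈ₗ R′ α → v ∈ₗ R α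
    back α {v} = subst (v ∈ₗ_) (≡sym (R≗ α))

  joined-relabel : ∀ {U : V G → Set} {q} {on : Fin q → V G → Set} (σ : Fin q → Fin q) {α β} →
                   Joined U on (σ α) (σ β) → Joined U (on ∘ σ) α β
  joined-relabel σ (u , v , u∈ , v∈ , inj₁ (ne , e)) = u , v , u∈ , v∈ , inj₁ (ne ∘ cong σ , e)
  joined-relabel σ (u , v , u∈ , v∈ , inj₂ (c , c′ , e , e′ , r)) = u , v , u∈ , v∈ ,
    inj₂ (c , c′ , e , e′ , reach-map (λ (a , ¬on) → a , λ (γ , h) → ¬on (σ γ , h)) r)

  paths-end-injective : ∀ {U : V G → Set} {q} {s : Fin q → V G} {y : Fin q → V G} {R} (π : Fin q → Fin q) →
                        Paths U s (y ∘ π) R → Injective _≡_ _≡_ π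
  paths-end-injective {y = y} {R} π P {α} {β} e =
    disj (end∈ (walk α)) (subst (λ z → y z ∈ₗ R β) (≡sym e) (end∈ (walk β)))
    where open Paths P

  module Units {q M} (C : Chain q M) where

    open Chain C

    onQ : (Fin q → List (V G)) → Fin q → V G → Set
    onQ Q α v = v ∈ₗ Q α

    Linked-by : ℕ → (Fin q → List (V G)) → (Fin q → Fin q) → Set
    Linked-by k Q π = Paths (U k) (x k) (x (suc k) ∘ π) Q

    Respects : ℕ → (Fin q → List (V G)) → (Fin q → Fin q) → Fin q → Fin q → Set
    Respects k Q π α β = α ≢ β →
      (E k α β → E k (π α) (π β)) × (E k (π α) (π β) → E k α β) ×
      (NT k α ⊎ NT k β → Joined (U k) (onQ Q) α β → E k α β)

    StableAt : ℕ → Set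
    StableAt k = ∀ Q π → Linked-by k Q π → ∀ α β → Respects k Q π α β

    Violates : ℕ → (Fin q → List (V G)) → (Fin q → Fin q) → Set
    Violates k Q π = ∃₂ λ α β → α ≢ β × (NT k α ⊎ NT k β) ×
      ((Joined (U k) (onQ Q) α β × ¬ E k α β) ⊎ (E k (π α) (π β) × ¬ E k α β) ⊎ (E k α β × ¬ E k (π α) (π β)))

    UnstableAt : ℕ → Set
    UnstableAt k = ∃₂ λ Q π → Linked-by k Q π × Violates k Q π

    -- The path that ends at `x (suc k) α` contains `x k α`, the same vertex, at which `Q α` starts;
    -- by disjointness it is `Q α`. So only pairs with a non-trivial label can violate stability.
    trivial-fixed : ∀ {k Q π} → Linked-by k Q π → ∀ {α} → ¬ NT k α → π α ≡ α
    trivial-fixed {k} {Q} {π} P {α} ¬nt = trans (cong π (≡sym γ≡α)) πγ≡α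
      where
      open Paths P
      inverse = injective⇒inverse π (paths-end-injective {y = x (suc k)} π P)
      γ = proj₁ inverse α
      πγ≡α : π γ ≡ α
      πγ≡α = proj₂ (proj₂ inverse) α
      stays : x (suc k) α ≡ x k α
      stays = case x k α ≟ x (suc k) α of λ { (yes e) → ≡sym e ; (no ne) → ⊥-elim (¬nt ne) }
      γ≡α : γ ≡ α
      γ≡α = disj (subst (_∈ₗ Q γ) (trans (cong (x (suc k)) πγ≡α) stays) (end∈ (walk γ))) (start∈ (walk α))

    respects⊎ : ∀ k Q π → Linked-by k Q π → ∀ α β → Respects k Q π α β ⊎ Violates k Q π
    respects⊎ k Q π P α β = decide (α ≟ β) (nt? k α ⊎-dec nt? k β)
      where
      decide : Dec (α ≡ β) → Dec (NT k α ⊎ NT k β) → Respects k Q π α β ⊎ Violates k Q π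
      decide (yes e) _ = inj₁ λ ne → ⊥-elim (ne e)
      decide (no ne) (no ¬nt) = inj₁ λ _ →
        subst (λ z → E k z (π β)) (≡sym πα) ∘ subst (E k α) (≡sym πβ) ,
        subst (E k α) πβ ∘ subst (λ z → E k z (π β)) πα , ⊥-elim ∘ ¬nt
        where
        πα = trivial-fixed P (¬nt ∘ inj₁)
        πβ = trivial-fixed P (¬nt ∘ inj₂)
      decide (no ne) (yes nt) = compare (e? k α β) (e? k (π α) (π β))
          (joined? (U k) (onQ Q) (bag? (A k) (A (suc k))) (λ α v → v ∈L? Q α) α β)
        where
        compare : Dec (E k α β) → Dec (E k (π α) (π β)) → Dec (Joined (U k) (onQ Q) α β) →
                  Respects k Q π α β ⊎ Violates k Q π
        compare (yes e) (yes e′) _ = inj₁ λ _ → (λ _ → e′) , (λ _ → e) , (λ _ _ → e)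
        compare (yes e) (no ¬e′) _ = inj₂ (α , β , ne , nt , inj₂ (inj₂ (e , ¬e′)))
        compare (no ¬e) (yes e′) _ = inj₂ (α , β , ne , nt , inj₂ (inj₁ (e′ , ¬e)))
        compare (no ¬e) (no ¬e′) (yes j) = inj₂ (α , β , ne , nt , inj₁ (j , ¬e))
        compare (no ¬e) (no ¬e′) (no ¬j) = inj₁ λ _ → ⊥-elim ∘ ¬e , ⊥-elim ∘ ¬e′ , λ _ j → ⊥-elim (¬j j)

    -- Paths repeat no vertex, so only vectors of lists of length at most `n G` have to be tested;
    -- `transport` carries the outcome from tabulated functions to arbitrary ones.
    stable⊎ : ∀ k → StableAt k ⊎ UnstableAt k
    stable⊎ k = finish (allVecs⊎ q (n G) λ Q → allFinVecs⊎ q λ π → test (lookup Q) (lookup π))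
      where
      Ok : (Fin q → List (V G)) → (Fin q → Fin q) → Set
      Ok Q π = Linked-by k Q π → ∀ α β → Respects k Q π α β
      test : ∀ Q π → Ok Q π ⊎ UnstableAt k
      test Q π with paths? (bag? (A k) (A (suc k))) (x k) (x (suc k) ∘ π) Q
      ... | no ¬P = inj₁ λ P → ⊥-elim (¬P P)
      ... | yes P with all⊎ (λ α → all⊎ λ β → respects⊎ k Q π P α β)
      ... | inj₁ ok = inj₁ λ _ → ok
      ... | inj₂ bad = inj₂ (Q , π , P , bad)
      finish : (∀ Q → (∀ α → length (lookup Q α) ≤ n G) → ∀ π → Ok (lookup Q) (lookup π)) ⊎ UnstableAt k → StableAt k ⊎ UnstableAt k
      finish (inj₂ bad) = inj₂ bad
      finish (inj₁ ok) = inj₁ stable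
        where
        stable : StableAt k
        stable Q π P α β = transport (ok (tabulate Q) short (tabulate π) P′ α β)
          where
          Q≗ : ∀ γ → Q γ ≡ lookup (tabulate Q) γ
          Q≗ γ = ≡sym (Vecₚ.lookup∘tabulate Q γ)
          π≗ : ∀ γ → π γ ≡ lookup (tabulate π) γ
          π≗ γ = ≡sym (Vecₚ.lookup∘tabulate π γ)
          P′ : Linked-by k (lookup (tabulate Q)) (lookup (tabulate π))
          P′ = paths-cong (λ γ → cong (x (suc k)) (π≗ γ)) Q≗ P
          short : ∀ γ → length (lookup (tabulate Q) γ) ≤ n G
          short γ = ℕₚ.≤-trans (unique⇒length≤ full _ (Paths.unique P′ γ) (λ _ _ → Subₚ.∈⊤)) (ℕₚ.≤-reflexive (Subₚ.∣⊤∣≡n (n G)))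
          transport : Respects k (lookup (tabulate Q)) (lookup (tabulate π)) α β → Respects k Q π α β
          transport h ne with h ne
          ... | a , b , c rewrite Vecₚ.lookup∘tabulate π α | Vecₚ.lookup∘tabulate π β =
            a , b , λ nt j → c nt (joined-cong id (λ {γ} {v} → subst (v ∈ₗ_) (Q≗ γ)) (λ {γ} {v} → subst (v ∈ₗ_) (≡sym (Q≗ γ))) j)

  module _ {q e : ℕ} {E E′ : Fin q → Fin q → Set} {NT NT′ : Fin q → Set} where

    many-suc : (h : Fin q → Fin q) → Injective _≡_ _≡_ h →
               (∀ {c d} → E c d → E′ (h c) (h d)) → (∀ {c} → NT c → NT′ (h c)) →
               ∀ {a b} → a ≢ b → NT′ a ⊎ NT′ b → E′ a b → (∀ {c d} → E c d → h c ≡ a → h d ≡ b → ⊥) →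
               Many e E NT → Many (suc e) E′ NT′
    many-suc h h-inj hE hNT {a} {b} a≢b ntab eab fresh (f , inj , ok) = f′ , inj′ , ok′
      where
      f′ : Fin (suc e) → Fin q × Fin q
      f′ zero = a , b
      f′ (suc k) = h (proj₁ (f k)) , h (proj₂ (f k))
      inj′ : Injective _≡_ _≡_ f′
      inj′ {zero} {zero} _ = refl
      inj′ {zero} {suc k} eq = ⊥-elim (fresh (proj₂ (proj₂ (ok k))) (≡sym (cong proj₁ eq)) (≡sym (cong proj₂ eq)))
      inj′ {suc k} {zero} eq = ⊥-elim (fresh (proj₂ (proj₂ (ok k))) (cong proj₁ eq) (cong proj₂ eq))
      inj′ {suc k} {suc k′} eq = cong suc (inj (cong₂ _,_ (h-inj (cong proj₁ eq)) (h-inj (cong proj₂ eq))))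
      ok′ : ∀ k → _
      ok′ zero = a≢b , ntab , eab
      ok′ (suc k) = let ne , nt , ek = ok k in (λ eq → ne (h-inj eq)) , map-⊎ hNT hNT nt , hE ek

  -- An unstable unit in every block is replaced by a linkage violating stability. After restitching, the labels
  -- before and after it differ by π, so merging the block keeps all old edges and gains the violating one; when the
  -- gain is an edge lost under π, the old edges are read off behind the replaced unit, through π.
  module Densify {q M e} (Rg : Regular q M e) (B l : ℕ) (le : B * suc (suc l) ≤ M) where

    open Regular Rg
    open Chain C
    open Units C

    private
      s : ℕ
      s = suc (suc l)

    MidBlock : ℕ → ℕ → Set
    MidBlock b k = b * s < k × suc k < s + b * s

    module _ (κ : ℕ → ℕ) (κ-mid : ∀ b → b < B → MidBlock b (κ b) × UnstableAt (κ b)) where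

      private

        Marked : ℕ → Set
        Marked i = ∃ λ b → b < B × κ b ≡ i

        marked? : ∀ i → Dec (Marked i)
        marked? i = ℕₚ.anyUpTo? (λ b → κ b ℕₚ.≟ i) B

        Spec : ℕ → (Fin q → Fin q) × (Fin q → List (V G)) → Set
        Spec i (π , Q) = Linked-by i Q π ×
          ((¬ Marked i × (∀ α → π α ≡ α) × (∀ α → R i α ≡ Q α)) ⊎ (Marked i × Violates i Q π))

        specify : ∀ i → i < M → ∃ (Spec i)
        specify i i< with marked? i
        ... | no ¬m = (id , R i) , paths i i< , inj₁ (¬m , (λ _ → refl) , λ _ → refl)
        ... | yes (b , b< , refl) with proj₂ (κ-mid b b<)
        ... | Q , π , P , bad = (π , Q) , P , inj₂ ((b , b< , refl) , bad)

        chosen = choose M {P = Spec} (id , λ _ → []) specify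
        π : ℕ → Fin q → Fin q
        π i = proj₁ (proj₁ chosen i)
        Q : ℕ → Fin q → List (V G)
        Q i = proj₂ (proj₁ chosen i)
        spec : ∀ i → i < M → Spec i (π i , Q i)
        spec = proj₂ chosen

        BC : BrickChain q M
        BC = record
          { A = A ; strict = strict ; card = card ; proper = proper ; s = x ; t = λ i → x (suc i) ∘ π i ; R = Q
          ; paths = λ i i< → proj₁ (spec i i<) ; s∈ = x∈ˡ ; t∈ = λ i i< α → x∈ʳ i i< (π i α) }

        open Stitch BC
        module St = Chain stitched

        blocks : Selection M B
        blocks = blockSelection B s (s≤s z≤n) le

        unmarked : ∀ {i} → i < M → ¬ Marked i → (∀ α → π i α ≡ α) × (∀ α → R i α ≡ Q i α)
        unmarked i< ¬m with spec _ i<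
        ... | _ , inj₁ (_ , a , b) = a , b
        ... | _ , inj₂ (m , _) = ⊥-elim (¬m m)

        violated : ∀ {i} → i < M → Marked i → Violates i (Q i) (π i)
        violated i< m with spec _ i<
        ... | _ , inj₁ (¬m , _) = ⊥-elim (¬m m)
        ... | _ , inj₂ (_ , v) = v

        σ-next : ∀ {i} → suc i < M → ∀ α → σ (suc i) α ≡ π i (σ i α)
        σ-next i< α = σ-step i< α _ refl

        stitched-nt : ∀ {i} → i < M → ¬ Marked i → ∀ {α} → NT i (σ i α) → St.NT i α
        stitched-nt {i} i< ¬m {α} nt eq = nt (trans (≡sym (labels≡s i< α)) (trans eq (cong (x (suc i)) (proj₁ (unmarked i< ¬m) _))))

        stitched-e : ∀ {i α β} → Joined (U i) (onQ (Q i)) (σ i α) (σ i β) → St.E i α β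
        stitched-e {i} = joined-relabel (σ i)

        stitched-e′ : ∀ {i} → i < M → ¬ Marked i → ∀ {α β} → E i (σ i α) (σ i β) → St.E i α β
        stitched-e′ i< ¬m e = stitched-e (joined-cong id
          (λ {γ} {v} → subst (v ∈ₗ_) (proj₂ (unmarked i< ¬m) γ)) (λ {γ} {v} → subst (v ∈ₗ_) (≡sym (proj₂ (unmarked i< ¬m) γ))) e)

        moveE : ∀ {i j} → i < M → j < M → ∀ {α β} → E i α β → E j α β
        moveE {i} {j} i< j< {α} {β} e with uniE α β
        ... | inj₁ all = all j j<
        ... | inj₂ none = ⊥-elim (none i i< e)

        moveNT : ∀ {i j} → i < M → j < M → ∀ {α} → NT i α → NT j α
        moveNT {i} {j} i< j< {α} nt with uniNT α
        ... | inj₁ all = all j j<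
        ... | inj₂ none = ⊥-elim (none i i< nt)

        open Theory.Merge stitched blocks

        module Mg = Chain merged

        -- Replaced bags are never adjacent, since each lies strictly inside its block. So the bags
        -- just before and after a replaced one keep their original paths.
        κ-apart : ∀ {b b′} → b < B → b′ < B → ∀ {k} → MidBlock b k → κ b′ ≡ suc k ⊎ suc (κ b′) ≡ k → κ b ≡ k → ⊥
        κ-apart {b} {b′} b< b′< {k} (lo , hi) adj κb with ℕₚ.<-cmp b b′
        ... | Relation.Binary.Definitions.tri≈ _ refl _ with adj
        ... | inj₁ eq = ℕₚ.1+n≢n (trans (≡sym eq) κb)
        ... | inj₂ eq = ℕₚ.1+n≢n (trans eq (≡sym κb))
        κ-apart {b} {b′} b< b′< {k} (lo , hi) adj κb | Relation.Binary.Definitions.tri< b<b′ _ _ =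
          ℕₚ.<-irrefl refl (ℕₚ.<-≤-trans (below adj) (ℕₚ.≤-trans (block-≤ b s b<b′) (ℕₚ.<⇒≤ (proj₁ (proj₁ (κ-mid b′ b′<))))))
          where
          below : κ b′ ≡ suc k ⊎ suc (κ b′) ≡ k → κ b′ < s + b * s
          below (inj₁ eq) = subst (_< s + b * s) (≡sym eq) hi
          below (inj₂ eq) = ℕₚ.≤-trans (ℕₚ.≤-reflexive eq) (ℕₚ.≤-trans (ℕₚ.n≤1+n k) (ℕₚ.<⇒≤ hi))
        κ-apart {b} {b′} b< b′< {k} (lo , hi) adj κb | Relation.Binary.Definitions.tri> _ _ b′<b =
          ℕₚ.<-irrefl refl (ℕₚ.<-≤-trans (proj₂ (proj₁ (κ-mid b′ b′<))) (ℕₚ.≤-trans (block-≤ b′ s b′<b) (above adj)))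
          where
          above : κ b′ ≡ suc k ⊎ suc (κ b′) ≡ k → b * s ≤ suc (κ b′)
          above (inj₁ eq) = subst (λ z → b * s ≤ suc z) (≡sym eq) (ℕₚ.≤-trans (ℕₚ.<⇒≤ lo) (ℕₚ.m≤n⇒m≤1+n (ℕₚ.n≤1+n k)))
          above (inj₂ eq) = subst (b * s ≤_) (≡sym eq) (ℕₚ.<⇒≤ lo)

        module Block {b} (b< : b < B) where

          k₀ k k₂ : ℕ
          k₀ = pred (κ b)
          k = suc k₀
          k₂ = suc k

          κ≡k : κ b ≡ k
          κ≡k with κ b | proj₁ (proj₁ (κ-mid b b<))
          ... | suc _ | _ = refl

          mid : MidBlock b k
          mid = subst (MidBlock b) κ≡k (proj₁ (κ-mid b b<))

          k₂< : k₂ < M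
          k₂< = ℕₚ.<-≤-trans (proj₂ mid) (ℕₚ.≤-trans (block-≤ b s b<) le)
          k< : k < M
          k< = ℕₚ.<⇒≤ k₂<
          k₀< : k₀ < M
          k₀< = ℕₚ.<⇒≤ k<

          W = Selection.Within blocks b
          w₀ : W k₀
          w₀ = ℕₚ.≤-pred (proj₁ mid) , ℕₚ.<⇒≤ (ℕₚ.<⇒≤ (proj₂ mid))
          w : W k
          w = ℕₚ.<⇒≤ (proj₁ mid) , ℕₚ.<⇒≤ (proj₂ mid)
          w₂ : W k₂
          w₂ = ℕₚ.m≤n⇒m≤1+n (ℕₚ.<⇒≤ (proj₁ mid)) , proj₂ mid

          ¬marked₀ : ¬ Marked k₀
          ¬marked₀ (b′ , b′< , eq) = κ-apart b< b′< mid (inj₂ (cong suc eq)) κ≡k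
          ¬marked₂ : ¬ Marked k₂
          ¬marked₂ (b′ , b′< , eq) = κ-apart b< b′< mid (inj₁ eq) κ≡k

          bad : Violates k (Q k) (π k)
          bad = violated k< (b , b< , κ≡k)

          σ₀ : Fin q → Fin q
          σ₀ = σ k₀

          σ-k : ∀ α → σ k α ≡ σ₀ α
          σ-k α = trans (σ-next k< α) (proj₁ (unmarked k₀< ¬marked₀) (σ₀ α))

          σ-k₂ : ∀ α → σ k₂ α ≡ π k (σ₀ α)
          σ-k₂ α = trans (σ-next k₂< α) (cong (π k) (σ-k α))

          inverse = injective⇒inverse σ₀ (σ-injective k₀<)
          ρ = proj₁ inverse
          σρ : ∀ c → σ₀ (ρ c) ≡ c
          σρ = proj₂ (proj₂ inverse)
          ρ-inj : Injective _≡_ _≡_ ρ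
          ρ-inj {c} {d} eq = trans (≡sym (σρ c)) (trans (cong σ₀ eq) (σρ d))

          inverseπ = injective⇒inverse (π k) (paths-end-injective {y = x (suc k)} (π k) (proj₁ (spec k k<)))
          ψ = proj₁ inverseπ
          πψ : ∀ c → π k (ψ c) ≡ c
          πψ = proj₂ (proj₂ inverseπ)
          ρψ-inj : Injective _≡_ _≡_ (ρ ∘ ψ)
          ρψ-inj {c} {d} eq = trans (≡sym (πψ c)) (trans (cong (π k) (ρ-inj eq)) (πψ d))

          σ₂ρψ : ∀ c → σ k₂ (ρ (ψ c)) ≡ c
          σ₂ρψ c = trans (σ-k₂ _) (trans (cong (π k) (σρ (ψ c))) (πψ c))

          substE : ∀ {i c c′ d d′} → c′ ≡ c → d′ ≡ d → E i c d → E i c′ d′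
          substE refl refl e = e

          early-e : ∀ {c d} → E k₀ c d → Mg.E b (ρ c) (ρ d)
          early-e e = merged-e⁺ b< w₀ (stitched-e′ k₀< ¬marked₀ (substE (σρ _) (σρ _) e))

          early-nt : ∀ {c} → NT k₀ c → Mg.NT b (ρ c)
          early-nt {c} nt = merged-nt⁺ b< w₀ (stitched-nt k₀< ¬marked₀ (subst (NT k₀) (≡sym (σρ c)) nt))

          late-e : ∀ {c d α β} → σ k₂ α ≡ c → σ k₂ β ≡ d → E k₂ c d → Mg.E b α β
          late-e p q e = merged-e⁺ b< w₂ (stitched-e′ k₂< ¬marked₂ (substE p q e))

          late-nt : ∀ {c} → NT k₂ c → Mg.NT b (ρ (ψ c))
          late-nt {c} nt = merged-nt⁺ b< w₂ (stitched-nt k₂< ¬marked₂ (subst (NT k₂) (≡sym (σ₂ρψ c)) nt))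

          mid-e : ∀ {c d} → Joined (U k) (onQ (Q k)) c d → Mg.E b (ρ c) (ρ d)
          mid-e {c} {d} j = merged-e⁺ b< w (stitched-e (subst (λ z → Joined (U k) (onQ (Q k)) z _) (≡sym (trans (σ-k _) (σρ c)))
            (subst (Joined (U k) (onQ (Q k)) c) (≡sym (trans (σ-k _) (σρ d))) j)))

          new-nt : ∀ {α β} → NT k α ⊎ NT k β → Mg.NT b (ρ α) ⊎ Mg.NT b (ρ β)
          new-nt = map-⊎ (early-nt ∘ moveNT k< k₀<) (early-nt ∘ moveNT k< k₀<)

          fresh : ∀ {α β} → ¬ E k α β → ∀ {c d} → E k₀ c d → ρ c ≡ ρ α → ρ d ≡ ρ β → ⊥
          fresh ¬e e eq eq′ = ¬e (substE (≡sym (ρ-inj eq)) (≡sym (ρ-inj eq′)) (moveE k₀< k< e))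

          denser : Violates k (Q k) (π k) → Many (suc e) (Mg.E b) (Mg.NT b)
          denser (α , β , α≢β , nt , inj₁ (j , ¬e)) = many-suc {E = E k₀} {E′ = Mg.E b} {NT = NT k₀} {NT′ = Mg.NT b} ρ (λ {_} {_} → ρ-inj) early-e early-nt
            (α≢β ∘ ρ-inj) (new-nt nt) (mid-e j) (fresh ¬e) (many k₀ k₀<)
          -- By uniformity the edge between `π k α` and `π k β` also occurs in the next bag, whose
          -- paths with these indices now carry the labels `ρ α` and `ρ β`.
          denser (α , β , α≢β , nt , inj₂ (inj₁ (e′ , ¬e))) = many-suc {E = E k₀} {E′ = Mg.E b} {NT = NT k₀} {NT′ = Mg.NT b} ρ (λ {_} {_} → ρ-inj) early-e early-nt
            (α≢β ∘ ρ-inj) (new-nt nt)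
            (late-e (trans (σ-k₂ _) (cong (π k) (σρ α))) (trans (σ-k₂ _) (cong (π k) (σρ β))) (moveE k< k₂< e′))
            (fresh ¬e) (many k₀ k₀<)
          -- The edge between α and β is seen in the bag before; it is new, since in the bag behind
          -- the labels `ρ α` and `ρ β` belong to `π k α` and `π k β`, which are not joined.
          denser (α , β , α≢β , nt , inj₂ (inj₂ (e′ , ¬e))) = many-suc {E = E k₂} {E′ = Mg.E b} {NT = NT k₂} {NT′ = Mg.NT b} (ρ ∘ ψ) (λ {_} {_} → ρψ-inj)
            (late-e (σ₂ρψ _) (σ₂ρψ _)) late-nt
            (α≢β ∘ ρ-inj) (new-nt nt) (early-e (moveE k< k₀< e′))
            (λ {c} {d} ec eq eq′ → ¬e (substE (back eq) (back eq′) (moveE k₂< k< ec))) (many k₂ k₂<)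
            where
            back : ∀ {c γ} → ρ (ψ c) ≡ ρ γ → π k γ ≡ c
            back {c} eq = trans (cong (π k) (≡sym (ρ-inj eq))) (πψ c)

      densified : Σ (Chain q B) λ C′ → ManyEdges C′ (suc e)
      densified = merged , λ b b< → Block.denser b< (Block.bad b<)

  record StableChain (q l : ℕ) : Set where
    field
      C        : Chain q l
      uniNT    : UniformNT C
      uniE     : UniformE C
      attached : ∀ i → i < l → AttachedAt C i
      stable   : ∀ i → i < l → Units.StableAt C i

  restrict : ∀ {q M e} (Rg : Regular q M e) b {l} (le : l + b ≤ M) →
             (∀ i → i < l → Units.StableAt (Regular.C Rg) (i + b)) → StableChain q l
  restrict Rg b {l} le stable = record
    { C = window C b le
    ; uniNT = λ α → map-⊎ (λ h i i< → h (i + b) (lt i<)) (λ h i i< → h (i + b) (lt i<)) (uniNT α)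
    ; uniE = λ α β → map-⊎ (λ h i i< → h (i + b) (lt i<)) (λ h i i< → h (i + b) (lt i<)) (uniE α β)
    ; attached = λ i i< → attached (i + b) (lt i<)
    ; stable = stable }
    where
    open Regular Rg
    lt : ∀ {i} → i < l → i + b < _
    lt i< = ℕₚ.≤-trans (ℕₚ.+-monoˡ-≤ b i<) le

  module _ (q l : ℕ) where

    module Search {e B} (Rg : Regular q (B * suc (suc l)) e) where

      open Densify Rg B l ℕₚ.≤-refl
      open Units (Regular.C Rg)

      private
        s : ℕ
        s = suc (suc l)

      Found : ℕ → ℕ → Set
      Found b k = MidBlock b k × UnstableAt k

      look : ∀ b i → i < l → StableAt (i + suc (b * s)) ⊎ ∃ (Found b)
      -- The offset `suc` skips the first bag of the block, and `i < l` leaves out its last.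
      look b i i< = map-⊎ id (λ bad → i + suc (b * s) , (ℕₚ.m≤n+m (suc (b * s)) i ,
        subst (λ z → suc z < s + b * s) (≡sym (ℕₚ.+-suc i (b * s))) (s≤s (s≤s (ℕₚ.+-monoˡ-≤ (b * s) i<)))) , bad)
        (stable⊎ (i + suc (b * s)))

      search : ∀ b → b < B → ∃ (Found b) ⊎ StableChain q l
      search b b< = conclude (all<⊎ l (look b))
        where
        conclude : (∀ i → i < l → StableAt (i + suc (b * s))) ⊎ ∃ (Found b) → ∃ (Found b) ⊎ StableChain q l
        conclude (inj₂ found) = inj₁ found
        conclude (inj₁ ok) = inj₂ (restrict Rg (suc (b * s))
          (ℕₚ.≤-trans (ℕₚ.≤-reflexive (ℕₚ.+-suc l (b * s))) (ℕₚ.≤-trans (ℕₚ.n≤1+n _) (block-≤ b s b<))) ok)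

      stable-or-denser : StableChain q l ⊎ Σ (Chain q B) λ C′ → ManyEdges C′ (suc e)
      stable-or-denser = finish (all<⊎ B search)
        where
        finish : (∀ b → b < B → ∃ (Found b)) ⊎ StableChain q l → StableChain q l ⊎ Σ (Chain q B) λ C′ → ManyEdges C′ (suc e)
        finish (inj₂ done) = inj₁ done
        finish (inj₁ found) = let κ , κ-mid = choose B 0 found in inj₂ (densified κ κ-mid)

    -- Every round either ends with a stable block or gains one ordered pair; running out of rounds
    -- would mean `suc (q * q)` distinct pairs in bag 0.
    stabilize : ∀ r e → r + e ≡ suc (q * q) → ∀ {M} (C : Chain q M) → ManyEdges C e → mainBound q l r ≤ M → StableChain q l
    stabilize zero e refl C many le = ⊥-elim (ℕₚ.<-irrefl refl
      (let f , inj , _ = many 0 le in injective-pairs⇒≤ (suc (q * q)) q f inj))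
    stabilize (suc r) e eq C many le = continue (Search.stable-or-denser (regularize C many le))
      where
      continue : (StableChain q l ⊎ Σ (Chain q (mainBound q l r)) λ C′ → ManyEdges C′ (suc e)) → StableChain q l
      continue (inj₁ done) = done
      continue (inj₂ (C′ , many′)) = stabilize r (suc e) (trans (ℕₚ.+-suc r e) eq) C′ many′ ℕₚ.≤-refl

-- The decomposition defined by a stable chain

startsAt-unique : {A : Set} {L : List A} {x y : A} → StartsAt L x → StartsAt L y → x ≡ y
startsAt-unique (_ , refl) (_ , refl) = refl

endsAt-unique : {A : Set} {L : List A} {x y : A} → EndsAt L x → EndsAt L y → x ≡ y
endsAt-unique (pre , refl) (pre′ , eq) = Listₚ.∷ʳ-injectiveʳ pre pre′ eq

pathEdge-∈ : {A : Set} {L : List A} {u v : A} → PathEdge L u v → u ∈ₗ L × v ∈ₗ L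
pathEdge-∈ (inj₁ (ls , _ , refl)) = Memₚ.∈-++⁺ʳ ls (here refl) , Memₚ.∈-++⁺ʳ ls (there (here refl))
pathEdge-∈ (inj₂ (ls , _ , refl)) = Memₚ.∈-++⁺ʳ ls (there (here refl)) , Memₚ.∈-++⁺ʳ ls (here refl)

module Translation (G : Graph) where

  open GraphBasics G
  open Connections G

  trivial⇒loop : ∀ {x y L} → Walk _~_ x y L → Trivial L → x ≡ y
  trivial⇒loop nil _ = refl
  trivial⇒loop (cons _ nil) ()
  trivial⇒loop (cons _ (cons _ _)) ()

  loop⇒trivial : ∀ {x y L} → Walk _~_ x y L → Unique L → x ≡ y → Trivial L
  loop⇒trivial w u refl = cong length (walk-loop w u)

  module _ (U : V G → Set) {q : ℕ} (Vs : Fin q → V G → Set) (Es : Fin q → V G → V G → Set) where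

    open Bridges G U Vs Es

    attaches⇒joined : ∀ {α β} → α ≢ β → Attaches2 α β → Joined U Vs α β
    attaches⇒joined ne (inj₁ (u , v , _ , _ , e , _ , u∈ , v∈)) = u , v , u∈ , v∈ , inj₁ (ne , e)
    attaches⇒joined ne (inj₂ (u , v , c , c′ , u∈ , v∈ , _ , _ , r , e , e′)) = u , v , u∈ , v∈ , inj₂ (c , c′ , e , e′ , r)

    induced-attaches⇒joined : (∀ γ u v → Vs γ u → Vs γ v → u ~ v → Es γ u v) → ∀ {α β} → Attaches2 α β → Joined U Vs α β
    induced-attaches⇒joined ind {α} {β} (inj₁ (u , v , _ , _ , e , ¬es , u∈ , v∈)) = u , v , u∈ , v∈ ,
      inj₁ ((λ { refl → ¬es (α , ind α u v u∈ v∈ e) }) , e)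
    induced-attaches⇒joined ind (inj₂ (u , v , c , c′ , u∈ , v∈ , _ , _ , r , e , e′)) = u , v , u∈ , v∈ , inj₂ (c , c′ , e , e′ , r)

    joined⇒attaches : (∀ {γ u v} → Es γ u v → Vs γ u × Vs γ v) → (∀ {γ δ v} → Vs γ v → Vs δ v → γ ≡ δ) →
                      (∀ {γ v} → Vs γ v → U v) → ∀ {α β} → Joined U Vs α β → Attaches2 α β
    joined⇒attaches on disj sub (u , v , u∈ , v∈ , inj₁ (ne , e)) = inj₁ (u , v , sub u∈ , sub v∈ , e ,
      (λ (γ , es) → ne (trans (disj u∈ (proj₁ (on es))) (disj (proj₂ (on es)) v∈))) , u∈ , v∈)
    joined⇒attaches on disj sub (u , v , u∈ , v∈ , inj₂ (c , c′ , e , e′ , r)) =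
      inj₂ (u , v , c , c′ , u∈ , v∈ , reach-start r , reach-end r , r , e , e′)

module Realize (G : Graph) (p : ℕ) (conn : Connected G p) (o o′ : V G) {q l : ℕ}
               (SC : Stability.StableChain G p conn o o′ q (suc l)) where

  open Stability G p conn o o′
  open StableChain SC
  open Chain C
  open Theory C
  open Units C
  open Translation G

  M : ℕ
  M = suc l

  L : ℕ
  L = suc M

  private module P {i} (i< : i < M) = Paths (paths i i<)

  -- With ∅ prepended and the full vertex set appended, the end bags have the same form Bag (B i) (B (suc i))
  -- as the inner ones.
  abstract

    B : ℕ → Subset (n G)
    B zero = ∅
    B (suc i) = select (i ≤? M)
      where
      select : Dec (i ≤ M) → Subset (n G)
      select (yes _) = A i
      select (no _)  = full

    ∉B₀ : ∀ {v} → v ∉ B 0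
    ∉B₀ = Subₚ.∉⊥

    B≡A : ∀ {i} → i ≤ M → B (suc i) ≡ A i
    B≡A {i} i≤ with i ≤? M
    ... | yes _ = refl
    ... | no i≰ = ⊥-elim (i≰ i≤)

    B≡full : B (suc L) ≡ full
    B≡full with L ≤? M
    ... | yes L≤ = ⊥-elim (ℕₚ.<-irrefl refl L≤)
    ... | no _   = refl

  B-strict : ∀ i → i < suc L → B i ⊏ B (suc i)
  B-strict zero _ = (λ v∈ → ⊥-elim (∉B₀ v∈)) , o′ ,
    subst (o′ ∈_) (≡sym (B≡A z≤n)) (proj₁ (proj₂ (proper 0 z≤n))) , ∉B₀
  B-strict (suc i) (s≤s i<) = decide (ℕₚ.m≤n⇒m<n∨m≡n (ℕₚ.≤-pred i<))
    where
    rebase : ∀ {X Y} → B (suc i) ≡ X → B (suc (suc i)) ≡ Y → X ⊏ Y → B (suc i) ⊏ B (suc (suc i))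
    rebase refl refl h = h
    decide : i < M ⊎ i ≡ M → B (suc i) ⊏ B (suc (suc i))
    decide (inj₁ lt) = rebase (B≡A (ℕₚ.<⇒≤ lt)) (B≡A lt) (strict i lt)
    decide (inj₂ i≡M) = rebase (B≡A (ℕₚ.≤-reflexive i≡M)) (trans (cong (λ j → B (suc (suc j))) i≡M) B≡full)
      ((λ _ → Subₚ.∈⊤) , o , Subₚ.∈⊤ , proj₁ (proper i (ℕₚ.≤-reflexive i≡M)))

  B-mono : ∀ {i j} → i ≤ j → j ≤ suc L → ∀ {v} → v ∈ B i → v ∈ B j
  B-mono = monotone B B-strict

  W? : ∀ i → Decidable (Bag (B i) (B (suc i)))
  W? i = bag? (B i) (B (suc i))

  W : ℕ → Subset (n G)
  W i = toSub (W? i)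

  W⁺ : ∀ {i v} → Bag (B i) (B (suc i)) v → v ∈ W i
  W⁺ {i} = ∈toSub⁺ (W? i)

  W⁻ : ∀ {i v} → v ∈ W i → Bag (B i) (B (suc i)) v
  W⁻ {i} = ∈toSub⁻ (W? i)

  W-inner⁺ : ∀ {i} → i < M → ∀ {v} → U i v → v ∈ W (suc i)
  W-inner⁺ {i} i< {v} u = W⁺ (subst (λ X → Bag X (B (suc (suc i))) v) (≡sym (B≡A (ℕₚ.<⇒≤ i<)))
    (subst (λ X → Bag (A i) X v) (≡sym (B≡A i<)) u))

  W-inner⁻ : ∀ {i} → i < M → ∀ {v} → v ∈ W (suc i) → U i v
  W-inner⁻ {i} i< {v} v∈ = subst (λ X → Bag (A i) X v) (B≡A i<)
    (subst (λ X → Bag X (B (suc (suc i))) v) (B≡A (ℕₚ.<⇒≤ i<)) (W⁻ v∈))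

  past-antitone : ∀ {i j} → i ≤ j → j ≤ suc L → ∀ {v} → (v ∈ B j → v ∈ ∂ (B j)) → v ∈ B i → v ∈ ∂ (B i)
  past-antitone {i} {j} i≤ j≤ h v∈ = ∂-antitone (B i) (B j) (B-mono i≤ j≤) v∈ (h (B-mono i≤ j≤ v∈))

  adh⁺ : ∀ {i} → i ≤ M → ∀ {v} → v ∈ ∂ (A i) → v ∈ Adh G W i
  adh⁺ {i} i≤ {v} v∈ = Subₚ.x∈p∩q⁺
    ( W⁺ (v∈B , past-antitone (ℕₚ.n≤1+n i) (s≤s (ℕₚ.m≤n⇒m≤1+n i≤)) (λ _ → v∈∂B))
    , W⁺ (B-mono (ℕₚ.n≤1+n (suc i)) (s≤s (s≤s i≤)) v∈B , λ _ → v∈∂B))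
    where
    v∈∂B : v ∈ ∂ (B (suc i))
    v∈∂B = subst (λ X → v ∈ ∂ X) (≡sym (B≡A i≤)) v∈
    v∈B : v ∈ B (suc i)
    v∈B = ∂⊆ (B (suc i)) v∈∂B

  adh⁻ : ∀ {i} → i ≤ M → ∀ {v} → v ∈ Adh G W i → v ∈ ∂ (A i)
  adh⁻ {i} i≤ {v} v∈ = subst (λ X → v ∈ ∂ X) (B≡A i≤) (proj₂ (W⁻ (proj₂ both)) (proj₁ (W⁻ (proj₁ both))))
    where both = Subₚ.x∈p∩q⁻ (W i) (W (suc i)) v∈

  edge-cover-B : ∀ {u v k} → k ≤ L → u ~ v → ¬ (u ∈ B k × v ∈ B k) → u ∈ B (suc k) → v ∈ B (suc k) → u ∈ W k × v ∈ W k
  edge-cover-B {u} {v} {k} k≤ e ¬both u∈ v∈ =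
    W⁺ (u∈ , λ u∈k → ∂⁺ (B k) u∈k e (λ v∈k → ¬both (u∈k , v∈k))) ,
    W⁺ (v∈ , λ v∈k → ∂⁺ (B k) v∈k (~-sym e) (λ u∈k → ¬both (u∈k , v∈k)))

  ∈top : ∀ {v} → v ∈ B (suc L)
  ∈top {v} = subst (v ∈_) (≡sym B≡full) Subₚ.∈⊤

  -- Merging all inner bags into one yields the foundational linkage, and the bridge graph of this
  -- bag is the auxiliary graph.
  S₁ : Selection M 1
  S₁ = record { f = λ { zero → 0 ; (suc _) → M } ; inc = λ { zero _ → s≤s z≤n ; (suc _) (s≤s ()) } ; end = ℕₚ.≤-refl }

  open Merge S₁
  private
    module M₁ = Chain merged
    module P₁ = Paths (M₁.paths 0 (s≤s z≤n))

  0<1 : 0 < 1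
  0<1 = s≤s z≤n

  in-S₁ : ∀ {k} → k < M → Selection.Within S₁ 0 k
  in-S₁ k< = z≤n , k<

  P : Fin q → List (V G)
  P = M₁.R 0

  linkage : Linkage G (λ _ → ⊤) (λ v → v ∈ Adh G W 0) (λ v → v ∈ Adh G W M) q P
  linkage = (λ α → walk⇒isPath (P₁.walk α) (P₁.unique α) , (λ _ _ → tt) ,
      (x 0 α , walk-head (P₁.walk α) , adh⁺ z≤n (x∈ˡ 0 (s≤s z≤n) α)) ,
      (x M α , walk-last (P₁.walk α) , adh⁺ ℕₚ.≤-refl (x∈ʳ l ℕₚ.≤-refl α))) ,
    λ α β v ne a b → ne (P₁.disj a b)

  slim-W : Slim G L q W
  slim-W = record
    { length≥1 = s≤s z≤n
    ; L1-vert = λ v → let k , _ , k< , ¬p , p = find-step (λ i → v Subₚ.∈? B i) z≤n ∉B₀ ∈top in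
        k , ℕₚ.≤-pred k< , W⁺ (p , ⊥-elim ∘ ¬p)
    ; L1-edge = λ u v e → let k , _ , k< , ¬p , (pu , pv) = find-step (λ i → (u Subₚ.∈? B i) ×-dec (v Subₚ.∈? B i)) z≤n
                                (∉B₀ ∘ proj₁) (∈top , ∈top) in
        k , ℕₚ.≤-pred k< , edge-cover-B (ℕₚ.≤-pred k<) e ¬p pu pv
    ; L2 = λ i j k i≤j j≤k k≤ v∈ → let both = Subₚ.x∈p∩q⁻ (W i) (W k) v∈ in
        W⁺ (B-mono (s≤s i≤j) (s≤s (ℕₚ.≤-trans j≤k k≤)) (proj₁ (W⁻ (proj₁ both))) ,
            past-antitone j≤k (ℕₚ.m≤n⇒m≤1+n k≤) (proj₂ (W⁻ (proj₂ both))))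
    ; L3 = λ i i< → trans (ℕₚ.≤-antisym (Subₚ.p⊆q⇒∣p∣≤∣q∣ {p = Adh G W i} {q = ∂ (A i)} (adh⁻ (ℕₚ.≤-pred i<)))
                                        (Subₚ.p⊆q⇒∣p∣≤∣q∣ {p = ∂ (A i)} {q = Adh G W i} (adh⁺ (ℕₚ.≤-pred i<))))
                          (card i (ℕₚ.≤-pred i<))
    ; L4 = incomparable ; L5 = P , linkage }
    where
    -- Everything in `W j` is past the separation that bounds `W i` on the right, so a bag contained
    -- in a later one consists of adhesion vertices only. For the first bag, the vertex `o′`
    -- contradicts this.
    into-∂ : ∀ {i j} → i < j → j ≤ L → W i ⊆ W j → ∀ {v} → v ∈ W i → v ∈ ∂ (B (suc i))
    into-∂ {i} {j} i< j≤ sub v∈ = past-antitone i< (ℕₚ.m≤n⇒m≤1+n j≤) (proj₂ (W⁻ (sub v∈))) (proj₁ (W⁻ v∈))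
    incomparable : ∀ i j → i ≤ L → j ≤ L → i ≢ j → ¬ (W i ⊆ W j)
    incomparable i j i≤ j≤ i≢j sub with ℕₚ.<-cmp i j | B-strict i (s≤s i≤)
    ... | Relation.Binary.Definitions.tri≈ _ eq _ | _ = i≢j eq
    ... | Relation.Binary.Definitions.tri> _ _ j<i | _ , y , y∈ , y∉ =
      y∉ (B-mono j<i (ℕₚ.m≤n⇒m≤1+n i≤) (proj₁ (W⁻ (sub (W⁺ (y∈ , ⊥-elim ∘ y∉))))))
    incomparable zero j i≤ j≤ i≢j sub | Relation.Binary.Definitions.tri< i<j _ _ | _ =
      proj₂ (proj₂ (proper 0 z≤n)) (subst (λ X → o′ ∈ ∂ X) (B≡A z≤n) (into-∂ i<j j≤ (λ {_} → sub) (W⁺ (subst (o′ ∈_) (≡sym (B≡A z≤n)) (proj₁ (proj₂ (proper 0 z≤n))) , ⊥-elim ∘ ∉B₀))))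
    -- As `W (suc i)` contains `∂ (A i)`, the latter would be a subset of the equally large
    -- `∂ (A (suc i))` that misses the new vertex `y`.
    incomparable (suc i) j i≤ j≤ i≢j sub | Relation.Binary.Definitions.tri< i<j _ _ | _ , y , y∈ , y∉ =
      ℕₚ.<-irrefl refl (begin-strict
        q                        ≡⟨ card i (ℕₚ.<⇒≤ i<M) ⟨
        ∣ ∂ (A i) ∣              ≤⟨ Subₚ.p⊆q⇒∣p∣≤∣q∣ misses ⟩
        ∣ ∂ (A (suc i)) - y ∣    <⟨ Subₚ.x∈p⇒∣p-x∣<∣p∣ (into (W⁺ (y∈ , ⊥-elim ∘ y∉))) ⟩
        ∣ ∂ (A (suc i)) ∣        ≡⟨ card (suc i) i<M ⟩
        q                        ∎)
      where
      open ℕₚ.≤-Reasoning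
      i<M : suc i ≤ M
      i<M = ℕₚ.≤-pred (ℕₚ.<-≤-trans i<j j≤)
      into : ∀ {v} → v ∈ W (suc i) → v ∈ ∂ (A (suc i))
      into {v} v∈ = subst (λ X → v ∈ ∂ X) (B≡A i<M) (into-∂ i<j j≤ (λ {_} → sub) v∈)
      misses : ∂ (A i) ⊆ ∂ (A (suc i)) - y
      misses {v} v∈ = Subₚ.x∈p∧x≢y⇒x∈p-y (into (proj₂ (Subₚ.x∈p∩q⁻ (W i) (W (suc i)) (adh⁺ (ℕₚ.<⇒≤ i<M) v∈))))
        λ { refl → y∉ (∂⊆ (B (suc i)) (subst (λ X → y ∈ ∂ X) (≡sym (B≡A (ℕₚ.<⇒≤ i<M))) v∈)) }

  PW : ℕ → Fin q → List (V G)
  PW i = R (pred i)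

  inner : ∀ {i} → Inner G L i → ∃ λ k → i ≡ suc k × k < M
  inner (s≤s z≤n , s≤s k<) = _ , refl , k<

  module _ {k} (k< : k < M) where

    private
      Wk : V G → Set
      Wk v = v ∈ W (suc k)

    nonTrivial⇒NT : ∀ {α} → NonTrivial (R k α) → NT k α
    nonTrivial⇒NT nt eq = nt (loop⇒trivial (P.walk k< _) (P.unique k< _) eq)

    NT⇒nonTrivial : ∀ {α} → NT k α → NonTrivial (R k α)
    NT⇒nonTrivial nt tr = nt (trivial⇒loop (P.walk k< _) tr)

    e⇒attaches : ∀ {α β} → E k α β → Bridges.Attaches2 G Wk (LV G (R k)) (LE G (R k)) α β
    e⇒attaches e = joined⇒attaches Wk (LV G (R k)) (LE G (R k)) pathEdge-∈ (P.disj k<)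
      (λ v∈ → W-inner⁺ k< (P.inside k< _ v∈)) (joined-cong (W-inner⁺ k<) id id e)

    attaches⇒e : ∀ {α β} → Bridges.Attaches2 G Wk (LV G (R k)) (LE G (R k)) α β → E k α β
    attaches⇒e a = joined-cong (W-inner⁻ k<) id id
      (induced-attaches⇒joined Wk (LV G (R k)) (LE G (R k)) (PAttached.induced (attached k k<)) a)

    attached-W : Attached G p Wk (R k)
    attached-W = PAttached.induced (attached k k<) , bridge
      where
      open Bridges G Wk (LV G (R k)) (LE G (R k))
      bridge : ∀ α c → NonTrivial (R k α) → NTAttach c α → _
      bridge α c nt a with PAttached.attached (attached k k<) α c (nonTrivial⇒NT nt) (att-cong (W-inner⁻ k<) id id a)
      ... | inj₁ (β , β≢ , ntβ , aβ) = inj₁ (β , β≢ , NT⇒nonTrivial ntβ , att-cong (W-inner⁺ k<) id id aβ)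
      ... | inj₂ (g , inj , ok) = inj₂ (g , (λ {_} {_} → inj) , λ j →
        loop⇒trivial (P.walk k< _) (P.unique k< _) (proj₁ (ok j)) , e⇒attaches (proj₂ (ok j)))

    e-transfer : ∀ {α β} → E k α β → ∀ {j} → j < M → E j α β
    e-transfer {α} {β} e {j} j< with uniE α β
    ... | inj₁ all = all j j<
    ... | inj₂ none = ⊥-elim (none k k< e)

    trivial-everywhere : ∀ {α} → Trivial (R k α) → Trivial (P α)
    trivial-everywhere {α} tr = decide (M₁.x 0 α ≟ M₁.x 1 α)
      where
      decide : Dec (M₁.x 0 α ≡ M₁.x 1 α) → Trivial (P α)
      decide (yes eq) = loop⇒trivial (P₁.walk α) (P₁.unique α) eq
      decide (no nt) = let j , w , ntj = merged-nt⁻ 0<1 nt in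
        ⊥-elim (nt-somewhere (proj₂ w) ntj)
        where
        nt-somewhere : ∀ {j} → j < M → NT j α → ⊥
        nt-somewhere {j} j< ntj with uniNT α
        ... | inj₁ all = all k k< (trivial⇒loop (P.walk k< α) tr)
        ... | inj₂ none = none j j< ntj

    nonTrivialP⇒NT : ∀ {α} → NonTrivial (P α) → NT k α
    nonTrivialP⇒NT nt = nonTrivial⇒NT (nt ∘ trivial-everywhere)

    innerUnion⇒bag : ∀ {v} → InnerUnion G L W v → Bag (A 0) (A M) v
    innerUnion⇒bag (i , inn , v∈) with inner inn
    ... | j , refl , j< = bag-widen (s≤s z≤n) ℕₚ.≤-refl z≤n j< (W-inner⁻ j< v∈)

    bag⇒innerUnion : ∀ {v} → Bag (A 0) (A M) v → InnerUnion G L W v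
    bag⇒innerUnion b with vertex-cover (s≤s z≤n) ℕₚ.≤-refl b
    ... | j , _ , j< , u = suc j , (s≤s z≤n , s≤s j<) , W-inner⁺ j< u

    -- An edge of the auxiliary graph arises in a single bag and hence, by uniformity, in every bag.
    -- So this graph is the bridge graph of any inner bag, and stability can be checked bag by bag.
    Γ⇒e : ∀ {α β} → ΓEdge G L W P α β → α ≢ β × E k α β
    Γ⇒e (ne , a) = ne , (let j , w , e = merged-e⁻ 0<1 (joined-cong innerUnion⇒bag proj₁ (λ v∈ → v∈ , bag⇒innerUnion (P₁.inside _ v∈))
                              (attaches⇒joined (InnerUnion G L W) (RV G L W P) (RE G L W P) ne a))
                         in back (proj₂ w) e)
      where
      back : ∀ {j} → j < M → E j _ _ → E k _ _
      back {j} j< e with uniE _ _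
      ... | inj₁ all = all k k<
      ... | inj₂ none = ⊥-elim (none j j< e)

    e⇒Γ : ∀ {α β} → α ≢ β → E k α β → ΓEdge G L W P α β
    e⇒Γ ne e = ne , joined⇒attaches (InnerUnion G L W) (RV G L W P) (RE G L W P)
      (λ (pe , iu , iv) → (proj₁ (pathEdge-∈ pe) , iu) , (proj₂ (pathEdge-∈ pe) , iv))
      (λ a b → P₁.disj (proj₁ a) (proj₁ b)) proj₂
      (joined-cong bag⇒innerUnion (λ v∈ → v∈ , bag⇒innerUnion (P₁.inside _ v∈)) proj₁ (merged-e⁺ 0<1 (in-S₁ k<) e))

    module _ (Q : Fin q → List (V G))
             (link : Linkage G Wk (λ v → v ∈ Adh G W k) (λ v → v ∈ Adh G W (suc k)) q Q)
             (starts : ∀ α → ∃ λ y → StartsAt (R k α) y × StartsAt (Q α) y) where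

      private
        ends : ∀ α → ∃ λ y → EndsAt (Q α) y × y ∈ Adh G W (suc k)
        ends α = proj₂ (proj₂ (proj₂ (proj₁ link α)))

      labelled : (π : Fin q → Fin q) → (∀ α → EndsAt (Q α) (x (suc k) (π α))) → Linked-by k Q π
      labelled π end = record
        { walk = λ α → linked⇒walk (proj₂ (proj₂ (proj₁ (proj₁ link α)))) (start α) (end α)
        ; unique = λ α → proj₁ (proj₂ (proj₁ (proj₁ link α)))
        ; inside = λ α v∈ → W-inner⁻ k< (proj₁ (proj₂ (proj₁ link α)) _ v∈)
        ; disj = λ {α} {β} a b → case α ≟ β of λ { (yes e) → e ; (no ne) → ⊥-elim (proj₂ link α β _ ne a b) } }
        where
        start : ∀ α → StartsAt (Q α) (x k α)
        start α = let y , s₁ , s₂ = starts α in subst (StartsAt (Q α)) (startsAt-unique s₁ (walk-head (P.walk k< α))) s₂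

      automorphism : (π : Fin q → Fin q) → (∀ α → ∃ λ y → EndsAt (Q α) y × EndsAt (R k (π α)) y) →
                     Automorphism G (ΓEdge G L W P) π
      automorphism π end = injective⇒inverse π π-inj , λ α β →
          (λ g → let ne , e = Γ⇒e g in e⇒Γ (ne ∘ π-inj) (proj₁ (stable k k< Q π linked α β ne) e)) ,
          (λ g → let ne , e = Γ⇒e g ; ne′ = λ eq → ne (cong π eq) in
                 e⇒Γ ne′ (proj₁ (proj₂ (stable k k< Q π linked α β ne′)) e))
        where
        linked : Linked-by k Q π
        linked = labelled π λ α → let y , e₁ , e₂ = end α in
          subst (EndsAt (Q α)) (endsAt-unique e₂ (walk-last (P.walk k< (π α)))) e₁
        π-inj : Injective _≡_ _≡_ π
        π-inj = paths-end-injective {y = x (suc k)} π linked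

      -- No permutation is given here; it is read off from the ends of the linkage, which are among
      -- the labelled vertices of the right adhesion set.
      no-new-edges : ∀ α β → Bridges.BEdge G Wk (LV G Q) (LE G Q) α β → NonTrivial (P α) ⊎ NonTrivial (P β) → ΓEdge G L W P α β
      no-new-edges α β (ne , a) nt = e⇒Γ ne (proj₂ (proj₂ (stable k k< Q π linked α β ne)) (map-⊎ nonTrivialP⇒NT nonTrivialP⇒NT nt)
        (joined-cong (W-inner⁻ k<) id id (attaches⇒joined Wk (LV G Q) (LE G Q) ne a)))
        where
        label : ∀ α → ∃ λ β → proj₁ (ends α) ≡ x (suc k) β
        label α = ontoʳ k< (adh⁻ k< (proj₂ (proj₂ (ends α))))
        π : Fin q → Fin q
        π = proj₁ ∘ label
        linked : Linked-by k Q π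
        linked = labelled π λ α → subst (EndsAt (Q α)) (proj₂ (label α)) (proj₁ (proj₂ (ends α)))

  stableRegular : StableRegular G p L q W P
  stableRegular = record
    { slim = slim-W ; foundational = linkage ; PW = PW
    ; PW-sub = λ i α inn → case inner inn of λ { (k , refl , k<) →
        merged-infix 0<1 (in-S₁ k<) α ,
        (x k α , walk-head (P.walk k< α) , adh⁺ (ℕₚ.<⇒≤ k<) (x∈ˡ k k< α)) ,
        (x (suc k) α , walk-last (P.walk k< α) , adh⁺ k< (x∈ʳ k k< α)) }
    ; L6 = λ i inn → case inner inn of λ { (k , refl , k<) → attached-W k< }
    ; L7 = λ α i inn → case inner inn of λ { (k , refl , k<) → trivial-everywhere k< }
    ; L8 = λ α β i j inn inn′ a → case inner inn of λ { (k , refl , k<) → case inner inn′ of λ { (k′ , refl , k′<) →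
        e⇒attaches k′< (e-transfer k< (attaches⇒e k< a) k′<) } }
    ; L10 = λ i inn Q link st π en → case inner inn of λ { (k , refl , k<) → automorphism k< Q link st π en }
    ; L11 = λ i inn Q link st α β b nt → case inner inn of λ { (k , refl , k<) → no-new-edges k< Q link st α β b nt } }

-- Combining the bounds

StableDecomposition : (G : Graph) (l p w : ℕ) → Set
StableDecomposition G l p w = Σ ℕ λ L → Σ ℕ λ q → Σ (ℕ → Subset (n G)) λ W → Σ (Fin q → List (V G)) λ P →
  l ≤ L × q ≤ w × StableRegular G p L q W P

module _ (G : Graph) (p : ℕ) (conn : Connected G p) (l w : ℕ) (bricks : ℕ → ℕ)
         (enough : ∀ q → mainBound q (suc l) (suc (q * q)) ≤ bricks q) where

  module _ (o o′ : V G) where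

    open Stability G p conn o o′

    stable-brickChain : ∀ {q} → BrickChain q (bricks q) → StableChain q (suc l)
    -- No edge is guaranteed at the outset, so the count starts at 0 with `suc (q * q)` rounds
    -- ahead.
    stable-brickChain {q} D = stabilize q (suc l) (suc (q * q)) 0 (ℕₚ.+-identityʳ _) (Stitch.stitched D)
      (λ i i< → (λ ()) , (λ { {()} }) , λ ()) (enough q)

    realize : ∀ {q} → q ≤ w → StableChain q (suc l) → StableDecomposition G l p w
    realize {q} q≤ SC = L , q , W , P , ℕₚ.m≤n⇒m≤1+n (ℕₚ.n≤1+n l) , q≤ , stableRegular
      where open Realize G p conn o o′ SC

    slim-realize : ProperChain w (slimBound bricks w) → StableDecomposition G l p w
    slim-realize C = let q , q≤ , D = slim bricks w C in realize q≤ (stable-brickChain D)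

  decompose : ∀ {M} → M ≡ slimBound bricks w → SetChain G w (suc (suc w + M)) → StableDecomposition G l p w
  decompose {M} refl C = let o , o′ , C′ = properChain G w M C in slim-realize o o′ C′

theorem7 : (a l p w : ℕ) → Σ ℕ λ N →
    (G : Graph) → Connected G p → TreeWidthLess G w → N ≤ n G →
    SubdivisionK G a p
    ⊎ (Σ ℕ λ L → Σ ℕ λ q → Σ (ℕ → Subset (n G)) λ W →
    Σ (Fin q → List (V G)) λ P →
    l ≤ L × q ≤ w × StableRegular G p L q W P)
theorem7 a l p w = chainBound (starCount p a w) w (suc (suc w + M)) , λ G conn td large →
  result G conn (TreeChain.longChain G p conn w a (suc (suc w + M)) td large)
  where
  bricks : ℕ → ℕ
  -- The length `suc l` ensures at least one inner bag, from which the foundational linkage is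
  -- obtained.
  bricks q = mainBound q (suc l) (suc (q * q))
  M : ℕ
  M = slimBound bricks w
  result : ∀ G → Connected G p → SubdivisionK G a p ⊎ SetChain G w (suc (suc w + M)) →
           SubdivisionK G a p ⊎ StableDecomposition G l p w
  result G conn (inj₁ K) = inj₁ K
  result G conn (inj₂ C) = inj₂ (decompose G p conn l w bricks (λ q → ℕₚ.≤-refl) refl C)
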